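{- Let $n\ge 3$, let $M,N\in\mathbb{Z}^{n-1}$ and let $D=(D_1,\dots,D_{n-1})$ be a tuple of positive integers. If $\gcd(D_1,D_2\cdots D_{n-1})=1$, then the long Weyl element Kloosterman sums satisfy $$S_n(M,N;D)=S_2(D_2M_1,N_1;D_1)\cdot S_{n-1}\big(M'',(N_2,\dots,N_{n-1});(D_2,\dots,D_{n-1})\big),$$ where $M''=(D_1M_2,M_3,\dots,M_{n-1})$.
   Context: Definition of $S_n(M,N;D)$ for any $n\ge2$, $M,N\in\mathbb{Z}^{n-1}$ and $D$ an $(n-1)$-tuple of positive integers: $e(z)=e^{2\pi i z}$. $U$ is the group of upper triangular unipotent $n\times n$ matrices. For $N\in\mathbb{Z}^{n-1}$, $\psi_N$ is the character of $U(\mathbb{R})$, trivial on $U(\mathbb{Z})$, given by $\psi_N(u)=e(N_1u_{1,2}+N_2u_{2,3}+\cdots+N_{n-1}u_{n-1,n})$. For $M\in \mathbb{Z}^{n-1}$, $\tilde M=(M_{n-1},\dots,M_1)$. Let $w_0$ be the long Weyl element: the $n\times n$ matrix whose only nonzero entries are on the anti-diagonal, the entry at position $(n-k+1,k)$ being $(-1)^{k-1}$ ($1\le k\le n$). Let $c=\mathrm{Diag}(1/D_{n-1},\,D_{n-1}/D_{n-2},\dots,D_2/D_1,\,D_1)$, $C(c)=U(\mathbb{R})\,c\,w_0\,U(\mathbb{R})\cap SL(n,\mathbb{Z})$ and $X(c)=U(\mathbb{Z})\backslash C(c)/U(\mathbb{Z})$. Each $\gamma\in C(c)$ is uniquely $\gamma=b_1cw_0b_2$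 with $b_1,b_2\in U(\mathbb{R})$; set $\mu(\gamma)=b_1\in U(\mathbb{Z})\backslash U(\mathbb{R})$ and $\mu'(\gamma)=b_2\in U(\mathbb{R})/U(\mathbb{Z})$. Then $$S_n(M,N;D)=\sum_{x\in X(c)}\psi_{\tilde M}(\mu(x))\,\psi_N(\mu'(x)).$$ For $n=2$ the arguments are integers (1-tuples). -}

module Defs where

open import Algebra.Apartness.Bundles using (HeytingCommutativeRing; HeytingField)
open import Algebra.Bundles using (CommutativeRing)
open import Data.Bool.Base using (if_then_else_)
open import Data.Fin.Base as Fin using (Fin; zero; suc; inject₁; opposite; punchIn; toℕ)
open import Data.Fin.Properties using () renaming (_≟_ to _≟ᶠ_)
open import Data.Integer.Base as ℤ using (ℤ; +_; -[1+_])
import Data.Integer.Properties as ℤ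
open import Data.Irrelevant using ([_])
open import Data.List.Base as List using (List)
import Data.List.Relation.Unary.Enumerates.Setoid as Enumerates
import Data.List.Relation.Unary.Unique.Setoid as Uniqueness
open import Data.Nat.Base as ℕ using (ℕ; zero; suc; NonZero; s≤s)
open import Data.Product.Base using (∃-syntax; _×_; _,_; proj₁; proj₂)
open import Data.Refinement.Base using (Refinement-syntax; _,_; value)
open import Data.Vec.Functional as Vector using (Vector; _∷_; head; tail; reverse)
open import Level using (Level; _⊔_; 0ℓ) renaming (suc to lsuc)
open import Relation.Binary.Bundles using (Setoid)
open import Relation.Binary.PropositionalEquality.Core as ≡ using (_≡_)
open import Relation.Nullary.Decidable.Core using (does)
import Algebra.Properties.Monoid.Mult as Mult
import Algebra.Properties.Ring as RingProperties
import Algebra.Properties.Semiring.Exp as Exp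
import Algebra.Properties.Semiring.Sum as Sum
import Relation.Binary.Reasoning.Setoid as SetoidReasoning

ℕ⁺ : Set
ℕ⁺ = [ n ∈ ℕ ∣ NonZero n ]

1⁺ : ℕ⁺
1⁺ = 1 , [ _ ]

∏ : ∀ {k} → Vector ℕ⁺ k → ℕ
∏ = Vector.foldr (λ d p → value d ℕ.* p) 1

module Matrices {r ℓ} (R : CommutativeRing r ℓ) where

  open CommutativeRing R hiding (zero)
  open Mult +-monoid using () renaming (_×_ to _×′_)
  open Exp semiring using (_^_)
  open Sum semiring using (sum; sum-cong-≋; sum-replicate-zero; ∑-comm;
                           *-distribˡ-sum; *-distribʳ-sum)

  fromℕ : ℕ → Carrier
  fromℕ n = n ×′ 1#

  fromℤ : ℤ → Carrier
  fromℤ (+ n)      = fromℕ n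
  fromℤ (-[1+ n ]) = - fromℕ (suc n)

  Matrix : ℕ → Set r
  Matrix n = Fin n → Fin n → Carrier

  infix 4 _≋_
  _≋_ : ∀ {n} → Matrix n → Matrix n → Set ℓ
  A ≋ B = ∀ i j → A i j ≈ B i j

  infixl 7 _·_
  _·_ : ∀ {n} → Matrix n → Matrix n → Matrix n
  (A · B) i j = sum (λ l → A i l * B l j)

  diag : ∀ {n} → Vector Carrier n → Matrix n
  diag d i j = if does (i ≟ᶠ j) then d i else 0#

  I : ∀ {n} → Matrix n
  I = diag (λ _ → 1#)

  -- Laplace expansion along the first row.
  det : ∀ {n} → Matrix n → Carrier
  det {zero}  A = 1#
  det {suc n} A =
    sum (λ j → (- 1#) ^ toℕ j * (A zero j * det (λ i l → A (suc i) (punchIn j l))))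

  -- With indices counted from 0, column j has its nonzero entry (-1)ʲ in
  -- row n - 1 - j.
  w₀ : ∀ {n} → Matrix n
  w₀ i j = if does (i ≟ᶠ opposite j) then (- 1#) ^ toℕ j else 0#

  IsUpperUnipotent : ∀ {n} → Matrix n → Set ℓ
  IsUpperUnipotent u = (∀ i → u i i ≈ 1#) × (∀ i j → j Fin.< i → u i j ≈ 0#)

  ----------------------------------------------------------------------
  -- The upper unipotent matrices form a group.

  private
    minor : ∀ {n} → Matrix (suc n) → Matrix n
    minor A i j = A (suc i) (suc j)

    minor-U : ∀ {n} {u : Matrix (suc n)} → IsUpperUnipotent u → IsUpperUnipotent (minor u)
    minor-U (d , l) = (λ i → d (suc i)) , λ i j j<i → l (suc i) (suc j) (s≤s j<i)

    sum-0ʳ : ∀ {n} (f : Vector Carrier n) {g : Vector Carrier n} → (∀ l → g l ≈ 0#) → sum (λ l → f l * g l) ≈ 0#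
    sum-0ʳ {n} f g≈0 = trans (sum-cong-≋ (λ l → trans (*-congˡ (g≈0 l)) (zeroʳ (f l))))
                         (sum-replicate-zero n)

    sum-0ˡ : ∀ {n} {f : Vector Carrier n} (g : Vector Carrier n) → (∀ l → f l ≈ 0#) → sum (λ l → f l * g l) ≈ 0#
    sum-0ˡ {n} g f≈0 = trans (sum-cong-≋ (λ l → trans (*-congʳ (f≈0 l)) (zeroˡ (g l))))
                         (sum-replicate-zero n)

    0*+ : ∀ {x y z} → x ≈ 0# → x * y + z ≈ z
    0*+ x≈0 = trans (+-congʳ (trans (*-congʳ x≈0) (zeroˡ _))) (+-identityˡ _)

    1*+0 : ∀ {x y z} → x ≈ 1# → z ≈ 0# → x * y + z ≈ y
    1*+0 x≈1 z≈0 = trans (+-cong (trans (*-congʳ x≈1) (*-identityˡ _)) z≈0) (+-identityʳ _)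

  ≋-sym : ∀ {n} {A B : Matrix n} → A ≋ B → B ≋ A
  ≋-sym p i j = sym (p i j)

  ≋-trans : ∀ {n} {A B C : Matrix n} → A ≋ B → B ≋ C → A ≋ C
  ≋-trans p q i j = trans (p i j) (q i j)

  ·-cong : ∀ {n} {A B C D : Matrix n} → A ≋ B → C ≋ D → A · C ≋ B · D
  ·-cong p q i j = sum-cong-≋ (λ l → *-cong (p i l) (q l j))

  ·-congˡ : ∀ {n} (A : Matrix n) {B C} → B ≋ C → A · B ≋ A · C
  ·-congˡ A = ·-cong {A = A} (λ _ _ → refl)

  ·-congʳ : ∀ {n} (A : Matrix n) {B C} → B ≋ C → B · A ≋ C · A
  ·-congʳ A p = ·-cong {C = A} p (λ _ _ → refl)

  ·-assoc : ∀ {n} (A B C : Matrix n) → (A · B) · C ≋ A · (B · C)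
  ·-assoc A B C i j = begin
    sum (λ l → sum (λ k → A i k * B k l) * C l j)
      ≈⟨ sum-cong-≋ (λ l → *-distribʳ-sum (C l j) (λ k → A i k * B k l)) ⟩
    sum (λ l → sum (λ k → A i k * B k l * C l j))
      ≈⟨ ∑-comm (λ l k → A i k * B k l * C l j) ⟩
    sum (λ k → sum (λ l → A i k * B k l * C l j))
      ≈⟨ sum-cong-≋ (λ k → sum-cong-≋ (λ l → *-assoc (A i k) (B k l) (C l j))) ⟩
    sum (λ k → sum (λ l → A i k * (B k l * C l j)))
      ≈⟨ sum-cong-≋ (λ k → *-distribˡ-sum (A i k) (λ l → B k l * C l j)) ⟨
    sum (λ k → A i k * sum (λ l → B k l * C l j)) ∎
    where open SetoidReasoning setoid

  ·-identityˡ : ∀ {n} (A : Matrix n) → I · A ≋ A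
  ·-identityˡ A i j = go i (λ l → A l j)
    where
    go : ∀ {m} (i : Fin m) (f : Vector Carrier m) → sum (λ l → I i l * f l) ≈ f i
    go zero    f = 1*+0 refl (sum-0ˡ (tail f) (λ _ → refl))
    go (suc i) f = trans (0*+ refl) (go i (tail f))

  ·-identityʳ : ∀ {n} (A : Matrix n) → A · I ≋ A
  ·-identityʳ A i j = go j (A i)
    where
    go : ∀ {m} (j : Fin m) (f : Vector Carrier m) → sum (λ l → f l * I l j) ≈ f j
    go zero    f = trans (+-cong (*-identityʳ _) (sum-0ʳ (tail f) (λ _ → refl))) (+-identityʳ _)
    go (suc j) f = trans (+-cong (zeroʳ _) (go j (tail f))) (+-identityˡ _)

  I-U : ∀ {n} → IsUpperUnipotent (I {n})
  I-U = diagonal , lower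
    where
    diagonal : ∀ {n} (i : Fin n) → I i i ≈ 1#
    diagonal zero    = refl
    diagonal (suc i) = diagonal i
    lower : ∀ {n} (i j : Fin n) → j Fin.< i → I i j ≈ 0#
    lower (suc i) zero    _         = refl
    lower (suc i) (suc j) (s≤s j<i) = lower i j j<i

  ·-U : ∀ {n} {u v : Matrix n} → IsUpperUnipotent u → IsUpperUnipotent v → IsUpperUnipotent (u · v)
  ·-U U V = diagonal U V , lower U V
    where
    diagonal : ∀ {n} {u v : Matrix n} → IsUpperUnipotent u → IsUpperUnipotent v →
               ∀ i → (u · v) i i ≈ 1#
    diagonal {u = u} (d , _) (d′ , l′) zero =
      trans (1*+0 (d zero) (sum-0ʳ (tail (u zero)) (λ l → l′ (suc l) zero (s≤s ℕ.z≤n)))) (d′ zero)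
    diagonal U V (suc i) =
      trans (0*+ (proj₂ U (suc i) zero (s≤s ℕ.z≤n))) (diagonal (minor-U U) (minor-U V) i)
    lower : ∀ {n} {u v : Matrix n} → IsUpperUnipotent u → IsUpperUnipotent v →
            ∀ i j → j Fin.< i → (u · v) i j ≈ 0#
    lower {u = u} (_ , l) (_ , l′) (suc i) zero _ =
      trans (0*+ (l (suc i) zero (s≤s ℕ.z≤n)))
            (sum-0ʳ (tail (u (suc i))) (λ m → l′ (suc m) zero (s≤s ℕ.z≤n)))
    lower U V (suc i) (suc j) (s≤s j<i) =
      trans (0*+ (proj₂ U (suc i) zero (s≤s ℕ.z≤n))) (lower (minor-U U) (minor-U V) i j j<i)

  inv : ∀ {n} → Matrix n → Matrix n
  inv u zero    zero    = 1#
  inv u zero    (suc j) = - sum (λ l → u zero (suc l) * inv (minor u) l j)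
  inv u (suc i) zero    = 0#
  inv u (suc i) (suc j) = inv (minor u) i j

  inv-U : ∀ {n} (u : Matrix n) → IsUpperUnipotent (inv u)
  inv-U u = diagonal u , lower u
    where
    diagonal : ∀ {n} (u : Matrix n) i → inv u i i ≈ 1#
    diagonal u zero    = refl
    diagonal u (suc i) = diagonal (minor u) i
    lower : ∀ {n} (u : Matrix n) i j → j Fin.< i → inv u i j ≈ 0#
    lower u (suc i) zero    _         = refl
    lower u (suc i) (suc j) (s≤s j<i) = lower (minor u) i j j<i

  inv-inverseʳ : ∀ {n} {u : Matrix n} → IsUpperUnipotent u → u · inv u ≋ I
  inv-inverseʳ {u = u} (d , _) zero zero =
    1*+0 (d zero) (sum-0ʳ (tail (u zero)) (λ _ → refl))
  inv-inverseʳ (d , _) zero (suc j) =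
    trans (+-congʳ (trans (*-congʳ (d zero)) (*-identityˡ _))) (-‿inverseˡ _)
  inv-inverseʳ {u = u} (_ , l) (suc i) zero =
    trans (0*+ (l (suc i) zero (s≤s ℕ.z≤n))) (sum-0ʳ (tail (u (suc i))) (λ _ → refl))
  inv-inverseʳ U (suc i) (suc j) =
    trans (0*+ (proj₂ U (suc i) zero (s≤s ℕ.z≤n))) (inv-inverseʳ (minor-U U) i j)

  inv-inverseˡ : ∀ {n} {u : Matrix n} → IsUpperUnipotent u → inv u · u ≋ I
  inv-inverseˡ {u = u} U = ≋-trans (·-congˡ v u≋w) (inv-inverseʳ (inv-U u))
    where
    v = inv u
    w = inv v
    u≋w : u ≋ w
    u≋w = ≋-trans (≋-sym (·-identityʳ u))
         (≋-trans (·-congˡ u (≋-sym (inv-inverseʳ (inv-U u))))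
         (≋-trans (≋-sym (·-assoc u v w))
         (≋-trans (·-congʳ w (inv-inverseʳ U)) (·-identityˡ w))))

module ℤᴹ = Matrices ℤ.+-*-commutativeRing

heytingRing : ∀ {a ℓ₁ ℓ₂} → HeytingField a ℓ₁ ℓ₂ → CommutativeRing a ℓ₁
heytingRing F = HeytingCommutativeRing.commutativeRing (HeytingField.heytingCommutativeRing F)

CharacteristicZero : ∀ {a ℓ₁ ℓ₂} → HeytingField a ℓ₁ ℓ₂ → Set ℓ₂
CharacteristicZero F = ∀ n → .{{NonZero n}} → Matrices.fromℕ (heytingRing F) n # 0#
  where open HeytingField F

-- The library has neither the real nor the complex numbers, so the triple
-- (ℝ, ℂ, z ↦ e(z) = exp(2πiz)) enters through the following properties.  They
-- determine e on ℚ ⊆ ℝ up to a field embedding of ℚ(e(ℚ)): since e is an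
-- injection of ℚ/ℤ into the roots of unity of a field of characteristic zero,
-- a polynomial identity with rational coefficients between the values e(q),
-- q ∈ ℚ, holds in one such triple iff it holds for exp(2πi·).
record ComplexExponential (a ℓ₁ ℓ₂ : Level) : Set (lsuc (a ⊔ ℓ₁ ⊔ ℓ₂)) where
  field
    ℝ ℂ : HeytingField a ℓ₁ ℓ₂

  module ℝ  = HeytingField ℝ
  module ℂ  = HeytingField ℂ
  module ℝᴹ = Matrices (heytingRing ℝ)

  field
    ℝ-char0  : CharacteristicZero ℝ
    ℂ-char0  : CharacteristicZero ℂ
    e        : ℝ.Carrier → ℂ.Carrier
    e-cong   : ∀ {x y} → x ℝ.≈ y → e x ℂ.≈ e y
    e-+      : ∀ x y → e (x ℝ.+ y) ℂ.≈ e x ℂ.* e y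
    e-ℤ      : ∀ m → e (ℝᴹ.fromℤ m) ℂ.≈ ℂ.1#
    e-kernel : ∀ x → e x ℂ.≈ ℂ.1# → ∃[ m ] x ℝ.≈ ℝᴹ.fromℤ m

module Kloosterman {a ℓ₁ ℓ₂} (E : ComplexExponential a ℓ₁ ℓ₂) where

  open ComplexExponential E public

  fromℕ⁺ : ℕ⁺ → ℝ.Carrier
  fromℕ⁺ d = ℝᴹ.fromℕ (value d)

  -- `#⇒invertible` inverts the difference d - 0.
  1/_ : ℕ⁺ → ℝ.Carrier
  1/ (d , [ d≢0 ]) = proj₁ (ℝ.#⇒invertible (ℝ-char0 d {{d≢0}}))

  -- Throughout k = n - 1.  The diagonal of c has numerators
  -- (1, D_{n-1}, …, D₁) and denominators (D_{n-1}, …, D₁, 1).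
  c : ∀ {k} → Vector ℕ⁺ k → ℝᴹ.Matrix (suc k)
  c D = ℝᴹ.diag (λ i → fromℕ⁺ ((1⁺ ∷ reverse D) i) ℝ.* (1/ (reverse (1⁺ ∷ D) i)))

  ψ : ∀ {k} → Vector ℤ k → ℝᴹ.Matrix (suc k) → ℂ.Carrier
  ψ N u = e (sum (λ i → ℝᴹ.fromℤ (N i) ℝ.* u (inject₁ i) (suc i)))
    where open Sum (CommutativeRing.semiring (heytingRing ℝ)) using (sum)

  -- An element γ of C(c), with its (unique) factors b₁ = μ(γ) and b₂ = μ′(γ).
  record C {k} (D : Vector ℕ⁺ k) : Set (a ⊔ ℓ₁) where
    field
      γ       : ℤᴹ.Matrix (suc k)
      det-γ   : ℤᴹ.det γ ≡ + 1
      b₁ b₂   : ℝᴹ.Matrix (suc k)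
      b₁-U    : ℝᴹ.IsUpperUnipotent b₁
      b₂-U    : ℝᴹ.IsUpperUnipotent b₂
      γ≋b₁cwb₂ : (λ i j → ℝᴹ.fromℤ (γ i j)) ℝᴹ.≋ b₁ ℝᴹ.· c D ℝᴹ.· ℝᴹ.w₀ ℝᴹ.· b₂

  open C

  -- The double coset relation of U(ℤ).
  _∼_ : ∀ {k} {D : Vector ℕ⁺ k} → C D → C D → Set
  x ∼ y = ∃[ u ] ∃[ v ] ℤᴹ.IsUpperUnipotent u × ℤᴹ.IsUpperUnipotent v ×
            u ℤᴹ.· γ x ℤᴹ.· v ℤᴹ.≋ γ y

  X : ∀ {k} → Vector ℕ⁺ k → Setoid (a ⊔ ℓ₁) 0ℓ
  X D = record
    { Carrier       = C D
    ; _≈_           = _∼_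
    ; isEquivalence = record
      { refl  = λ {x} → ∼-refl {x}
      ; sym   = λ {x} {y} → ∼-sym {x} {y}
      ; trans = λ {x} {y} {z} → ∼-trans {x} {y} {z}
      }
    }
    where
    open ℤᴹ
    ∼-refl : ∀ {x : C D} → x ∼ x
    ∼-refl {x} = I , I , I-U , I-U ,
      ≋-trans (·-identityʳ (I · γ x)) (·-identityˡ (γ x))

    ∼-sym : ∀ {x y : C D} → x ∼ y → y ∼ x
    ∼-sym {x} {y} (u , v , U , V , uxv≋y) = inv u , inv v , inv-U u , inv-U v ,
      ≋-trans (·-congʳ (inv v) (·-congˡ (inv u) (≋-sym uxv≋y)))
     (≋-trans (·-congʳ (inv v) (≋-sym (·-assoc (inv u) (u · γ x) v)))
     (≋-trans (·-assoc (inv u · (u · γ x)) v (inv v))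
     (≋-trans (·-cong (≋-sym (·-assoc (inv u) u (γ x))) (inv-inverseʳ V))
     (≋-trans (·-identityʳ (inv u · u · γ x))
     (≋-trans (·-congʳ (γ x) (inv-inverseˡ U)) (·-identityˡ (γ x)))))))

    ∼-trans : ∀ {x y z : C D} → x ∼ y → y ∼ z → x ∼ z
    ∼-trans {x} {y} {z} (u , v , U , V , uxv≋y) (u′ , v′ , U′ , V′ , u′yv′≋z) =
      u′ · u , v · v′ , ·-U U′ U , ·-U V V′ ,
      ≋-trans (≋-sym (·-assoc (u′ · u · γ x) v v′))
     (≋-trans (·-congʳ v′
        (≋-trans (·-congʳ v (·-assoc u′ u (γ x)))
        (≋-trans (·-assoc u′ (u · γ x) v) (·-congˡ u′ uxv≋y))))
      u′yv′≋z)

  -- X is finite, and s is the sum of f over X.  As f is summed over an arbitrary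
  -- duplicate-free enumeration of X, s is unique, and f must be well defined on X.
  record IsSumOver {b ℓ} (S : Setoid b ℓ) (f : Setoid.Carrier S → ℂ.Carrier) (s : ℂ.Carrier)
         : Set (b ⊔ ℓ ⊔ ℓ₁) where
    open Enumerates S using (IsEnumeration)
    open Uniqueness S using (Unique)
    field
      finite : ∃[ xs ] IsEnumeration xs × Unique xs
      sum    : ∀ xs → IsEnumeration xs → Unique xs →
               List.foldr ℂ._+_ ℂ.0# (List.map f xs) ℂ.≈ s

  -- S_{k+1}(M, N; D) = s
  S[_,_⨾_]≔_ : ∀ {k} → Vector ℤ k → Vector ℤ k → Vector ℕ⁺ k → ℂ.Carrier → Set (a ⊔ ℓ₁)
  S[ M , N ⨾ D ]≔ s = IsSumOver (X D) (λ x → ψ (reverse M) (b₁ x) ℂ.* ψ N (b₂ x)) s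

{-# OPTIONS --safe #-}
module Submission where

-- Reversing the rows of γ turns γ = b₁ c w₀ b₂ into G = Wᵀ · diag δ · V with W, V upper
-- unipotent, and the double coset relation into G ~ uᵀ · G · v. These equivalences descend
-- to fraction-free Schur complements, so that C(c) consists of the integral matrices with
-- prescribed pivots, and reducing the first row and column modulo the first pivot, then
-- passing to the Schur complement, shows that X(c) is finite with decidable equality.
--
-- Let p = D₁ and t = D₂. Take x ∈ X(D₁) with rows (p, d), (a, b), so that ad - pb = 1, and
-- y ∈ X(D₂, …) whose first row is normalised to (t, pq), with Y₁ below it. The matrix
-- [[p, d, 0], [ta, tb, -q], [0, -Y₁]] has the Schur complement diag(1, p, …, p) · y. This
-- gluing is a bijection from X(D₁) × X(D₂, …) to X(D₁, D₂, …), and the superdiagonals of W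
-- and V for the glued matrix are (t w, p w₁, w₂, …) and (v, v₁, v₂, …) in terms of those
-- for x and y, so the summands multiply.

open import Defs
open import Algebra.Bundles using (CommutativeRing)
import Algebra.Properties.AbelianGroup as AbelianGroupProperties
import Algebra.Properties.CommutativeMonoid.Sum as CommutativeMonoidSum
import Algebra.Properties.CommutativeSemigroup as CommutativeSemigroupProperties
import Algebra.Properties.Monoid.Sum as MonoidSum
import Algebra.Properties.Ring as RingProperties
import Algebra.Properties.Semiring.Exp as Exp
import Algebra.Properties.Semiring.Mult as SemiringMult
import Algebra.Properties.Semiring.Sum as Sum
import Algebra.Solver.Ring as RingSolver
open import Algebra.Solver.Ring.AlmostCommutativeRing
  using (fromCommutativeRing; _-Raw-AlmostCommutative⟶_)
open import Data.Bool.Base using (if_then_else_)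
open import Data.Fin.Base as Fin using (Fin; zero; suc; inject₁; opposite; punchIn; toℕ)
open import Data.Fin.Patterns using (0F; 1F)
import Data.Fin.Permutation as Permutation
open import Data.Fin.Properties as Fin using (_≟_; all?; opposite-involutive; toℕ-fromℕ; toℕ-inject₁)
open import Data.Integer.Base as ℤ using (ℤ; +_; -[1+_]; 0ℤ; 1ℤ)
open import Data.Integer.DivMod as ℤ using (_/ℕ_; _%ℕ_)
open import Data.Integer.Divisibility.Signed as ℤ using (_∣_; divides; _∣?_; ∣n⇒∣m*n)
import Data.Integer.Properties as ℤ
open import Data.Integer.Tactic.RingSolver using (solve-∀)
open import Data.Irrelevant using ([_])
open import Data.List.Base as List using (List)
open import Data.List.Membership.Propositional using (lose; find)
open import Data.List.Membership.Propositional.Properties using (∈-upTo⁺)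
import Data.List.Membership.Setoid as Membership
import Data.List.Membership.Setoid.Properties as MembershipProperties
import Data.List.Relation.Binary.Permutation.Setoid as ListPermutation
import Data.List.Relation.Binary.Permutation.Setoid.Properties as ListPermutationProperties
open import Data.List.Relation.Unary.Any as Any using (Any; here; there)
import Data.List.Relation.Unary.Any.Properties as Any
import Data.List.Relation.Unary.Enumerates.Setoid as Enumerates
import Data.List.Relation.Unary.Enumerates.Setoid.Properties as EnumeratesProperties
import Data.List.Relation.Unary.Unique.DecSetoid.Properties as DecUniquenessProperties
import Data.List.Relation.Unary.Unique.Setoid as Uniqueness
import Data.List.Relation.Unary.Unique.Setoid.Properties as UniquenessProperties
open import Data.Maybe.Base using (Maybe; just; nothing)
open import Data.Nat.Base as ℕ using (ℕ; zero; suc; NonZero; s≤s; z≤n)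
import Data.Nat.Divisibility as ℕ
open import Data.Nat.GCD using (gcd; gcd-GCD; module Bézout)
import Data.Nat.Properties as ℕ
open import Data.Nat.Tactic.RingSolver using () renaming (solve-∀ to solve-∀ᴺ)
open import Data.Product.Base using (∃-syntax; _×_; _,_; proj₁; proj₂)
open import Data.Refinement.Base using (_,_; value)
open import Data.Vec.Functional as Vector using (Vector; tail; init; last; reverse)
open import Function.Base using (_∘_)
open import Level using (_⊔_; 0ℓ)
open import Relation.Binary.Bundles using (Setoid; DecSetoid)
open import Relation.Binary.PropositionalEquality as ≡ using (_≡_; _≢_; subst; module ≡-Reasoning)
import Relation.Binary.Reasoning.Setoid as SetoidReasoning
open import Relation.Nullary.Decidable.Core using (Dec; does; yes; no; map′)
open import Relation.Nullary.Negation.Core using (contradiction)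

-- Two rings are involved: matrices and cosets are integral, the factors W and V real. The
-- equivalence is therefore studied over an arbitrary commutative ring, with cancellation in place
-- of division. A fraction-free Schur complement stays integral and commutes with ℤ → ℝ; the price
-- is that later pivots carry powers of earlier ones, and that the determinant is recovered
-- separately over ℝ. When the pivots can be cancelled, the two unipotent factors of an equivalence
-- are unique. This one fact gives decidability over ℤ and invariance of the summand over ℝ.
--
-- The glued matrix is dictated by its Schur complement. The zeros in its first column make
-- elimination multiply every row below the second by -p, whence -Y₁. In the second row, ta and tb
-- turn ad - pb = 1 into the corner t, while the zeros of the first row leave p times the negated
-- entries. So the first row of y must consist of multiples of p beyond its corner, which can be
-- arranged because t is a unit modulo p. The scaling diag(1, p, ..., p) produces the argument D₁M₂,
-- and the factor t in ta produces D₂M₁.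

module FiniteSums where

  -- Duplicate-free enumerations of a setoid and finite sums over them.

  open import Data.List.Base using ([]; _∷_; _++_)
  open import Data.List.Relation.Unary.AllPairs using (_∷_)

  module _ {b ℓ} (S : Setoid b ℓ) where

    open Setoid S
    open Membership S using (_∈_)
    open MembershipProperties using (∈-∃++; ∈-resp-≈)
    open ListPermutation S using (_↭_; ↭-refl; ↭-sym; ↭-trans; ↭-reflexive-≋; prep)
    open ListPermutationProperties S using (↭-shift; ∈-resp-↭; Unique-resp-↭)
    open UniquenessProperties using (Unique[x∷xs]⇒x∉xs)
    open Uniqueness S using (Unique)

    -- Induction on `xs`: the copy `w` of its head in `ys` is moved to the front. Uniqueness on both
    -- sides keeps the remainders free of it, so they again have the same elements. Equality need
    -- not be decided.
    unique-sameElements⇒↭ : ∀ {xs ys} → Unique xs → Unique ys →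
      (∀ {z} → z ∈ xs → z ∈ ys) → (∀ {z} → z ∈ ys → z ∈ xs) → xs ↭ ys
    unique-sameElements⇒↭ {[]}     {[]}    _ _ _ _ = ↭-refl
    unique-sameElements⇒↭ {[]}     {y ∷ _} _ _ _ ⊇ = contradiction (⊇ (here refl)) λ ()
    unique-sameElements⇒↭ {x ∷ xs} {ys} !xs@(_ ∷ !xs′) !ys ⊆ ⊇
      with as , bs , w , x≈w , ys≋ ← ∈-∃++ S (⊆ (here refl)) =
      ↭-trans (prep x≈w (unique-sameElements⇒↭ !xs′ !rest into outof)) (↭-sym split)
      where
      split : ys ↭ w ∷ (as ++ bs)
      split = ↭-trans (↭-reflexive-≋ ys≋) (↭-shift as bs)
      !split : Unique (w ∷ (as ++ bs))
      !split = Unique-resp-↭ split !ys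
      !rest : Unique (as ++ bs)
      !rest with !split
      ... | _ ∷ !rest = !rest
      into : ∀ {z} → z ∈ xs → z ∈ as ++ bs
      into z∈xs with ∈-resp-↭ split (⊆ (there z∈xs))
      ... | here z≈w   = contradiction (∈-resp-≈ S (trans z≈w (sym x≈w)) z∈xs) (Unique[x∷xs]⇒x∉xs S !xs)
      ... | there z∈   = z∈
      outof : ∀ {z} → z ∈ as ++ bs → z ∈ xs
      outof z∈ with ⊇ (∈-resp-↭ (↭-sym split) (there z∈))
      ... | here z≈x   = contradiction (∈-resp-≈ S (trans z≈x x≈w) z∈) (Unique[x∷xs]⇒x∉xs S !split)
      ... | there z∈xs = z∈xs

  module ListSums {r ℓ′} (R : CommutativeRing r ℓ′) where

    open CommutativeRing R renaming (sym to ≈-sym; trans to ≈-trans)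
    open SetoidReasoning setoid

    ∑ : ∀ {b} {B : Set b} → (B → Carrier) → List B → Carrier
    ∑ f xs = List.foldr _+_ 0# (List.map f xs)

    module _ {b ℓ} (S : Setoid b ℓ) where

      open Setoid S using () renaming (Carrier to B; _≈_ to _≈ₛ_)
      open Enumerates S using (IsEnumeration)
      open Uniqueness S using (Unique)

      -- Two duplicate-free enumerations are permutations of each other; this is the independence of
      -- the enumeration that `IsSumOver` demands.
      ∑-enumeration : (f : B → Carrier) → (∀ {x y} → x ≈ₛ y → f x ≈ f y) → ∀ {xs ys} →
                      IsEnumeration xs → Unique xs → IsEnumeration ys → Unique ys → ∑ f xs ≈ ∑ f ys
      ∑-enumeration f f-resp xs-enumerates !xs ys-enumerates !ys =
        ListPermutationProperties.foldr-commMonoid setoid +-isCommutativeMonoid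
          (ListPermutationProperties.map⁺ S setoid f-resp
            (unique-sameElements⇒↭ S !xs !ys (λ {z} _ → ys-enumerates z) (λ {z} _ → xs-enumerates z)))

    ∑-++ : ∀ {b} {B : Set b} (f : B → Carrier) xs ys → ∑ f (xs ++ ys) ≈ ∑ f xs + ∑ f ys
    ∑-++ f []       ys = ≈-sym (+-identityˡ _)
    ∑-++ f (x ∷ xs) ys = ≈-trans (+-congˡ (∑-++ f xs ys)) (≈-sym (+-assoc _ _ _))

    ∑-product : ∀ {a b c} {A : Set a} {B : Set b} {C : Set c} {f : A → Carrier} {g : B → Carrier} {h : C → Carrier} (_∙_ : A → B → C) →
      (∀ x y → h (x ∙ y) ≈ f x * g y) → ∀ xs ys → ∑ h (List.cartesianProductWith _∙_ xs ys) ≈ ∑ f xs * ∑ g ys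
    ∑-product {f = f} {g} {h} _∙_ multiplicative []       ys = ≈-sym (zeroˡ _)
    ∑-product {f = f} {g} {h} _∙_ multiplicative (x ∷ xs) ys = begin
      ∑ h (List.map (x ∙_) ys ++ List.cartesianProductWith _∙_ xs ys)
        ≈⟨ ∑-++ h (List.map (x ∙_) ys) _ ⟩
      ∑ h (List.map (x ∙_) ys) + ∑ h (List.cartesianProductWith _∙_ xs ys)
        ≈⟨ +-cong (row ys) (∑-product {f = f} {g} {h} _∙_ multiplicative xs ys) ⟩
      f x * ∑ g ys + ∑ f xs * ∑ g ys
        ≈⟨ distribʳ _ _ _ ⟨
      (f x + ∑ f xs) * ∑ g ys ∎
      where
      row : ∀ ys → ∑ h (List.map (x ∙_) ys) ≈ f x * ∑ g ys
      row []       = ≈-sym (zeroʳ _)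
      row (y ∷ ys) = ≈-trans (+-cong (multiplicative x y) (row ys)) (≈-sym (distribˡ _ _ _))

open Vector using ([]; _∷_)

-- The ring homomorphism from ℤ and a ring solver with integer coefficients.

module IntegerEmbedding {r ℓ} (R : CommutativeRing r ℓ) where

  open CommutativeRing R hiding (zero)
  open Matrices R using (fromℕ; fromℤ)
  open RingProperties ring
  open AbelianGroupProperties +-abelianGroup using (⁻¹-∙-comm)
  open SemiringMult semiring using (×-homo-+; ×1-homo-*)
  open SetoidReasoning setoid

  fromℕ-+ : ∀ m n → fromℕ (m ℕ.+ n) ≈ fromℕ m + fromℕ n
  fromℕ-+ = ×-homo-+ 1#

  fromℕ-* : ∀ m n → fromℕ (m ℕ.* n) ≈ fromℕ m * fromℕ n
  fromℕ-* = ×1-homo-*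

  fromℤ-cong : ∀ {i j} → i ≡ j → fromℤ i ≈ fromℤ j
  fromℤ-cong ≡.refl = refl

  fromℤ-0 : fromℤ (+ 0) ≈ 0#
  fromℤ-0 = refl

  fromℤ-1 : fromℤ (+ 1) ≈ 1#
  fromℤ-1 = +-identityʳ 1#

  fromℤ-neg : ∀ i → fromℤ (ℤ.- i) ≈ - fromℤ i
  fromℤ-neg (+ zero)  = sym -0#≈0#
  fromℤ-neg (+ suc n) = refl
  fromℤ-neg -[1+ n ]  = sym (-‿involutive _)

  fromℤ-⊖ : ∀ m n → fromℤ (m ℤ.⊖ n) ≈ fromℕ m - fromℕ n
  fromℤ-⊖ zero    zero    = sym (-‿inverseʳ 0#)
  fromℤ-⊖ zero    (suc n) = sym (+-identityˡ _)
  fromℤ-⊖ (suc m) zero    = sym (trans (+-congˡ -0#≈0#) (+-identityʳ _))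
  fromℤ-⊖ (suc m) (suc n) = begin
    fromℤ (suc m ℤ.⊖ suc n)            ≈⟨ fromℤ-cong (ℤ.[1+m]⊖[1+n]≡m⊖n m n) ⟩
    fromℤ (m ℤ.⊖ n)                    ≈⟨ fromℤ-⊖ m n ⟩
    fromℕ m - fromℕ n                  ≈⟨ +-congʳ (+-identityˡ _) ⟨
    0# + fromℕ m - fromℕ n             ≈⟨ +-congʳ (+-congʳ (-‿inverseʳ 1#)) ⟨
    1# - 1# + fromℕ m - fromℕ n        ≈⟨ +-congʳ (trans (+-assoc _ _ _) (trans (+-congˡ (+-comm _ _)) (sym (+-assoc _ _ _)))) ⟩
    1# + fromℕ m - 1# - fromℕ n        ≈⟨ +-assoc _ _ _ ⟩
    1# + fromℕ m + (- 1# - fromℕ n)    ≈⟨ +-congˡ (⁻¹-∙-comm _ _) ⟩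
    1# + fromℕ m - (1# + fromℕ n)      ∎

  fromℤ-+ : ∀ i j → fromℤ (i ℤ.+ j) ≈ fromℤ i + fromℤ j
  fromℤ-+ (+ m)    (+ n)    = fromℕ-+ m n
  fromℤ-+ (+ m)    -[1+ n ] = fromℤ-⊖ m (suc n)
  fromℤ-+ -[1+ m ] (+ n)    = trans (fromℤ-⊖ n (suc m)) (+-comm _ _)
  fromℤ-+ -[1+ m ] -[1+ n ] = begin
    - fromℕ (suc (suc (m ℕ.+ n)))        ≈⟨ -‿cong (+-congˡ (fromℕ-+ (suc m) n)) ⟩
    - (1# + (fromℕ (suc m) + fromℕ n))   ≈⟨ -‿cong (trans (sym (+-assoc _ _ _)) (trans (+-congʳ (+-comm _ _)) (+-assoc _ _ _))) ⟩
    - (fromℕ (suc m) + fromℕ (suc n))    ≈⟨ ⁻¹-∙-comm _ _ ⟨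
    - fromℕ (suc m) - fromℕ (suc n)      ∎

  private
    +*-homo : ∀ m j → fromℤ (+ m ℤ.* j) ≈ fromℕ m * fromℤ j
    +*-homo m (+ n)    = trans (fromℤ-cong (≡.sym (ℤ.pos-* m n))) (fromℕ-* m n)
    +*-homo m -[1+ n ] = begin
      fromℤ (+ m ℤ.* -[1+ n ])       ≈⟨ fromℤ-cong (ℤ.neg-distribʳ-* (+ m) (+ suc n)) ⟨
      fromℤ (ℤ.- (+ m ℤ.* + suc n))  ≈⟨ fromℤ-neg (+ m ℤ.* + suc n) ⟩
      - fromℤ (+ m ℤ.* + suc n)      ≈⟨ -‿cong (+*-homo m (+ suc n)) ⟩
      - (fromℕ m * fromℕ (suc n))    ≈⟨ -‿distribʳ-* _ _ ⟩
      fromℕ m * - fromℕ (suc n)      ∎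

  fromℤ-* : ∀ i j → fromℤ (i ℤ.* j) ≈ fromℤ i * fromℤ j
  fromℤ-* (+ m)    j = +*-homo m j
  fromℤ-* -[1+ m ] j = begin
    fromℤ (-[1+ m ] ℤ.* j)         ≈⟨ fromℤ-cong (ℤ.neg-distribˡ-* (+ suc m) j) ⟨
    fromℤ (ℤ.- (+ suc m ℤ.* j))    ≈⟨ fromℤ-neg (+ suc m ℤ.* j) ⟩
    - fromℤ (+ suc m ℤ.* j)        ≈⟨ -‿cong (+*-homo (suc m) j) ⟩
    - (fromℕ (suc m) * fromℤ j)    ≈⟨ -‿distribˡ-* _ _ ⟩
    - fromℕ (suc m) * fromℤ j      ∎

  private
    morphism : ℤ.+-*-rawRing -Raw-AlmostCommutative⟶ fromCommutativeRing R
    morphism = record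
      { ⟦_⟧    = fromℤ
      ; +-homo = fromℤ-+
      ; *-homo = fromℤ-*
      ; -‿homo = fromℤ-neg
      ; 0-homo = fromℤ-0
      ; 1-homo = fromℤ-1
      }

    -- Equality in `R` need not be decidable; comparing integer coefficients is enough for the
    -- solver to cancel terms. Distinct integers may still agree in `R`, hence `nothing`.
    weaklyDecide : ∀ i j → Maybe (fromℤ i ≈ fromℤ j)
    weaklyDecide i j with i ℤ.≟ j
    ... | yes i≡j = just (fromℤ-cong i≡j)
    ... | no  _   = nothing

  module Solver = RingSolver ℤ.+-*-rawRing (fromCommutativeRing R) morphism weaklyDecide

-- Equivalence under unipotent row and column operations, and fraction-free elimination.

module UnipotentEquivalence {r ℓ} (R : CommutativeRing r ℓ) where

  open CommutativeRing R hiding (zero)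
  open Matrices R
  open RingProperties ring
  open Sum semiring using (sum; sum-cong-≋; sum-replicate-zero; ∑-distrib-+; *-distribˡ-sum; *-distribʳ-sum)
  open SetoidReasoning setoid
  open IntegerEmbedding R using (module Solver)
  open Solver using (solve; _:=_; _:+_; _:*_; _:-_; :-_)

  ∑ : ∀ {n} → Vector Carrier n → Carrier
  ∑ = sum

  infixl 8 _ᵀ
  _ᵀ : ∀ {n} → Matrix n → Matrix n
  (A ᵀ) i j = A j i

  minor : ∀ {n} → Matrix (suc n) → Matrix n
  minor A i j = A (suc i) (suc j)

  -- The usual Schur complement times minus the corner. The sign absorbs the alternating signs of
  -- `w₀`, so that the pivots that occur are positive.
  schur : ∀ {n} → Matrix (suc n) → Matrix n
  schur A i j = A (suc i) zero * A zero (suc j) - A zero zero * A (suc i) (suc j)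

  pivots : ∀ {n} → Matrix n → Vector Carrier n
  pivots {suc n} A zero    = A zero zero
  pivots {suc n} A (suc i) = pivots (schur A) i

  -- Both factors are kept upper unipotent and the left one acts through its transpose, so rows and
  -- columns are handled by the same lemmas.
  record _~[_,_]_ {n} (A : Matrix n) (u v : Matrix n) (B : Matrix n) : Set (r ⊔ ℓ) where
    constructor mk~
    field
      left-U    : IsUpperUnipotent u
      right-U   : IsUpperUnipotent v
      equation  : u ᵀ · (A · v) ≋ B

  open _~[_,_]_ public

  -- Cancellability covers nonzero integers and invertible reals alike.
  Regular : Carrier → Set (r ⊔ ℓ)
  Regular x = ∀ {y z} → x * y ≈ x * z → y ≈ z

  block : ∀ {n} → Carrier → Vector Carrier n → Vector Carrier n → Matrix n → Matrix (suc n)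
  block p x y A zero    zero    = p
  block p x y A zero    (suc j) = x j
  block p x y A (suc i) zero    = y i
  block p x y A (suc i) (suc j) = A i j

  unipotent : ∀ {n} → Vector Carrier n → Matrix n → Matrix (suc n)
  unipotent t u = block 1# t (λ _ → 0#) u

  minor-U : ∀ {n} {u : Matrix (suc n)} → IsUpperUnipotent u → IsUpperUnipotent (minor u)
  minor-U (d , l) = (λ i → d (suc i)) , λ i j j<i → l (suc i) (suc j) (s≤s j<i)

  unipotent-U : ∀ {n} {t : Vector Carrier n} {u} → IsUpperUnipotent u → IsUpperUnipotent (unipotent t u)
  unipotent-U {n} {t} {u} (d , l) = diagonal , lower
    where
    diagonal : ∀ i → unipotent t u i i ≈ 1#
    diagonal zero    = refl
    diagonal (suc i) = d i
    lower : ∀ i j → j Fin.< i → unipotent t u i j ≈ 0#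
    lower (suc i) zero    _         = refl
    lower (suc i) (suc j) (s≤s j<i) = l i j j<i

  below-U : ∀ {n} {u : Matrix (suc n)} → IsUpperUnipotent u → ∀ i → u (suc i) zero ≈ 0#
  below-U (_ , l) i = l (suc i) zero (s≤s z≤n)

  schur-cong : ∀ {n} {A B : Matrix (suc n)} → A ≋ B → schur A ≋ schur B
  schur-cong p i j = +-cong (*-cong (p _ _) (p _ _)) (-‿cong (*-cong (p _ _) (p _ _)))

  pivots-cong : ∀ {n} {A B : Matrix n} → A ≋ B → ∀ i → pivots A i ≈ pivots B i
  pivots-cong p zero    = p zero zero
  pivots-cong p (suc i) = pivots-cong (schur-cong p) i

  infixl 7 _⋆_
  -- The transpose of `A` applied to `x`: the way `u` acts on columns and `v` on rows.
  _⋆_ : ∀ {n} → Matrix n → Vector Carrier n → Vector Carrier n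
  (A ⋆ x) i = sum (λ l → A l i * x l)

  sum-U : ∀ {n} {u : Matrix (suc n)} → IsUpperUnipotent u → ∀ x → (u ⋆ x) zero ≈ x zero
  sum-U {n} {u} U x = begin
    u zero zero * x zero + sum (λ l → u (suc l) zero * x (suc l))
      ≈⟨ +-cong (trans (*-congʳ (proj₁ U zero)) (*-identityˡ _))
                (sum-cong-≋ (λ l → trans (*-congʳ (below-U U l)) (zeroˡ _))) ⟩
    x zero + sum {n} (λ _ → 0#) ≈⟨ +-congˡ (sum-replicate-zero n) ⟩
    x zero + 0#                ≈⟨ +-identityʳ _ ⟩
    x zero                     ∎

  ·≈⋆ : ∀ {n} (A v : Matrix n) i j → (A · v) i j ≈ (v ⋆ A i) j
  ·≈⋆ A v i j = sum-cong-≋ (λ l → *-comm (A i l) (v l j))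

  sum-sub : ∀ {n} (x y : Vector Carrier n) → sum (λ i → x i - y i) ≈ sum x - sum y
  sum-sub {n} x y = begin
    sum (λ i → x i - y i)        ≈⟨ ∑-distrib-+ x (λ i → - y i) ⟩
    sum x + sum (λ i → - y i)    ≈⟨ +-congˡ (go y) ⟩
    sum x - sum y                ∎
    where
    go : ∀ {n} (y : Vector Carrier n) → sum (λ i → - y i) ≈ - sum y
    go {zero}  y = sym -0#≈0#
    go {suc n} y = trans (+-congˡ (go (tail y))) (solve 2 (λ a b → (:- a) :+ (:- b) := :- (a :+ b)) refl (y zero) (sum (tail y)))

  ⋆-lin : ∀ {n} (u : Matrix n) (x y : Vector Carrier n) p i → (u ⋆ (λ l → x l - p * y l)) i ≈ (u ⋆ x) i - p * (u ⋆ y) i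
  ⋆-lin u x y p i = begin
    sum (λ l → u l i * (x l - p * y l))
      ≈⟨ sum-cong-≋ (λ l → solve 4 (λ u x y p → u :* (x :- p :* y) := u :* x :- p :* (u :* y)) refl (u l i) (x l) (y l) p) ⟩
    sum (λ l → u l i * x l - p * (u l i * y l))
      ≈⟨ sum-sub (λ l → u l i * x l) (λ l → p * (u l i * y l)) ⟩
    (u ⋆ x) i - sum (λ l → p * (u l i * y l))
      ≈⟨ +-congˡ (-‿cong (*-distribˡ-sum p (λ l → u l i * y l))) ⟨
    (u ⋆ x) i - p * (u ⋆ y) i ∎

  ⋆-cong : ∀ {n} (u : Matrix n) {x y : Vector Carrier n} → (∀ l → x l ≈ y l) → ∀ i → (u ⋆ x) i ≈ (u ⋆ y) i
  ⋆-cong u x≈y i = sum-cong-≋ (λ l → *-congˡ (x≈y l))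

  ⋆-congʳ : ∀ {n} {u v : Matrix n} → u ≋ v → ∀ x i → (u ⋆ x) i ≈ (v ⋆ x) i
  ⋆-congʳ {n} u≋v x i = sum-cong-≋ {n} (λ l → *-congʳ (u≋v l i))

  ⋆-*ʳ : ∀ {n} (u : Matrix n) (x : Vector Carrier n) p i → (u ⋆ (λ l → x l * p)) i ≈ (u ⋆ x) i * p
  ⋆-*ʳ {n} u x p i = trans (sum-cong-≋ {n} (λ l → sym (*-assoc _ _ _))) (sym (*-distribʳ-sum p (λ l → u l i * x l)))

  ⋆-*ˡ : ∀ {n} (u : Matrix n) (x : Vector Carrier n) p i → (u ⋆ (λ l → p * x l)) i ≈ p * (u ⋆ x) i
  ⋆-*ˡ u x p i = trans (⋆-cong u (λ l → *-comm p (x l)) i) (trans (⋆-*ʳ u x p i) (*-comm _ _))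

  ⋆-+ : ∀ {n} (u : Matrix n) (x y : Vector Carrier n) i → (u ⋆ (λ l → x l + y l)) i ≈ (u ⋆ x) i + (u ⋆ y) i
  ⋆-+ {n} u x y i = trans (sum-cong-≋ {n} (λ l → distribˡ _ _ _)) (∑-distrib-+ (λ l → u l i * x l) (λ l → u l i * y l))

  col row : ∀ {n} → Matrix (suc n) → Vector Carrier n
  col A i = A (suc i) zero
  row A j = A zero (suc j)

  module Blocks {n} {A u v : Matrix (suc n)} (U : IsUpperUnipotent u) (V : IsUpperUnipotent v) where

    P : Matrix (suc n)
    P = u ᵀ · (A · v)

    inner : Matrix n
    inner i j = (minor u ⋆ (λ l → (minor v ⋆ (λ k → A (suc l) (suc k))) j)) i

    row-Av : ∀ l j → (A · v) l (suc j) ≈ A l zero * row v j + (minor v ⋆ (λ k → A l (suc k))) j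
    row-Av l j = +-congˡ (sum-cong-≋ {n} (λ k → *-comm _ _))

    zero-Av : ∀ l → (A · v) l zero ≈ A l zero
    zero-Av l = trans (·≈⋆ A v l zero) (sum-U V (A l))

    corner : P zero zero ≈ A zero zero
    corner = trans (sum-U U (λ l → (A · v) l zero)) (zero-Av zero)

    top : ∀ j → P zero (suc j) ≈ A zero zero * row v j + (minor v ⋆ row A) j
    top j = trans (sum-U U (λ l → (A · v) l (suc j))) (row-Av zero j)

    left : ∀ i → P (suc i) zero ≈ A zero zero * row u i + (minor u ⋆ col A) i
    left i = +-cong (trans (*-comm _ _) (*-congʳ (zero-Av zero))) (⋆-cong (minor u) (λ l → zero-Av (suc l)) i)

    inside : ∀ i j → P (suc i) (suc j) ≈ row u i * P zero (suc j) + ((minor u ⋆ col A) i * row v j + inner i j)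
    inside i j = +-cong (*-congˡ (sym (sum-U U (λ l → (A · v) l (suc j)))))
      (trans (⋆-cong (minor u) (λ l → row-Av (suc l) j) i)
      (trans (⋆-+ (minor u) (λ l → A (suc l) zero * row v j) _ i)
             (+-congʳ (⋆-*ʳ (minor u) (col A) (row v j) i))))

    schur-inner : ∀ i j → (minor u ᵀ · (schur A · minor v)) i j ≈
                  (minor u ⋆ col A) i * (minor v ⋆ row A) j - A zero zero * inner i j
    schur-inner i j = begin
      (minor u ⋆ (λ l → (schur A · minor v) l j)) i
        ≈⟨ ⋆-cong (minor u) (λ l → trans (·≈⋆ (schur A) (minor v) l j)
             (trans (⋆-lin (minor v) (λ k → col A l * row A k) (λ k → A (suc l) (suc k)) (A zero zero) j)
                    (+-congʳ (⋆-*ˡ (minor v) (row A) (col A l) j)))) i ⟩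
      (minor u ⋆ (λ l → col A l * (minor v ⋆ row A) j - A zero zero * (minor v ⋆ (λ k → A (suc l) (suc k))) j)) i
        ≈⟨ ⋆-lin (minor u) (λ l → col A l * (minor v ⋆ row A) j) _ (A zero zero) i ⟩
      (minor u ⋆ (λ l → col A l * (minor v ⋆ row A) j)) i - A zero zero * inner i j
        ≈⟨ +-congʳ (⋆-*ʳ (minor u) (col A) ((minor v ⋆ row A) j) i) ⟩
      (minor u ⋆ col A) i * (minor v ⋆ row A) j - A zero zero * inner i j ∎

    -- The multiples of the first row and column that `u` and `v` add cancel in the cross product,
    -- so only the minors of `u` and `v` act on the Schur complement.
    schur-P : ∀ i j → schur P i j ≈ (minor u ᵀ · (schur A · minor v)) i j
    schur-P i j = begin
      P (suc i) zero * P zero (suc j) - P zero zero * P (suc i) (suc j)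
        ≈⟨ +-cong (*-congʳ (left i)) (-‿cong (*-cong corner (inside i j))) ⟩
      (p * t + g) * q - p * (t * q + (g * s + k))
        ≈⟨ solve 6 (λ p t g q s k → (p :* t :+ g) :* q :- p :* (t :* q :+ (g :* s :+ k)) := g :* (q :- p :* s) :- p :* k) refl p t g q s k ⟩
      g * (q - p * s) - p * k
        ≈⟨ +-congʳ (*-congˡ (trans (+-congʳ (top j)) (solve 3 (λ p s h → (p :* s :+ h) :- p :* s := h) refl p s h))) ⟩
      g * h - p * k
        ≈⟨ schur-inner i j ⟨
      (minor u ᵀ · (schur A · minor v)) i j ∎
      where
      p = A zero zero
      t = row u i
      s = row v j
      g = (minor u ⋆ col A) i
      h = (minor v ⋆ row A) j
      k = inner i j
      q = P zero (suc j)

  -- The content of an equivalence after one elimination step: first row and column are controlled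
  -- modulo the corner, and the rest is an equivalence of Schur complements. For a regular corner,
  -- `lift` is the converse.
  record Descent {n} (A u v B : Matrix (suc n)) : Set (r ⊔ ℓ) where
    field
      corner : B zero zero ≈ A zero zero
      top    : ∀ j → B zero (suc j) ≈ A zero zero * row v j + (minor v ⋆ row A) j
      left   : ∀ i → B (suc i) zero ≈ A zero zero * row u i + (minor u ⋆ col A) i
      schur~ : schur A ~[ minor u , minor v ] schur B

  descend : ∀ {n} {A u v B : Matrix (suc n)} → A ~[ u , v ] B → Descent A u v B
  descend {A = A} {u} {v} {B} (mk~ U V eq) = record
    { corner = trans (sym (eq zero zero)) corner
    ; top    = λ j → trans (sym (eq zero (suc j))) (top j)
    ; left   = λ i → trans (sym (eq (suc i) zero)) (left i)
    ; schur~ = mk~ (minor-U U) (minor-U V)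
        (λ i j → trans (sym (schur-P i j)) (schur-cong eq i j))
    }
    where open Blocks {A = A} U V

  -- Once corner, first row and first column agree, the Schur complement determines the corner times
  -- each inner entry, and the corner cancels.
  lift : ∀ {n} {A B : Matrix (suc n)} {u v : Matrix n} {t s} →
         Regular (A zero zero) →
         B zero zero ≈ A zero zero →
         (∀ j → B zero (suc j) ≈ A zero zero * s j + (v ⋆ row A) j) →
         (∀ i → B (suc i) zero ≈ A zero zero * t i + (u ⋆ col A) i) →
         schur A ~[ u , v ] schur B →
         A ~[ unipotent t u , unipotent s v ] B
  lift {A = A} {B} {u} {v} {t} {s} regular corner′ top′ left′ (mk~ U V eq) = mk~ (unipotent-U U) (unipotent-U V) entries
    where
    open Blocks {A = A} {u = unipotent t u} {v = unipotent s v} (unipotent-U U) (unipotent-U V)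
    entries : P ≋ B
    entries zero    zero    = trans corner (sym corner′)
    entries zero    (suc j) = trans (top j) (sym (top′ j))
    entries (suc i) zero    = trans (left i) (sym (left′ i))
    entries (suc i) (suc j) = regular (begin
      A zero zero * P (suc i) (suc j)
        ≈⟨ *-congʳ corner ⟨
      P zero zero * P (suc i) (suc j)
        ≈⟨ solve 2 (λ x z → z := x :- (x :- z)) refl (P (suc i) zero * P zero (suc j)) _ ⟩
      P (suc i) zero * P zero (suc j) - schur P i j
        ≈⟨ +-cong (*-cong (entries (suc i) zero) (entries zero (suc j))) (-‿cong (trans (schur-P i j) (eq i j))) ⟩
      B (suc i) zero * B zero (suc j) - schur B i j
        ≈⟨ solve 2 (λ x z → x :- (x :- z) := z) refl (B (suc i) zero * B zero (suc j)) _ ⟩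
      B zero zero * B (suc i) (suc j)
        ≈⟨ *-congʳ corner′ ⟩
      A zero zero * B (suc i) (suc j) ∎)

  ~-pivots : ∀ {n} {A B u v : Matrix n} → A ~[ u , v ] B → ∀ i → pivots A i ≈ pivots B i
  ~-pivots A~B zero    = sym (Descent.corner (descend A~B))
  ~-pivots A~B (suc i) = ~-pivots (Descent.schur~ (descend A~B)) i

  ~-cong : ∀ {n} {A A′ B B′ u v : Matrix n} → A ≋ A′ → B ≋ B′ → A ~[ u , v ] B → A′ ~[ u , v ] B′
  ~-cong {u = u} {v} A≋A′ B≋B′ (mk~ U V eq) = mk~ U V
    (≋-trans (·-congˡ (u ᵀ) (·-congʳ v (≋-sym A≋A′))) (≋-trans eq B≋B′))

  -- By induction the Schur complements determine the minors of both factors; the equations for the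
  -- first row and column then determine the rest after cancelling the pivot.
  ~-unique : ∀ {n} {A B u v u′ v′ : Matrix n} → (∀ i → Regular (pivots A i)) →
             A ~[ u , v ] B → A ~[ u′ , v′ ] B → u ≋ u′ × v ≋ v′
  ~-unique {zero}  _ _ _ = (λ ()) , (λ ())
  ~-unique {suc n} {A} {B} {u} {v} {u′} {v′} regular x y =
    extend (left-U x) (left-U y) (proj₁ ih) (λ i → cancel (proj₁ ih) (col A) i (left X i) (left Y i)) ,
    extend (right-U x) (right-U y) (proj₂ ih) (λ i → cancel (proj₂ ih) (row A) i (top X i) (top Y i))
    where
    open Descent
    X = descend x
    Y = descend y
    ih = ~-unique (λ i → regular (suc i)) (schur~ X) (schur~ Y)
    cancel : ∀ {b s s′} {w w′ : Matrix n} → w ≋ w′ → (x : Vector Carrier n) → ∀ i →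
             b ≈ A zero zero * s + (w ⋆ x) i → b ≈ A zero zero * s′ + (w′ ⋆ x) i → s ≈ s′
    cancel {w = w} w≋w′ x i eq eq′ = regular zero (+-cancelʳ ((w ⋆ x) i) _ _
      (trans (sym eq) (trans eq′ (+-congˡ (sum-cong-≋ {n} (λ l → *-congʳ (sym (w≋w′ l i))))))))
    extend : ∀ {w w′ : Matrix (suc n)} → IsUpperUnipotent w → IsUpperUnipotent w′ →
             minor w ≋ minor w′ → (∀ i → row w i ≈ row w′ i) → w ≋ w′
    extend W W′ p q zero    zero    = trans (proj₁ W zero) (sym (proj₁ W′ zero))
    extend W W′ p q zero    (suc j) = q j
    extend W W′ p q (suc i) zero    = trans (below-U W i) (sym (below-U W′ i))
    extend W W′ p q (suc i) (suc j) = p i j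

  Invertible : Carrier → Set (r ⊔ ℓ)
  Invertible x = ∃[ y ] x * y ≈ 1#

  invertible⇒regular : ∀ {x} → Invertible x → Regular x
  invertible⇒regular {x} (x⁻¹ , eq) {y} {z} xy≈xz = begin
    y               ≈⟨ *-identityˡ y ⟨
    1# * y          ≈⟨ *-congʳ (trans (*-comm _ _) eq) ⟨
    x⁻¹ * x * y     ≈⟨ *-assoc _ _ _ ⟩
    x⁻¹ * (x * y)   ≈⟨ *-congˡ xy≈xz ⟩
    x⁻¹ * (x * z)   ≈⟨ *-assoc _ _ _ ⟨
    x⁻¹ * x * z     ≈⟨ *-congʳ (trans (*-comm _ _) eq) ⟩
    1# * z          ≈⟨ *-identityˡ z ⟩
    z               ∎

  -- With invertible pivots the equations for the first rows of `u` and `v` can always be solved, so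
  -- the pivots are a complete invariant.
  pivots⇒~ : ∀ {n} {A B : Matrix n} → (∀ i → Invertible (pivots A i)) → (∀ i → pivots A i ≈ pivots B i) →
             ∃[ u ] ∃[ v ] A ~[ u , v ] B
  pivots⇒~ {zero}  _ _ = I , I , mk~ I-U I-U (λ ())
  pivots⇒~ {suc n} {A} {B} invertible equal =
    let u , v , schur~ = pivots⇒~ (λ i → invertible (suc i)) (λ i → equal (suc i))
        p⁻¹ , inverse = invertible zero
        solveFor : ∀ b g → b ≈ A zero zero * (p⁻¹ * (b - g)) + g
        solveFor b g = begin
          b               ≈⟨ solve 2 (λ b g → b := (b :- g) :+ g) refl b g ⟩
          (b - g) + g     ≈⟨ +-congʳ (*-identityˡ _) ⟨
          1# * (b - g) + g ≈⟨ +-congʳ (*-congʳ inverse) ⟨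
          A zero zero * p⁻¹ * (b - g) + g ≈⟨ +-congʳ (*-assoc _ _ _) ⟩
          A zero zero * (p⁻¹ * (b - g)) + g ∎
    in _ , _ , lift {A = A} {B} {u} {v} (invertible⇒regular (invertible zero)) (sym (equal zero))
         (λ j → solveFor (row B j) ((v ⋆ row A) j)) (λ i → solveFor (col B i) ((u ⋆ col A) i)) schur~

  scaleRows : ∀ {n} → Vector Carrier n → Matrix n → Matrix n
  scaleRows d A i j = d i * A i j

  -- The hypothesis is u′ᵀ · diag d = diag d · uᵀ, written entrywise: a row scaling moves through
  -- the left factor.
  conjugation : ∀ {n} {A u u′ v : Matrix n} (d : Vector Carrier n) → (∀ l i → u′ l i * d l ≈ d i * u l i) →
                u′ ᵀ · (scaleRows d A · v) ≋ scaleRows d (u ᵀ · (A · v))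
  conjugation {n} {A} {u} {u′} {v} d eq i j = begin
    sum (λ l → u′ l i * sum (λ k → d l * A l k * v k j))
      ≈⟨ sum-cong-≋ {n} (λ l → *-congˡ (trans (sum-cong-≋ {n} (λ k → *-assoc _ _ _)) (sym (*-distribˡ-sum (d l) (λ k → A l k * v k j))))) ⟩
    sum (λ l → u′ l i * (d l * (A · v) l j))
      ≈⟨ sum-cong-≋ {n} (λ l → trans (sym (*-assoc _ _ _)) (trans (*-congʳ (eq l i)) (*-assoc _ _ _))) ⟩
    sum (λ l → d i * (u l i * (A · v) l j))
      ≈⟨ *-distribˡ-sum (d i) (λ l → u l i * (A · v) l j) ⟨
    d i * (u ᵀ · (A · v)) i j ∎

  conjugate : ∀ {n} {A B u u′ v : Matrix n} (d : Vector Carrier n) → IsUpperUnipotent u′ →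
              (∀ l i → u′ l i * d l ≈ d i * u l i) →
              A ~[ u , v ] B → scaleRows d A ~[ u′ , v ] scaleRows d B
  conjugate {v = v} d U′ eq (mk~ _ V A~B) = mk~ U′ V (λ i j → trans (conjugation {v = v} d eq i j) (*-congˡ (A~B i j)))

  unconjugate : ∀ {n} {A B u u′ v : Matrix n} (d : Vector Carrier n) → (∀ i → Regular (d i)) →
                IsUpperUnipotent u → (∀ l i → u′ l i * d l ≈ d i * u l i) →
                scaleRows d A ~[ u′ , v ] scaleRows d B → A ~[ u , v ] B
  unconjugate {v = v} d regular U eq (mk~ _ V A~B) = mk~ U V (λ i j → regular i (trans (sym (conjugation {v = v} d eq i j)) (A~B i j)))

  cornerScale : ∀ {n} → Carrier → Vector Carrier (suc n)
  cornerScale p = 1# ∷ (λ _ → p)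

  -- Moving diag(1, p, ..., p) through the left factor multiplies its first row by `p` off the
  -- diagonal and changes nothing else. This is the source of the factor D₁ in D₁M₂.
  cornerScale-conjugates : ∀ {n} {p} {u u′ : Matrix (suc n)} → IsUpperUnipotent u → IsUpperUnipotent u′ →
    (∀ i → row u′ i ≈ p * row u i) → minor u′ ≋ minor u → ∀ l i → u′ l i * cornerScale p l ≈ cornerScale p i * u l i
  cornerScale-conjugates U U′ row≈ minor≈ zero    zero    =
    trans (*-comm _ _) (*-congˡ (trans (proj₁ U′ zero) (sym (proj₁ U zero))))
  cornerScale-conjugates U U′ row≈ minor≈ zero    (suc i) = trans (*-identityʳ _) (row≈ i)
  cornerScale-conjugates U U′ row≈ minor≈ (suc l) zero    =
    trans (*-congʳ (below-U U′ l)) (trans (zeroˡ _) (sym (trans (*-congˡ (below-U U l)) (zeroʳ _))))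
  cornerScale-conjugates U U′ row≈ minor≈ (suc l) (suc i) = trans (*-comm _ _) (*-congˡ (minor≈ l i))

  I-⋆ : ∀ {n} (x : Vector Carrier n) i → (I ⋆ x) i ≈ x i
  I-⋆ {n} x i = trans (sum-cong-≋ {n} (λ l → *-comm _ _)) (·-identityʳ (λ _ → x) i i)

  ~-refl : ∀ {n} {A B : Matrix n} → A ≋ B → A ~[ I , I ] B
  ~-refl {A = A} {B} A≋B = mk~ I-U I-U (λ i j → trans (I-⋆ (λ l → (A · I) l j) i) (trans (·-identityʳ A i j) (A≋B i j)))

  ⋆-sparse : ∀ {n} (u : Matrix (suc n)) {x : Vector Carrier (suc n)} → (∀ l → x (suc l) ≈ 0#) → ∀ i → (u ⋆ x) i ≈ u zero i * x zero
  ⋆-sparse {n} u x≈0 i = trans (+-congˡ (trans (sum-cong-≋ {n} (λ l → trans (*-congˡ (x≈0 l)) (zeroʳ _))) (sum-replicate-zero n))) (+-identityʳ _)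

-- Determinants under unipotent row operations, from the Laplace expansion.

module Determinant {r ℓ} (R : CommutativeRing r ℓ) where

  open CommutativeRing R hiding (zero)
  open Matrices R
  open RingProperties ring
  open Exp semiring using (_^_)
  open Sum semiring using (sum; sum-cong-≋; sum-replicate-zero; sum-init-last; ∑-comm; ∑-distrib-+; *-distribˡ-sum; *-distribʳ-sum)
  open MonoidSum *-monoid using () renaming (sum to prod)
  open SetoidReasoning setoid
  open IntegerEmbedding R using (module Solver)
  open Solver using (solve; _:=_; _:+_; _:*_; _:-_; :-_)
  open UnipotentEquivalence R using (minor; minor-U; below-U)

  sign : ∀ {n} → Fin n → Carrier
  sign j = (- 1#) ^ toℕ j

  det-cong : ∀ {n} {A B : Matrix n} → A ≋ B → det A ≈ det B
  det-cong {zero}  _   = refl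
  det-cong {suc n} A≋B = sum-cong-≋ (λ j → *-congˡ {sign j} (*-cong (A≋B zero j) (det-cong (λ i l → A≋B (suc i) (punchIn j l)))))

  -- A term of the iterated Laplace expansion along two rows a and b, where g φ is the
  -- minor of the remaining rows on the columns φ.
  private
    term : ∀ {n} (a b : Vector Carrier (2 ℕ.+ n)) (g : (Fin n → Fin (2 ℕ.+ n)) → Carrier) →
           Fin (2 ℕ.+ n) → Fin (1 ℕ.+ n) → Carrier
    term a b g j k = sign j * (a j * (sign k * (b (punchIn j k) * g (punchIn j ∘ punchIn k))))

    sum-0 : ∀ {n} {f : Vector Carrier n} → (∀ i → f i ≈ 0#) → sum f ≈ 0#
    sum-0 {n} f≈0 = trans (sum-cong-≋ f≈0) (sum-replicate-zero n)

    shift : ∀ {m n} → (Fin m → Fin n) → Fin (suc m) → Fin (suc n)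
    shift φ zero    = zero
    shift φ (suc i) = suc (φ i)

    twoRows : ∀ {n} (a b : Vector Carrier (2 ℕ.+ n)) (g : (Fin n → Fin (2 ℕ.+ n)) → Carrier) → Carrier
    twoRows a b g = sum (λ j → sum (λ k → term a b g j k))

  -- Terms in which one of the rows uses column 0 cancel in pairs, the two orders having opposite
  -- signs. In the others column 0 is removed: both signs change, their product does not, and
  -- induction applies.
  twoRows-antisymmetric : ∀ {n} (a b : Vector Carrier (2 ℕ.+ n)) (g : (Fin n → Fin (2 ℕ.+ n)) → Carrier) →
                          (∀ {φ φ′} → (∀ i → φ i ≡ φ′ i) → g φ ≈ g φ′) →
                          twoRows a b g + twoRows b a g ≈ 0#
  twoRows-antisymmetric {n} a b g g-cong = begin
    twoRows a b g + twoRows b a g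
      ≈⟨ +-cong (expand a b) (expand b a) ⟩
    (first a b + (second a b + rest a b)) + (first b a + (second b a + rest b a))
      ≈⟨ solve 6 (λ x y z x′ y′ z′ → (x :+ (y :+ z)) :+ (x′ :+ (y′ :+ z′)) := ((x :+ y′) :+ (x′ :+ y)) :+ (z :+ z′)) refl _ _ _ _ _ _ ⟩
    (first a b + second b a) + (first b a + second a b) + (rest a b + rest b a)
      ≈⟨ +-cong (trans (+-cong (cancel a b) (cancel b a)) (+-identityˡ 0#)) (rest-antisymmetric {n} {a} {b} g g-cong) ⟩
    0# + 0#
      ≈⟨ +-identityˡ 0# ⟩
    0# ∎
    where
    first second rest : (a b : Vector Carrier (2 ℕ.+ n)) → Carrier
    first  a b = sum (λ k → term a b g zero k)
    second a b = sum (λ j → term a b g (suc j) zero)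
    rest   a b = sum (λ j → sum (λ k → term a b g (suc j) (suc k)))

    expand : ∀ a b → twoRows a b g ≈ first a b + (second a b + rest a b)
    expand a b = +-congˡ (∑-distrib-+ (λ j → term a b g (suc j) zero) (λ j → sum (λ k → term a b g (suc j) (suc k))))

    cancel : ∀ a b → first a b + second b a ≈ 0#
    cancel a b = trans (sym (∑-distrib-+ (λ k → term a b g zero k) (λ j → term b a g (suc j) zero)))
      (sum-0 (λ k → begin
        1# * (a zero * (sign k * (b (suc k) * g _))) + (- 1# * sign k) * (b (suc k) * (1# * (a zero * g _)))
          ≈⟨ solve 5 (λ o s x y z → o :* (x :* (s :* (y :* z))) :+ (:- o :* s) :* (y :* (o :* (x :* z)))
                       := (s :* x :* y :* z) :* (o :- o :* o)) refl 1# (sign k) (a zero) (b (suc k)) (g (suc ∘ punchIn k)) ⟩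
        (sign k * a zero * b (suc k) * g _) * (1# - 1# * 1#)
          ≈⟨ *-congˡ (trans (+-congˡ (-‿cong (*-identityˡ 1#))) (-‿inverseʳ 1#)) ⟩
        (sign k * a zero * b (suc k) * g _) * 0#
          ≈⟨ zeroʳ _ ⟩
        0# ∎))

    rest-antisymmetric : ∀ {n} {a b : Vector Carrier (2 ℕ.+ n)} (g : (Fin n → Fin (2 ℕ.+ n)) → Carrier) →
      (∀ {φ φ′} → (∀ i → φ i ≡ φ′ i) → g φ ≈ g φ′) →
      sum (λ j → sum (λ k → term a b g (suc j) (suc k))) + sum (λ j → sum (λ k → term b a g (suc j) (suc k))) ≈ 0#
    rest-antisymmetric {zero}  {a} {b} g g-cong = trans (+-cong (sum-0 {1} (λ _ → refl)) (sum-0 {1} (λ _ → refl))) (+-identityˡ 0#)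
    rest-antisymmetric {suc n} {a} {b} g g-cong = begin
      sum (λ j → sum (λ k → term a b g (suc j) (suc k))) + sum (λ j → sum (λ k → term b a g (suc j) (suc k)))
        ≈⟨ +-cong (reduce a b) (reduce b a) ⟩
      twoRows (tail a) (tail b) g′ + twoRows (tail b) (tail a) g′
        ≈⟨ twoRows-antisymmetric (tail a) (tail b) g′ g′-cong ⟩
      0# ∎
      where
      g′ : (Fin n → Fin (2 ℕ.+ n)) → Carrier
      g′ φ = g (shift φ)
      shift-cong : ∀ {φ φ′ : Fin n → Fin (2 ℕ.+ n)} → (∀ i → φ i ≡ φ′ i) → ∀ i → shift φ i ≡ shift φ′ i
      shift-cong eq zero    = ≡.refl
      shift-cong eq (suc i) = ≡.cong suc (eq i)
      g′-cong : ∀ {φ φ′} → (∀ i → φ i ≡ φ′ i) → g′ φ ≈ g′ φ′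
      g′-cong eq = g-cong (shift-cong eq)
      columns : ∀ (j : Fin (2 ℕ.+ n)) (k : Fin (1 ℕ.+ n)) i → punchIn (suc j) (punchIn (suc k) i) ≡ shift (punchIn j ∘ punchIn k) i
      columns j k zero    = ≡.refl
      columns j k (suc i) = ≡.refl
      reduce : ∀ a b → sum (λ j → sum (λ k → term a b g (suc j) (suc k))) ≈ twoRows (tail a) (tail b) g′
      reduce a b = sum-cong-≋ {2 ℕ.+ n} (λ j → sum-cong-≋ {1 ℕ.+ n} (λ k → begin
        (- 1# * sign j) * (a (suc j) * ((- 1# * sign k) * (b (suc (punchIn j k)) * g _)))
          ≈⟨ *-congˡ (*-congˡ (*-congˡ (*-congˡ (g-cong (columns j k))))) ⟩
        (- 1# * sign j) * (a (suc j) * ((- 1# * sign k) * (b (suc (punchIn j k)) * g′ _)))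
          ≈⟨ solve 6 (λ o s t x y z → (:- o :* s) :* (x :* ((:- o :* t) :* (y :* z))) := (o :* o) :* (s :* (x :* (t :* (y :* z)))))
               refl 1# (sign j) (sign k) (a (suc j)) (b (suc (punchIn j k))) (g′ (punchIn j ∘ punchIn k)) ⟩
        (1# * 1#) * term (tail a) (tail b) g′ j k
          ≈⟨ trans (*-congʳ (*-identityˡ 1#)) (*-identityˡ _) ⟩
        term (tail a) (tail b) g′ j k ∎))

  private
    laplace : ∀ {n} → Vector Carrier (suc n) → (Fin n → Vector Carrier (suc n)) → Carrier
    laplace x B = sum (λ j → sign j * (x j * det (λ i l → B i (punchIn j l))))

    laplace-twoRows : ∀ {n} (x : Vector Carrier (2 ℕ.+ n)) (B : Fin (suc n) → Vector Carrier (2 ℕ.+ n)) →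
      laplace x B ≈ twoRows x (B zero) (λ φ → det (λ i l → B (suc i) (φ l)))
    laplace-twoRows {n} x B = sum-cong-≋ {2 ℕ.+ n} (λ j →
      trans (trans (sym (*-assoc _ _ _)) (*-distribˡ-sum (sign j * x j) (λ k → sign k * (B zero (punchIn j k) * det (λ i l → B (suc i) (punchIn j (punchIn k l)))))))
            (sum-cong-≋ {1 ℕ.+ n} (λ k → *-assoc (sign j) (x j) (sign k * (B zero (punchIn j k) * det (λ i l → B (suc i) (punchIn j (punchIn k l))))))))

  module _ (2-torsion-free : ∀ {x} → x + x ≈ 0# → x ≈ 0#) where

    -- If the repeated row is the second, antisymmetry equates the determinant with its negative,
    -- and 2 is cancelled. Otherwise the first two rows are exchanged; the result vanishes because
    -- its minors still contain a repeated row.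
    laplace-repeated : ∀ {n} (B : Fin n → Vector Carrier (suc n)) i → laplace (B i) B ≈ 0#
    laplace-repeated {suc n} B zero = 2-torsion-free (trans (+-cong (laplace-twoRows (B zero) B) (laplace-twoRows (B zero) B))
      (twoRows-antisymmetric (B zero) (B zero) _ (λ eq → det-cong (λ i l → reflexive (≡.cong (B (suc i)) (eq l))))))
    laplace-repeated {suc n} B (suc i) = begin
      laplace (B (suc i)) B
        ≈⟨ laplace-twoRows (B (suc i)) B ⟩
      twoRows (B (suc i)) (B zero) g
        ≈⟨ +-identityʳ _ ⟨
      twoRows (B (suc i)) (B zero) g + 0#
        ≈⟨ +-congˡ swapped ⟨
      twoRows (B (suc i)) (B zero) g + laplace (B zero) C
        ≈⟨ +-congˡ (laplace-twoRows (B zero) C) ⟩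
      twoRows (B (suc i)) (B zero) g + twoRows (B zero) (B (suc i)) g
        ≈⟨ twoRows-antisymmetric (B (suc i)) (B zero) g (λ eq → det-cong (λ i l → reflexive (≡.cong (B (suc i)) (eq l)))) ⟩
      0# ∎
      where
      g : (Fin n → Fin (2 ℕ.+ n)) → Carrier
      g φ = det (λ i l → B (suc i) (φ l))
      C : Fin (suc n) → Vector Carrier (2 ℕ.+ n)
      C = B (suc i) ∷ (λ l → B (suc l))
      swapped : laplace (B zero) C ≈ 0#
      swapped = sum-0 (λ j → trans (*-congˡ {sign j} (trans (*-congˡ {B zero j} (laplace-repeated (λ l k → B (suc l) (punchIn j k)) i)) (zeroʳ _))) (zeroʳ (sign j)))

    -- The first row of `u · A` is that of `A` plus multiples of lower rows, each contributing an
    -- expansion with a repeated row; the minors are treated by induction with `minor u`.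
    det-unipotent : ∀ {n} {u : Matrix n} (A : Matrix n) → IsUpperUnipotent u → det (u · A) ≈ det A
    det-unipotent {zero}  A U = refl
    det-unipotent {suc n} {u} A U = begin
      sum (λ j → sign j * ((u · A) zero j * det (λ i l → (u · A) (suc i) (punchIn j l))))
        ≈⟨ sum-cong-≋ {suc n} (λ j → *-congˡ {sign j} (*-cong (+-congʳ {sum (λ l → u zero (suc l) * A (suc l) j)} (trans (*-congʳ (proj₁ U zero)) (*-identityˡ (A zero j))))
             (trans (det-cong (λ i l → trans (+-congʳ (trans (*-congʳ (below-U U i)) (zeroˡ (A zero (punchIn j l))))) (+-identityˡ _)))
                    (det-unipotent {u = minor u} (λ i l → A (suc i) (punchIn j l)) (minor-U U))))) ⟩
      sum (λ j → sign j * ((A zero j + sum (λ l → u zero (suc l) * A (suc l) j)) * d j))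
        ≈⟨ sum-cong-≋ {suc n} (λ j → trans (*-congˡ {sign j} (distribʳ (d j) (A zero j) (sum (λ l → u zero (suc l) * A (suc l) j)))) (distribˡ (sign j) _ _)) ⟩
      sum (λ j → sign j * (A zero j * d j) + sign j * (sum (λ l → u zero (suc l) * A (suc l) j) * d j))
        ≈⟨ ∑-distrib-+ (λ j → sign j * (A zero j * d j)) (λ j → sign j * (sum (λ l → u zero (suc l) * A (suc l) j) * d j)) ⟩
      det A + sum (λ j → sign j * (sum (λ l → u zero (suc l) * A (suc l) j) * d j))
        ≈⟨ +-congˡ (sum-cong-≋ {suc n} (λ j → trans (*-congˡ {sign j} (*-distribʳ-sum (d j) (λ l → u zero (suc l) * A (suc l) j)))
             (*-distribˡ-sum (sign j) (λ l → u zero (suc l) * A (suc l) j * d j)))) ⟩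
      det A + sum (λ j → sum (λ l → sign j * (u zero (suc l) * A (suc l) j * d j)))
        ≈⟨ +-congˡ (∑-comm (λ j l → sign j * (u zero (suc l) * A (suc l) j * d j))) ⟩
      det A + sum (λ l → sum (λ j → sign j * (u zero (suc l) * A (suc l) j * d j)))
        ≈⟨ +-congˡ (sum-0 (λ l → trans (sum-cong-≋ {suc n} (λ j →
               solve 4 (λ s x y z → s :* (x :* y :* z) := x :* (s :* (y :* z))) refl (sign j) (u zero (suc l)) (A (suc l) j) (d j)))
             (trans (sym (*-distribˡ-sum (u zero (suc l)) (λ j → sign j * (A (suc l) j * d j))))
             (trans (*-congˡ (laplace-repeated (λ i → A (suc i)) l)) (zeroʳ _))))) ⟩
      det A + 0#
        ≈⟨ +-identityʳ _ ⟩
      det A ∎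
      where
      d : Vector Carrier (suc n)
      d j = det (λ i l → A (suc i) (punchIn j l))

  sign-square : ∀ {n} (i : Fin n) → sign i * sign i ≈ 1#
  sign-square zero    = *-identityˡ 1#
  sign-square (suc i) = begin
    (- 1# * sign i) * (- 1# * sign i)   ≈⟨ solve 2 (λ o s → (:- o :* s) :* (:- o :* s) := o :* o :* (s :* s)) refl 1# (sign i) ⟩
    1# * 1# * (sign i * sign i)         ≈⟨ *-cong (*-identityˡ 1#) (sign-square i) ⟩
    1# * 1#                             ≈⟨ *-identityˡ 1# ⟩
    1#                                  ∎

  private
    punchIn-fromℕ : ∀ {n} (l : Fin n) → punchIn (Fin.fromℕ n) l ≡ inject₁ l
    punchIn-fromℕ zero    = ≡.refl
    punchIn-fromℕ (suc l) = ≡.cong suc (punchIn-fromℕ l)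

  -- A zero pattern above the antidiagonal leaves a single term of the Laplace expansion.
  det-antitriangular : ∀ {n} {A : Matrix n} (q : Vector Carrier n) →
                       (∀ i j → j Fin.< opposite i → A i j ≈ 0#) →
                       (∀ i → A i (opposite i) ≈ q i * sign (opposite i)) → det A ≈ prod q
  det-antitriangular {zero}  q above antidiagonal = refl
  det-antitriangular {suc n} {A} q above antidiagonal = begin
    sum t
      ≈⟨ sum-init-last t ⟩
    sum (init t) + last t
      ≈⟨ +-congʳ (sum-0 (λ j → trans (*-congˡ (trans (*-congʳ (above zero (inject₁ j) (inject₁<fromℕ j))) (zeroˡ _))) (zeroʳ _))) ⟩
    0# + last t
      ≈⟨ +-identityˡ _ ⟩
    sign (Fin.fromℕ n) * (A zero (Fin.fromℕ n) * det (λ i l → A (suc i) (punchIn (Fin.fromℕ n) l)))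
      ≈⟨ *-congˡ (*-cong (antidiagonal zero)
           (trans (det-cong (λ i l → reflexive (≡.cong (A (suc i)) (punchIn-fromℕ l))))
                  (det-antitriangular {A = λ i l → A (suc i) (inject₁ l)} (tail q) above′ antidiagonal′))) ⟩
    sign (Fin.fromℕ n) * (q zero * sign (Fin.fromℕ n) * prod (tail q))
      ≈⟨ solve 3 (λ s x y → s :* (x :* s :* y) := (s :* s) :* (x :* y)) refl (sign (Fin.fromℕ n)) (q zero) (prod (tail q)) ⟩
    sign (Fin.fromℕ n) * sign (Fin.fromℕ n) * prod q
      ≈⟨ trans (*-congʳ (sign-square (Fin.fromℕ n))) (*-identityˡ _) ⟩
    prod q ∎
    where
    t : Vector Carrier (suc n)
    t j = sign j * (A zero j * det (λ i l → A (suc i) (punchIn j l)))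
    inject₁<fromℕ : ∀ (j : Fin n) → inject₁ j Fin.< Fin.fromℕ n
    inject₁<fromℕ j = ≡.subst (toℕ (inject₁ j) ℕ.<_) (≡.sym (toℕ-fromℕ n)) (Fin.inject₁ℕ< j)
    above′ : ∀ i j → j Fin.< opposite i → A (suc i) (inject₁ j) ≈ 0#
    above′ i j j<i = above (suc i) (inject₁ j)
      (≡.subst₂ ℕ._<_ (≡.sym (toℕ-inject₁ j)) (≡.sym (toℕ-inject₁ (opposite i))) j<i)
    antidiagonal′ : ∀ i → A (suc i) (inject₁ (opposite i)) ≈ q (suc i) * sign (opposite i)
    antidiagonal′ i = trans (antidiagonal (suc i)) (*-congˡ (reflexive (≡.cong ((- 1#) ^_) (toℕ-inject₁ (opposite i)))))

-- Integral equivalence: decidability and finitely many representatives.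

open _∣_ using (quotient; equality)

module ℤᵁ = UnipotentEquivalence ℤ.+-*-commutativeRing

module IntegralEquivalence where

  open ≡ using (refl; sym; trans; cong; cong₂)
  open ℤᴹ using (Matrix; I; I-U; _≋_)

  ≢0⇒regular : ∀ {i} → i ≢ 0ℤ → ℤᵁ.Regular i
  ≢0⇒regular {i} i≢0 {j} {k} = ℤ.*-cancelˡ-≡ i j k {{ℤ.≢-nonZero i≢0}}

  private
    isolate : ∀ p a b t → b ≡ p ℤ.* t ℤ.+ a → b ℤ.- a ≡ t ℤ.* p
    isolate p a _ t refl = lemma p a t
      where
      lemma : ∀ p a t → p ℤ.* t ℤ.+ a ℤ.- a ≡ t ℤ.* p
      lemma = solve-∀

    restore : ∀ p a b t → b ℤ.- a ≡ t ℤ.* p → b ≡ p ℤ.* t ℤ.+ a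
    restore p a b t eq = trans (lemma a b) (trans (cong (ℤ._+ a) eq) (cong (ℤ._+ a) (ℤ.*-comm t p)))
      where
      lemma : ∀ a b → b ≡ b ℤ.- a ℤ.+ a
      lemma = solve-∀

  _~ℤ_ : ∀ {n} → Matrix n → Matrix n → Set
  A ~ℤ B = ∃[ u ] ∃[ v ] A ℤᵁ.~[ u , v ] B

  -- The factors relating the Schur complements are unique, so one pair decides: an equivalence
  -- exists exactly when, for that pair, the discrepancies in the first row and column are divisible
  -- by the corner.
  ~-decidable : ∀ {n} (A B : Matrix n) → (∀ i → ℤᵁ.pivots A i ≢ 0ℤ) → Dec (∃[ u ] ∃[ v ] A ℤᵁ.~[ u , v ] B)
  ~-decidable {zero}  A B _ = yes (I , I , ℤᵁ.mk~ I-U I-U (λ ()))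
  ~-decidable {suc n} A B pivots≢0 with B zero zero ℤ.≟ A zero zero | ~-decidable (ℤᵁ.schur A) (ℤᵁ.schur B) (pivots≢0 ∘ suc)
  ... | no ≢ | _ = no λ (u , v , A~B) → ≢ (ℤᵁ.Descent.corner (ℤᵁ.descend A~B))
  ... | yes _ | no ≁ = no λ (u , v , A~B) → ≁ (_ , _ , ℤᵁ.Descent.schur~ (ℤᵁ.descend A~B))
  ... | yes corner | yes (u , v , schur~)
    with all? (λ j → A zero zero ∣? (ℤᵁ.row B j ℤ.- (v ℤᵁ.⋆ ℤᵁ.row A) j))
       | all? (λ i → A zero zero ∣? (ℤᵁ.col B i ℤ.- (u ℤᵁ.⋆ ℤᵁ.col A) i))
  ... | yes s | yes t = yes (_ , _ , ℤᵁ.lift {A = A} {B} {u} {v} {λ i → quotient (t i)} {λ j → quotient (s j)} (≢0⇒regular (pivots≢0 zero)) corner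
          (λ j → restore (A zero zero) ((v ℤᵁ.⋆ ℤᵁ.row A) j) (ℤᵁ.row B j) (quotient (s j)) (equality (s j))) (λ i → restore (A zero zero) ((u ℤᵁ.⋆ ℤᵁ.col A) i) (ℤᵁ.col B i) (quotient (t i)) (equality (t i))) schur~)
  ... | no ∤ | _ = no λ (u′ , v′ , A~B) → ∤ λ j →
    let D = ℤᵁ.descend A~B
        v≋ = proj₂ (ℤᵁ.~-unique (≢0⇒regular ∘ pivots≢0 ∘ suc) schur~ (ℤᵁ.Descent.schur~ D))
    in divides (ℤᵁ.row v′ j) (isolate (A zero zero) ((v ℤᵁ.⋆ ℤᵁ.row A) j) (ℤᵁ.row B j) (ℤᵁ.row v′ j) (trans (ℤᵁ.Descent.top D j) (cong (λ x → A zero zero ℤ.* ℤᵁ.row v′ j ℤ.+ x) (sym (ℤᵁ.⋆-congʳ v≋ (ℤᵁ.row A) j)))))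
  ... | yes _ | no ∤ = no λ (u′ , v′ , A~B) → ∤ λ i →
    let D = ℤᵁ.descend A~B
        u≋ = proj₁ (ℤᵁ.~-unique (≢0⇒regular ∘ pivots≢0 ∘ suc) schur~ (ℤᵁ.Descent.schur~ D))
    in divides (ℤᵁ.row u′ i) (isolate (A zero zero) ((u ℤᵁ.⋆ ℤᵁ.col A) i) (ℤᵁ.col B i) (ℤᵁ.row u′ i) (trans (ℤᵁ.Descent.left D i) (cong (λ x → A zero zero ℤ.* ℤᵁ.row u′ i ℤ.+ x) (sym (ℤᵁ.⋆-congʳ u≋ (ℤᵁ.col A) i)))))

  boundedVectors : ∀ n → ℕ → List (Vector ℤ n)
  boundedVectors zero    p = List.[ (λ ()) ]
  boundedVectors (suc n) p = List.cartesianProductWith (λ r x → + r ∷ x) (List.upTo p) (boundedVectors n p)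

  boundedVectors-complete : ∀ {n p} (x : Vector ℤ n) → (∀ i → ∃[ r ] r ℕ.< p × x i ≡ + r) →
                            Any (λ y → ∀ i → x i ≡ y i) (boundedVectors n p)
  boundedVectors-complete {zero}  x _ = here (λ ())
  boundedVectors-complete {suc n} x bounded =
    Any.cartesianProductWith⁺ (λ r y → + r ∷ y) (λ { x₀≡r x≗y zero → x₀≡r ; x₀≡r x≗y (suc i) → x≗y i })
      (let r , r<p , x₀≡r = bounded zero in lose (∈-upTo⁺ r<p) x₀≡r)
      (boundedVectors-complete (x ∘ suc) (bounded ∘ suc))

  -- The matrix with first row (p, x), first column (p, y) and Schur complement S; the
  -- division is exact if there is such a matrix.
  fromSchur : ∀ {n} (p : ℕ) .{{_ : NonZero p}} → Vector ℤ n → Vector ℤ n → Matrix n → Matrix (suc n)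
  fromSchur p x y S = ℤᵁ.block (+ p) x y (λ i j → (y i ℤ.* x j ℤ.- S i j) /ℕ p)

  -- Every matrix with the given pivots is equivalent to one whose successive
  -- first rows and columns are reduced modulo the pivots.
  representatives : ∀ {n} (p : Vector ℕ n) → (∀ i → NonZero (p i)) → List (Matrix n)
  representatives {zero}  p p≢0 = List.[ I ]
  representatives {suc n} p p≢0 =
    List.cartesianProductWith (λ S (x , y) → fromSchur (p zero) {{p≢0 zero}} x y S)
      (representatives (tail p) (p≢0 ∘ suc))
      (List.cartesianProduct (boundedVectors n (p zero)) (boundedVectors n (p zero)))

  private
    *-/ℕ : ∀ (i : ℤ) p .{{_ : NonZero p}} → (+ p ℤ.* i) /ℕ p ≡ i
    *-/ℕ i p@(suc _) = ℤ.*-cancelʳ-≡ _ i (+ p) (begin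
      k /ℕ p ℤ.* + p                         ≡⟨ ℤ.+-identityˡ _ ⟨
      + 0 ℤ.+ k /ℕ p ℤ.* + p                 ≡⟨ cong (λ r → + r ℤ.+ k /ℕ p ℤ.* + p) k%p≡0 ⟨
      + (k %ℕ p) ℤ.+ k /ℕ p ℤ.* + p          ≡⟨ ℤ.a≡a%ℕn+[a/ℕn]*n k p ⟨
      k                                      ≡⟨ ℤ.*-comm (+ p) i ⟩
      i ℤ.* + p                              ∎)
      where
      open ≡-Reasoning
      k = + p ℤ.* i
      k%p≡0 : k %ℕ p ≡ 0
      k%p≡0 = small (k %ℕ p) (ℤ.n%ℕd<d k p) (ℤ.∣⇒∣ᵤ (divides (i ℤ.- k /ℕ p) (begin
        + (k %ℕ p)                                          ≡⟨ lemma (+ (k %ℕ p)) (k /ℕ p ℤ.* + p) ⟩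
        + (k %ℕ p) ℤ.+ k /ℕ p ℤ.* + p ℤ.- k /ℕ p ℤ.* + p    ≡⟨ cong (ℤ._- k /ℕ p ℤ.* + p) (ℤ.a≡a%ℕn+[a/ℕn]*n k p) ⟨
        k ℤ.- k /ℕ p ℤ.* + p                                ≡⟨ lemma′ (+ p) i (k /ℕ p) ⟩
        (i ℤ.- k /ℕ p) ℤ.* + p                              ∎)))
        where
        lemma : ∀ a b → a ≡ a ℤ.+ b ℤ.- b
        lemma = solve-∀
        lemma′ : ∀ p i q → p ℤ.* i ℤ.- q ℤ.* p ≡ (i ℤ.- q) ℤ.* p
        lemma′ = solve-∀
        small : ∀ r → r ℕ.< p → p ℕ.∣ r → r ≡ 0
        small zero    _   _   = refl
        small (suc r) r<p p∣r = contradiction p∣r (ℕ.>⇒∤ r<p)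

  -- The factors that bring the Schur complement to a representative are extended so that the new
  -- first row and column are reduced; the inner entries are then forced, by an exact division.
  representatives-complete : ∀ {n} (p : Vector ℕ n) (p≢0 : ∀ i → NonZero (p i)) (A : Matrix n) →
    (∀ i → ℤᵁ.pivots A i ≡ + p i) → Any (λ B → ∃[ u ] ∃[ v ] A ℤᵁ.~[ u , v ] B) (representatives p p≢0)
  representatives-complete {zero}  p p≢0 A _ = here (I , I , ℤᵁ.mk~ I-U I-U (λ ()))
  representatives-complete {suc n} p p≢0 A pivots≡p =
    let S , S∈ , u , v , schur~ = find (representatives-complete (tail p) (p≢0 ∘ suc) (ℤᵁ.schur A) (pivots≡p ∘ suc))
        U = ℤᵁ.unipotent-U {t = t u} (ℤᵁ.left-U schur~)
        V = ℤᵁ.unipotent-U {t = s v} (ℤᵁ.right-U schur~)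
        open Reduced u v schur~ U V
        x , x∈ , x≗ = find (boundedVectors-complete (ℤᵁ.row B) (λ j → _ , ℤ.n%ℕd<d (h v j) p₀ , row≡ j))
        y , y∈ , y≗ = find (boundedVectors-complete (ℤᵁ.col B) (λ i → _ , ℤ.n%ℕd<d (g u i) p₀ , col≡ i))
    in Any.cartesianProductWith⁺ (λ S (x , y) → fromSchur p₀ x y S)
         (λ { refl (refl , refl) → _ , _ , ℤᵁ.~-cong {A = A} (λ _ _ → refl) (reduced x≗ y≗) A~B })
         S∈ (Any.cartesianProduct⁺ x∈ y∈)
    where
    p₀ = p zero
    instance
      _ = p≢0 zero
    h g : Matrix n → Vector ℤ n
    h v = v ℤᵁ.⋆ ℤᵁ.row A
    g u = u ℤᵁ.⋆ ℤᵁ.col A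
    -- Minus the quotients: adding these multiples of the corner leaves the remainders modulo `p₀`.
    s t : Matrix n → Vector ℤ n
    s v j = ℤ.- (h v j /ℕ p₀)
    t u i = ℤ.- (g u i /ℕ p₀)

    remainder : ∀ b a → b ≡ A zero zero ℤ.* (ℤ.- (a /ℕ p₀)) ℤ.+ a → b ≡ + (a %ℕ p₀)
    remainder b a eq = begin
      b                                                               ≡⟨ eq ⟩
      A zero zero ℤ.* (ℤ.- (a /ℕ p₀)) ℤ.+ a                           ≡⟨ cong₂ (λ x y → x ℤ.* (ℤ.- (a /ℕ p₀)) ℤ.+ y) (pivots≡p zero) (ℤ.a≡a%ℕn+[a/ℕn]*n a p₀) ⟩
      + p₀ ℤ.* (ℤ.- (a /ℕ p₀)) ℤ.+ (+ (a %ℕ p₀) ℤ.+ (a /ℕ p₀) ℤ.* + p₀) ≡⟨ lemma (+ p₀) (a /ℕ p₀) (+ (a %ℕ p₀)) ⟩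
      + (a %ℕ p₀)                                                     ∎
      where
      open ≡-Reasoning
      lemma : ∀ p q r → p ℤ.* (ℤ.- q) ℤ.+ (r ℤ.+ q ℤ.* p) ≡ r
      lemma = solve-∀

    module Reduced (u v : Matrix n) {S} (schur~ : ℤᵁ.schur A ℤᵁ.~[ u , v ] S)
                   (U : ℤᴹ.IsUpperUnipotent (ℤᵁ.unipotent (t u) u)) (V : ℤᴹ.IsUpperUnipotent (ℤᵁ.unipotent (s v) v)) where
      B : Matrix (suc n)
      B = (ℤᵁ.unipotent (t u) u ℤᵁ.ᵀ) ℤᴹ.· (A ℤᴹ.· ℤᵁ.unipotent (s v) v)

      A~B : A ℤᵁ.~[ ℤᵁ.unipotent (t u) u , ℤᵁ.unipotent (s v) v ] B
      A~B = ℤᵁ.mk~ U V (λ _ _ → refl)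

      open ℤᵁ.Descent (ℤᵁ.descend A~B) renaming (schur~ to schurB~)

      corner≡ : B zero zero ≡ + p₀
      corner≡ = trans corner (pivots≡p zero)

      row≡ : ∀ j → ℤᵁ.row B j ≡ + (h v j %ℕ p₀)
      row≡ j = remainder _ _ (top j)

      col≡ : ∀ i → ℤᵁ.col B i ≡ + (g u i %ℕ p₀)
      col≡ i = remainder _ _ (left i)

      reduced : ∀ {x y} → (∀ j → ℤᵁ.row B j ≡ x j) → (∀ i → ℤᵁ.col B i ≡ y i) → B ≋ fromSchur p₀ x y S
      reduced x≗ y≗ zero    zero    = corner≡
      reduced x≗ y≗ zero    (suc j) = x≗ j
      reduced x≗ y≗ (suc i) zero    = y≗ i
      reduced {x} {y} x≗ y≗ (suc i) (suc j) = begin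
        B (suc i) (suc j)
          ≡⟨ *-/ℕ (B (suc i) (suc j)) p₀ ⟨
        (+ p₀ ℤ.* B (suc i) (suc j)) /ℕ p₀
          ≡⟨ cong (λ q → (q ℤ.* B (suc i) (suc j)) /ℕ p₀) corner≡ ⟨
        (B zero zero ℤ.* B (suc i) (suc j)) /ℕ p₀
          ≡⟨ cong (_/ℕ p₀) (lemma (ℤᵁ.col B i ℤ.* ℤᵁ.row B j) _) ⟩
        (ℤᵁ.col B i ℤ.* ℤᵁ.row B j ℤ.- ℤᵁ.schur B i j) /ℕ p₀
          -- The Schur complement of `B` is `S`, both being the image of `schur A` under the same
          -- `u` and `v`.
          ≡⟨ cong₂ (λ a b → (a ℤ.- b) /ℕ p₀) (cong₂ ℤ._*_ (y≗ i) (x≗ j))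
               (trans (sym (ℤᵁ.equation schurB~ i j)) (ℤᵁ.equation schur~ i j)) ⟩
        (y i ℤ.* x j ℤ.- S i j) /ℕ p₀ ∎
        where
        open ≡-Reasoning
        lemma : ∀ a b → b ≡ a ℤ.- (a ℤ.- b)
        lemma = solve-∀

open IntegralEquivalence

-- Reversal of the rows and the Bruhat decomposition.

opposite-< : ∀ {n} {i j : Fin n} → i Fin.< j → opposite j Fin.< opposite i
opposite-< {n} {i} {j} i<j = ≡.subst₂ ℕ._<_ (≡.sym (Fin.opposite-prop j)) (≡.sym (Fin.opposite-prop i))
  (ℕ.∸-monoʳ-< (s≤s i<j) (Fin.toℕ<n j))

opposite-inject₁ : ∀ {n} (i : Fin n) → opposite (inject₁ i) ≡ suc (opposite i)
opposite-inject₁ i = ≡.trans (≡.cong opposite (≡.cong inject₁ (≡.sym (opposite-involutive i))))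
  (opposite-involutive (suc (opposite i)))

module Reversal {r ℓ} (R : CommutativeRing r ℓ) where

  open CommutativeRing R hiding (zero)
  open Matrices R
  open RingProperties ring
  open Sum semiring
  open SetoidReasoning setoid
  open UnipotentEquivalence R
  open Determinant R
  open IntegerEmbedding R using (module Solver)
  open Solver using (solve; _:=_; _:*_)

  flipRows : ∀ {n} → Matrix n → Matrix n
  flipRows A i j = A (opposite i) j

  infixl 8 _ᴿ
  -- Reflection in the antidiagonal. It preserves upper unipotent matrices, and its transpose is `u`
  -- with both rows and columns reversed.
  _ᴿ : ∀ {n} → Matrix n → Matrix n
  (u ᴿ) i j = u (opposite j) (opposite i)

  ᴿ-U : ∀ {n} {u : Matrix n} → IsUpperUnipotent u → IsUpperUnipotent (u ᴿ)
  ᴿ-U (d , l) = (λ i → d (opposite i)) , (λ i j j<i → l (opposite j) (opposite i) (opposite-< j<i))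

  ᴿ-involutive : ∀ {n} (u : Matrix n) → u ᴿ ᴿ ≋ u
  ᴿ-involutive u i j = reflexive (≡.cong₂ u (opposite-involutive i) (opposite-involutive j))

  flipRows-involutive : ∀ {n} (A : Matrix n) → flipRows (flipRows A) ≋ A
  flipRows-involutive A i j = reflexive (≡.cong (λ i → A i j) (opposite-involutive i))

  flipRows-injective : ∀ {n} {A B : Matrix n} → flipRows A ≋ flipRows B → A ≋ B
  flipRows-injective {A = A} {B} eq = ≋-trans (≋-sym (flipRows-involutive A))
    (≋-trans (λ i j → eq (opposite i) j) (flipRows-involutive B))

  sum-opposite : ∀ {n} (f : Vector Carrier n) → sum f ≈ sum (f ∘ opposite)
  sum-opposite f = sum-permute f Permutation.reverse

  flipRows-· : ∀ {n} (u A : Matrix n) → (u ᴿ) ᵀ · flipRows A ≋ flipRows (u · A)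
  flipRows-· u A i j = sym (sum-opposite (λ l → u (opposite i) l * A l j))

  sum-single : ∀ {n} (k : Fin n) (f g : Vector Carrier n) →
               sum (λ l → (if does (k ≟ l) then f l else 0#) * g l) ≈ f k * g k
  sum-single {suc n} zero    f g = trans (+-congˡ (trans (sum-cong-≋ {n} (λ l → zeroˡ _)) (sum-replicate-zero n))) (+-identityʳ _)
  sum-single {suc n} (suc k) f g = trans (+-cong (zeroˡ _) (sum-single k (f ∘ suc) (g ∘ suc))) (+-identityˡ _)

  diag-· : ∀ {n} (d : Vector Carrier n) (A : Matrix n) → diag d · A ≋ scaleRows d A
  diag-· {n} d A i j = sum-single i (λ _ → d i) (λ l → A l j)

  w₀≡ : ∀ {n} (i l : Fin n) → w₀ i l ≡ (if does (opposite i ≟ l) then sign l else 0#)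
  w₀≡ i l with i ≟ opposite l | opposite i ≟ l
  ... | yes _  | yes _   = ≡.refl
  ... | no _   | no _    = ≡.refl
  ... | yes eq | no neq  = contradiction (≡.trans (≡.cong opposite eq) (opposite-involutive l)) neq
  ... | no neq | yes eq  = contradiction (≡.trans (≡.sym (opposite-involutive i)) (≡.cong opposite eq)) neq

  w₀-· : ∀ {n} (A : Matrix n) → w₀ · A ≋ flipRows (scaleRows sign A)
  w₀-· {n} A i j = trans (sum-cong-≋ {n} (λ l → *-congʳ (reflexive (w₀≡ i l)))) (sum-single (opposite i) sign (λ l → A l j))

  -- The diagonal of `diag q · w₀` after its rows are reversed.
  alternating : ∀ {n} → Vector Carrier n → Vector Carrier n
  alternating q l = sign l * q (opposite l)

  -- Reversing the order of the rows turns the Bruhat decomposition b₁ c w₀ b₂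
  -- into an LDU decomposition.
  flipRows-bruhat : ∀ {n} (b₁ b₂ : Matrix n) (q : Vector Carrier n) →
                    (b₁ ᴿ) ᵀ · (diag (alternating q) · b₂) ≋ flipRows (b₁ · diag q · w₀ · b₂)
  flipRows-bruhat b₁ b₂ q = ≋-trans (·-congˡ ((b₁ ᴿ) ᵀ) middle)
    (≋-trans (flipRows-· b₁ (diag q · (w₀ · b₂))) (λ i j → sym (associate (opposite i) j)))
    where
    associate : b₁ · diag q · w₀ · b₂ ≋ b₁ · (diag q · (w₀ · b₂))
    associate = ≋-trans (·-assoc (b₁ · diag q) w₀ b₂) (·-assoc b₁ (diag q) (w₀ · b₂))
    middle : diag (alternating q) · b₂ ≋ flipRows (diag q · (w₀ · b₂))
    middle i j = begin
      (diag (alternating q) · b₂) i j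
        ≈⟨ diag-· (alternating q) b₂ i j ⟩
      sign i * q (opposite i) * b₂ i j
        ≈⟨ solve 3 (λ s x y → s :* x :* y := x :* (s :* y)) refl (sign i) (q (opposite i)) (b₂ i j) ⟩
      q (opposite i) * (sign i * b₂ i j)
        ≈⟨ *-congˡ (reflexive (≡.cong (λ i → sign i * b₂ i j) (opposite-involutive i))) ⟨
      q (opposite i) * (sign (opposite (opposite i)) * b₂ (opposite (opposite i)) j)
        ≈⟨ *-congˡ (w₀-· b₂ (opposite i) j) ⟨
      q (opposite i) * (w₀ · b₂) (opposite i) j
        ≈⟨ diag-· q (w₀ · b₂) (opposite i) j ⟨
      (diag q · (w₀ · b₂)) (opposite i) j ∎

  open CommutativeMonoidSum *-commutativeMonoid public using () renaming (sum to prod; sum-permute to prod-permute; sum-cong-≋ to prod-cong)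

  -- `b₁` only performs row operations. What remains vanishes above the antidiagonal, where the
  -- signs of `w₀` match those of the expansion.
  det-bruhat : (∀ {x} → x + x ≈ 0# → x ≈ 0#) → ∀ {n} {b₁ b₂ : Matrix n} (q : Vector Carrier n) →
               IsUpperUnipotent b₁ → IsUpperUnipotent b₂ → det (b₁ · diag q · w₀ · b₂) ≈ prod q
  det-bruhat 2-torsion-free {n} {b₁} {b₂} q U V = begin
    det (b₁ · diag q · w₀ · b₂)     ≈⟨ det-cong (≋-trans (·-assoc (b₁ · diag q) w₀ b₂) (·-assoc b₁ (diag q) (w₀ · b₂))) ⟩
    det (b₁ · (diag q · (w₀ · b₂))) ≈⟨ det-unipotent 2-torsion-free (diag q · (w₀ · b₂)) U ⟩
    det (diag q · (w₀ · b₂))        ≈⟨ det-antitriangular q above antidiagonal ⟩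
    prod q                          ∎
    where
    entry : ∀ i j → (diag q · (w₀ · b₂)) i j ≈ q i * (sign (opposite i) * b₂ (opposite i) j)
    entry i j = trans (diag-· q (w₀ · b₂) i j) (*-congˡ (w₀-· b₂ i j))
    above : ∀ i j → j Fin.< opposite i → (diag q · (w₀ · b₂)) i j ≈ 0#
    above i j j<i = trans (entry i j) (trans (*-congˡ (trans (*-congˡ (proj₂ V (opposite i) j j<i)) (zeroʳ _))) (zeroʳ _))
    antidiagonal : ∀ i → (diag q · (w₀ · b₂)) i (opposite i) ≈ q i * sign (opposite i)
    antidiagonal i = trans (entry i (opposite i)) (*-congˡ (trans (*-congˡ (proj₁ V (opposite i))) (*-identityʳ _)))

  schur-diag : ∀ {n} (a : Vector Carrier (suc n)) → schur (diag a) ≋ diag (λ l → - (a zero * a (suc l)))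
  schur-diag a i j with i ≟ j
  ... | yes _ = trans (+-congʳ (zeroˡ 0#)) (+-identityˡ _)
  ... | no _  = trans (+-cong (zeroˡ 0#) (-‿cong (zeroʳ (a zero)))) (-‿inverseʳ 0#)

  superdiagonal : ∀ {n} → Matrix (suc n) → Vector Carrier n
  superdiagonal u i = u (inject₁ i) (suc i)

  -- This additivity is what makes `ψ` a character.
  superdiagonal-· : ∀ {n} {u v : Matrix (suc n)} → IsUpperUnipotent u → IsUpperUnipotent v →
                    ∀ i → superdiagonal (u · v) i ≈ superdiagonal u i + superdiagonal v i
  superdiagonal-· {suc n} {u} {v} U V zero = begin
    u zero zero * v zero (suc zero) + (u zero (suc zero) * v (suc zero) (suc zero) + sum (λ l → u zero (suc (suc l)) * v (suc (suc l)) (suc zero)))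
      ≈⟨ +-cong (trans (*-congʳ (proj₁ U zero)) (*-identityˡ _))
           (+-cong (trans (*-congˡ (proj₁ V (suc zero))) (*-identityʳ _))
             (trans (sum-cong-≋ {n} (λ l → trans (*-congˡ (proj₂ V (suc (suc l)) (suc zero) (s≤s (s≤s z≤n)))) (zeroʳ _))) (sum-replicate-zero n))) ⟩
    v zero (suc zero) + (u zero (suc zero) + 0#)
      ≈⟨ trans (+-congˡ (+-identityʳ _)) (+-comm _ _) ⟩
    u zero (suc zero) + v zero (suc zero) ∎
  superdiagonal-· {suc n} U V (suc i) =
    trans (+-congʳ (trans (*-congʳ (below-U U (inject₁ i))) (zeroˡ _)))
          (trans (+-identityˡ _) (superdiagonal-· (minor-U U) (minor-U V) i))

  ~-trans : ∀ {n} {A B C u v u′ v′ : Matrix n} → A ~[ u , v ] B → B ~[ u′ , v′ ] C → A ~[ u · u′ , v · v′ ] C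
  ~-trans {n} {A} {B} {C} {u} {v} {u′} {v′} (mk~ U V A~B) (mk~ U′ V′ B~C) = mk~ (·-U U U′) (·-U V V′)
    (≋-trans (·-congʳ (A · (v · v′)) transposed)
    (≋-trans (·-assoc (u′ ᵀ) (u ᵀ) (A · (v · v′)))
    (≋-trans (·-congˡ (u′ ᵀ) (≋-trans (·-congˡ (u ᵀ) (≋-sym (·-assoc A v v′)))
                              (≋-trans (≋-sym (·-assoc (u ᵀ) (A · v) v′)) (·-congʳ v′ A~B))))
     B~C)))
    where
    transposed : (u · u′) ᵀ ≋ (u′ ᵀ) · (u ᵀ)
    transposed i j = sum-cong-≋ {n} (λ l → *-comm _ _)

  ~-sym : ∀ {n} {A B u v : Matrix n} → A ~[ u , v ] B → B ~[ inv u , inv v ] A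
  ~-sym {n} {A} {B} {u} {v} (mk~ U V A~B) = mk~ (inv-U u) (inv-U v)
    (≋-trans (·-congˡ (inv u ᵀ) (·-congʳ (inv v) (≋-sym A~B)))
    (≋-trans (·-congˡ (inv u ᵀ) (·-assoc (u ᵀ) (A · v) (inv v)))
    (≋-trans (≋-sym (·-assoc (inv u ᵀ) (u ᵀ) (A · v · inv v)))
    (≋-trans (·-cong cancelled (≋-trans (·-assoc A v (inv v)) (≋-trans (·-congˡ A (inv-inverseʳ V)) (·-identityʳ A))))
     (·-identityˡ A)))))
    where
    cancelled : inv u ᵀ · u ᵀ ≋ I
    cancelled i j = trans (sum-cong-≋ {n} (λ l → *-comm _ _)) (trans (inv-inverseʳ U j i) (I-symmetric j i))
      where
      I-symmetric : ∀ {n} (i j : Fin n) → I i j ≈ I j i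
      I-symmetric zero    zero    = refl
      I-symmetric zero    (suc j) = refl
      I-symmetric (suc i) zero    = refl
      I-symmetric (suc i) (suc j) = I-symmetric i j

~ℤ-trans : ∀ {n} {A B C : ℤᴹ.Matrix n} → A ~ℤ B → B ~ℤ C → A ~ℤ C
~ℤ-trans (_ , _ , A~B) (_ , _ , B~C) = _ , _ , Reversal.~-trans ℤ.+-*-commutativeRing A~B B~C

~ℤ-sym : ∀ {n} {A B : ℤᴹ.Matrix n} → A ~ℤ B → B ~ℤ A
~ℤ-sym (_ , _ , A~B) = _ , _ , Reversal.~-sym ℤ.+-*-commutativeRing A~B

-- The pivots prescribed by D.

value≢0 : ∀ d → NonZero (value {P = NonZero} d)
value≢0 (suc _ , _) = _

-- The pivots of diag (r d δ), where δₗ = (-1)ˡ times the l-th entry of (D₁/d, D₂/D₁, …, 1/Dₖ).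
pivotChain : ∀ {k} → ℕ → ℕ → Vector ℕ⁺ k → Vector ℕ (suc k)
pivotChain {zero}  r d D i       = r
pivotChain {suc k} r d D zero    = r ℕ.* value (D zero)
pivotChain {suc k} r d D (suc i) = pivotChain (r ℕ.* r ℕ.* d) (value (D zero)) (tail D) i

pivotChain≢0 : ∀ {k} r d (D : Vector ℕ⁺ k) .{{_ : NonZero r}} .{{_ : NonZero d}} → ∀ i → NonZero (pivotChain r d D i)
pivotChain≢0 {zero}  (suc r) d D i = _
pivotChain≢0 {suc k} r d D zero    = ℕ.m*n≢0 r (value (D zero))
  where instance _ = value≢0 (D zero)
pivotChain≢0 {suc k} r d D (suc i) = pivotChain≢0 (r ℕ.* r ℕ.* d) (value (D zero)) (tail D) i
  where instance
    _ = value≢0 (D zero)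
    _ = ℕ.m*n≢0 r r
    _ = ℕ.m*n≢0 (r ℕ.* r) d

-- (D₁, ..., Dₖ, 1), the numerators of `c` read from the bottom, in a form suited to induction on
-- `D`.
numerators : ∀ {k} → Vector ℕ⁺ k → Vector ℕ⁺ (suc k)
numerators {zero}  D _       = 1⁺
numerators {suc k} D zero    = D zero
numerators {suc k} D (suc l) = numerators (tail D) l

numerators-opposite : ∀ {k} (D : Vector ℕ⁺ k) l → (1⁺ ∷ reverse D) (opposite l) ≡ numerators D l
numerators-opposite {zero}  D zero    = ≡.refl
numerators-opposite {suc k} D zero    = ≡.cong D (opposite-involutive zero)
numerators-opposite {suc k} D (suc l) = ≡.trans (shift (opposite l)) (numerators-opposite (tail D) l)
  where
  shift : ∀ j → (1⁺ ∷ reverse D) (inject₁ j) ≡ (1⁺ ∷ reverse (tail D)) j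
  shift zero    = ≡.refl
  shift (suc j) = ≡.cong D (opposite-inject₁ j)

pivotsOf : ∀ {k} → Vector ℕ⁺ k → Vector ℕ (suc k)
pivotsOf = pivotChain 1 1

-- The set C(c) as the integral matrices with prescribed pivots.

module Cells {a ℓ₁ ℓ₂} (E : ComplexExponential a ℓ₁ ℓ₂) where

  open Kloosterman E
  open C

  ℝ-ring = heytingRing ℝ

  open CommutativeRing ℝ-ring hiding (zero)
  open RingProperties ring
  open IntegerEmbedding ℝ-ring
  open Solver using (solve; _:=_; _:+_; _:*_; _:-_; :-_)
  module ℝᵁ = UnipotentEquivalence ℝ-ring
  open ℝᵁ hiding (Regular)
  open Determinant ℝ-ring using (sign)
  open Reversal ℝ-ring
  module ℤᴰ = Determinant ℤ.+-*-commutativeRing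
  module ℤᴿ = Reversal ℤ.+-*-commutativeRing
  open Sum semiring using (sum; sum-cong-≋; ∑-distrib-+)
  open ℝᴹ
  open SetoidReasoning setoid

  ι : ∀ {n} → ℤᴹ.Matrix n → Matrix n
  ι A i j = fromℤ (A i j)

  fromℕ-invertible : ∀ n → .{{NonZero n}} → Invertible (fromℕ n)
  fromℕ-invertible n with ℝ.#⇒invertible (ℝ-char0 n)
  ... | x⁻¹ , _ , inverse = x⁻¹ , trans (*-congʳ (sym (trans (+-congˡ -0#≈0#) (+-identityʳ _)))) inverse

  *-1/ : ∀ d → fromℕ⁺ d * 1/ d ≈ 1#
  *-1/ (d , [ d≢0 ]) = proj₂ (fromℕ-invertible d {{d≢0}})

  2-torsion-free : ∀ {x} → x + x ≈ 0# → x ≈ 0#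
  2-torsion-free {x} x+x≈0 = invertible⇒regular (fromℕ-invertible 2) (trans (begin
    (1# + (1# + 0#)) * x  ≈⟨ *-congʳ (+-congˡ (+-identityʳ 1#)) ⟩
    (1# + 1#) * x         ≈⟨ distribʳ x 1# 1# ⟩
    1# * x + 1# * x       ≈⟨ +-cong (*-identityˡ x) (*-identityˡ x) ⟩
    x + x                 ≈⟨ x+x≈0 ⟩
    0#                    ∎) (sym (zeroʳ _)))

  fromℤ-injective : ∀ {i j} → fromℤ i ≈ fromℤ j → i ≡ j
  fromℤ-injective {i} {j} i≈j = ℤ.i-j≡0⇒i≡j i j (kernel (i ℤ.- j) (begin
    fromℤ (i ℤ.- j)            ≈⟨ fromℤ-+ i (ℤ.- j) ⟩
    fromℤ i + fromℤ (ℤ.- j)    ≈⟨ +-cong i≈j (fromℤ-neg j) ⟩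
    fromℤ j - fromℤ j          ≈⟨ -‿inverseʳ _ ⟩
    0#                         ∎))
    where
    kernel : ∀ i → fromℤ i ≈ 0# → i ≡ 0ℤ
    kernel (+ zero)  _  = ≡.refl
    kernel (+ suc n) eq = contradiction (ℝ-char0 (suc n)) (ℝ.#-irrefl eq)
    kernel -[1+ n ]  eq = contradiction (ℝ-char0 (suc n)) (ℝ.#-irrefl (trans (sym (-‿involutive _)) (trans (-‿cong eq) -0#≈0#)))

  fromℤ-sum : ∀ {n} (x : Vector ℤ n) → fromℤ (ℤᵁ.∑ x) ≈ sum (fromℤ ∘ x)
  fromℤ-sum {zero}  x = refl
  fromℤ-sum {suc n} x = trans (fromℤ-+ (x zero) _) (+-congˡ (fromℤ-sum (x ∘ suc)))

  ι-· : ∀ {n} (A B : ℤᴹ.Matrix n) → ι (A ℤᴹ.· B) ≋ ι A · ι B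
  ι-· {n} A B i j = trans (fromℤ-sum (λ l → A i l ℤ.* B l j)) (sum-cong-≋ {n} (λ l → fromℤ-* (A i l) (B l j)))

  ι-U : ∀ {n} {u : ℤᴹ.Matrix n} → ℤᴹ.IsUpperUnipotent u → IsUpperUnipotent (ι u)
  ι-U (d , l) = (λ i → trans (fromℤ-cong (d i)) fromℤ-1) , (λ i j j<i → fromℤ-cong (l i j j<i))

  ι-~ : ∀ {n} {A B u v : ℤᴹ.Matrix n} → A ℤᵁ.~[ u , v ] B → ι A ~[ ι u , ι v ] ι B
  ι-~ {A = A} {B} {u} {v} (ℤᵁ.mk~ U V eq) = mk~ (ι-U U) (ι-U V)
    (≋-trans (·-congˡ (ι u ᵀ) (≋-sym (ι-· A v)))
    (≋-trans (≋-sym (ι-· (u ℤᵁ.ᵀ) (A ℤᴹ.· v))) (λ i j → fromℤ-cong (eq i j))))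

  ι-schur : ∀ {n} (A : ℤᴹ.Matrix (suc n)) → schur (ι A) ≋ ι (ℤᵁ.schur A)
  ι-schur A i j = sym (trans (fromℤ-+ (x ℤ.* y) (ℤ.- (p ℤ.* z)))
    (+-cong (fromℤ-* x y) (trans (fromℤ-neg (p ℤ.* z)) (-‿cong (fromℤ-* p z)))))
    where
    x = A (suc i) zero
    y = A zero (suc j)
    p = A zero zero
    z = A (suc i) (suc j)

  ι-pivots : ∀ {n} (A : ℤᴹ.Matrix n) i → pivots (ι A) i ≈ fromℤ (ℤᵁ.pivots A i)
  ι-pivots A zero    = refl
  ι-pivots A (suc i) = trans (pivots-cong (ι-schur A) i) (ι-pivots (ℤᵁ.schur A) i)

  fromℤ-sign : ∀ {n} (j : Fin n) → fromℤ (ℤᴰ.sign j) ≈ sign j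
  fromℤ-sign zero    = fromℤ-1
  fromℤ-sign (suc j) = trans (fromℤ-* (ℤ.- (+ 1)) (ℤᴰ.sign j)) (*-cong (-‿cong fromℤ-1) (fromℤ-sign j))

  ι-det : ∀ {n} (A : ℤᴹ.Matrix n) → det (ι A) ≈ fromℤ (ℤᴹ.det A)
  ι-det {zero}  A = sym fromℤ-1
  ι-det {suc n} A = sym (trans (fromℤ-sum (λ j → ℤᴰ.sign j ℤ.* (A zero j ℤ.* ℤᴹ.det (submatrix j))))
    (sum-cong-≋ {suc n} (λ j → trans (fromℤ-* (ℤᴰ.sign j) (A zero j ℤ.* ℤᴹ.det (submatrix j)))
      (*-cong (fromℤ-sign j) (trans (fromℤ-* (A zero j) (ℤᴹ.det (submatrix j))) (*-congˡ {fromℤ (A zero j)} (sym (ι-det (submatrix j)))))))))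
    where
    submatrix : Fin (suc n) → ℤᴹ.Matrix n
    submatrix j i l = A (suc i) (punchIn j l)

  c-entries : ∀ {k} → Vector ℕ⁺ k → Vector Carrier (suc k)
  c-entries D i = fromℕ⁺ ((1⁺ ∷ reverse D) i) * (1/ (reverse (1⁺ ∷ D) i))

  δ : ∀ {k} → Vector ℕ⁺ k → Vector Carrier (suc k)
  δ D = alternating (c-entries D)

  δ-ratio : ∀ {k} (D : Vector ℕ⁺ k) l → δ D l ≈ sign l * (fromℕ⁺ (numerators D l) * 1/ ((1⁺ ∷ D) l))
  δ-ratio D l = *-congˡ {sign l} (*-cong (reflexive (≡.cong fromℕ⁺ (numerators-opposite D l)))
    (reflexive (≡.cong (λ i → 1/ ((1⁺ ∷ D) i)) (opposite-involutive l))))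

  -- The first pivot is r D₁, and elimination multiplies each remaining entry by it. The common
  -- factor r d thus becomes r D₁ · r d = (r² d) · D₁, which is the same shape with `r` replaced by
  -- r² d and `d` by D₁.
  pivots-diag : ∀ {k} r d (D : Vector ℕ⁺ k) (x : Vector Carrier (suc k)) →
    (∀ l → x l ≈ sign l * (fromℕ r * fromℕ⁺ d * (fromℕ⁺ (numerators D l) * 1/ ((d ∷ D) l)))) →
    ∀ i → pivots (diag x) i ≈ fromℕ (pivotChain r (value d) D i)
  pivots-diag {zero} r d D x eq zero = begin
    x zero                                             ≈⟨ eq zero ⟩
    1# * (fromℕ r * fromℕ⁺ d * ((1# + 0#) * 1/ d))     ≈⟨ solve 5 (λ o z r d e → o :* (r :* d :* ((o :+ z) :* e)) := o :* (o :+ z) :* (r :* (d :* e))) refl 1# 0# (fromℕ r) (fromℕ⁺ d) (1/ d) ⟩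
    1# * (1# + 0#) * (fromℕ r * (fromℕ⁺ d * 1/ d))     ≈⟨ *-cong (trans (*-identityˡ _) (+-identityʳ _)) (*-congˡ (*-1/ d)) ⟩
    1# * (fromℕ r * 1#)                                ≈⟨ trans (*-identityˡ _) (*-identityʳ _) ⟩
    fromℕ r                                            ∎
  pivots-diag {suc k} r d D x eq zero = begin
    x zero                                             ≈⟨ eq zero ⟩
    1# * (fromℕ r * fromℕ⁺ d * (fromℕ⁺ (D zero) * 1/ d)) ≈⟨ solve 5 (λ o r d D e → o :* (r :* d :* (D :* e)) := o :* (d :* e) :* (r :* D)) refl 1# (fromℕ r) (fromℕ⁺ d) (fromℕ⁺ (D zero)) (1/ d) ⟩
    1# * (fromℕ⁺ d * 1/ d) * (fromℕ r * fromℕ⁺ (D zero)) ≈⟨ trans (*-congʳ (trans (*-identityˡ _) (*-1/ d))) (*-identityˡ _) ⟩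
    fromℕ r * fromℕ⁺ (D zero)                           ≈⟨ fromℕ-* r (value (D zero)) ⟨
    fromℕ (r ℕ.* value (D zero))                        ∎
  pivots-diag {suc k} r d D x eq (suc i) = trans (pivots-cong (schur-diag x) i)
    (pivots-diag (r ℕ.* r ℕ.* value d) (D zero) (tail D) (λ l → - (x zero * x (suc l))) eq′ i)
    where
    denominator : ∀ l → 1/ (D l) ≈ 1/ ((D zero ∷ tail D) l)
    denominator zero    = refl
    denominator (suc l) = refl
    eq′ : ∀ l → - (x zero * x (suc l)) ≈ sign l * (fromℕ (r ℕ.* r ℕ.* value d) * fromℕ⁺ (D zero) *
                  (fromℕ⁺ (numerators (tail D) l) * 1/ ((D zero ∷ tail D) l)))
    eq′ l = begin
      - (x zero * x (suc l))
        ≈⟨ -‿cong (*-cong (pivots-diag r d D x eq zero) (trans (eq (suc l)) (*-congˡ {sign (suc l)} (*-congˡ (*-congˡ (denominator l)))))) ⟩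
      - (fromℕ (r ℕ.* value (D zero)) * ((- 1# * sign l) * (fromℕ r * fromℕ⁺ d * n/d)))
        ≈⟨ -‿cong (*-congʳ (fromℕ-* r (value (D zero)))) ⟩
      - (fromℕ r * fromℕ⁺ (D zero) * ((- 1# * sign l) * (fromℕ r * fromℕ⁺ d * n/d)))
        ≈⟨ solve 6 (λ o s r d D e → :- (r :* D :* ((:- o :* s) :* (r :* d :* e))) := o :* (s :* (r :* r :* d :* D :* e))) refl
             1# (sign l) (fromℕ r) (fromℕ⁺ d) (fromℕ⁺ (D zero)) n/d ⟩
      1# * (sign l * (fromℕ r * fromℕ r * fromℕ⁺ d * fromℕ⁺ (D zero) * n/d))
        ≈⟨ *-identityˡ _ ⟩
      sign l * (fromℕ r * fromℕ r * fromℕ⁺ d * fromℕ⁺ (D zero) * n/d)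
        ≈⟨ *-congˡ {sign l} (*-congʳ (*-congʳ (trans (fromℕ-* (r ℕ.* r) (value d)) (*-congʳ (fromℕ-* r r))))) ⟨
      sign l * (fromℕ (r ℕ.* r ℕ.* value d) * fromℕ⁺ (D zero) * n/d) ∎
      where
      n/d = fromℕ⁺ (numerators (tail D) l) * 1/ ((D zero ∷ tail D) l)

  pivots-δ : ∀ {k} (D : Vector ℕ⁺ k) i → pivots (diag (δ D)) i ≈ fromℕ (pivotsOf D i)
  pivots-δ D = pivots-diag 1 1⁺ D (δ D) (λ l → trans (δ-ratio D l) (*-congˡ {sign l} (begin
    fromℕ⁺ (numerators D l) * 1/ ((1⁺ ∷ D) l)                    ≈⟨ trans (*-congʳ (*-identityˡ 1#)) (*-identityˡ _) ⟨
    1# * 1# * (fromℕ⁺ (numerators D l) * 1/ ((1⁺ ∷ D) l))        ≈⟨ *-congʳ (*-cong fromℤ-1 fromℤ-1) ⟨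
    fromℕ 1 * fromℕ⁺ 1⁺ * (fromℕ⁺ (numerators D l) * 1/ ((1⁺ ∷ D) l)) ∎)))

  -- The product (D₁/d)(D₂/D₁)⋯(1/Dₖ) telescopes.
  prod-ratios : ∀ {k} d (D : Vector ℕ⁺ k) → prod (λ l → fromℕ⁺ (numerators D l) * 1/ ((d ∷ D) l)) ≈ 1/ d
  prod-ratios {zero}  d D = trans (*-identityʳ _) (trans (*-congʳ (+-identityʳ 1#)) (*-identityˡ _))
  prod-ratios {suc k} d D = begin
    fromℕ⁺ (D zero) * 1/ d * prod (λ l → fromℕ⁺ (numerators (tail D) l) * 1/ (D l))
      ≈⟨ *-congˡ (trans (prod-cong (λ l → *-congˡ {fromℕ⁺ (numerators (tail D) l)} (denominator l))) (prod-ratios (D zero) (tail D))) ⟩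
    fromℕ⁺ (D zero) * 1/ d * 1/ (D zero)
      ≈⟨ solve 3 (λ x y z → x :* y :* z := x :* z :* y) refl (fromℕ⁺ (D zero)) (1/ d) (1/ (D zero)) ⟩
    fromℕ⁺ (D zero) * 1/ (D zero) * 1/ d
      ≈⟨ trans (*-congʳ (*-1/ (D zero))) (*-identityˡ _) ⟩
    1/ d ∎
    where
    denominator : ∀ l → 1/ (D l) ≈ 1/ ((D zero ∷ tail D) l)
    denominator zero    = refl
    denominator (suc l) = refl

  module _ {k} (D : Vector ℕ⁺ k) where

    prod-c-entries : prod (c-entries D) ≈ 1#
    prod-c-entries = begin
      prod (c-entries D)
        ≈⟨ prod-permute (c-entries D) Permutation.reverse ⟩
      prod (c-entries D ∘ opposite)
        ≈⟨ prod-cong (λ l → *-cong (reflexive (≡.cong fromℕ⁺ (numerators-opposite D l)))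
             (reflexive (≡.cong (λ i → 1/ ((1⁺ ∷ D) i)) (opposite-involutive l)))) ⟩
      prod (λ l → fromℕ⁺ (numerators D l) * 1/ ((1⁺ ∷ D) l))
        ≈⟨ prod-ratios 1⁺ D ⟩
      1/ 1⁺
        ≈⟨ trans (*-congʳ fromℤ-1) (*-identityˡ _) ⟨
      fromℕ⁺ 1⁺ * 1/ 1⁺
        ≈⟨ *-1/ 1⁺ ⟩
      1# ∎

    cell : (G : ℤᴹ.Matrix (suc k)) (W V : Matrix (suc k)) → diag (δ D) ~[ W , V ] ι G → C D
    cell G W V (mk~ W-U V-U eq) = record
      { γ        = ℤᴿ.flipRows G
      -- The determinant is computed over ℝ from the factorisation, where the diagonal of `c` has
      -- product 1, and pulled back along the injection of ℤ.
      ; det-γ    = fromℤ-injective (begin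
          fromℤ (ℤᴹ.det (ℤᴿ.flipRows G))     ≈⟨ ι-det (ℤᴿ.flipRows G) ⟨
          det (ι (ℤᴿ.flipRows G))            ≈⟨ Determinant.det-cong ℝ-ring bruhat ⟩
          det (W ᴿ · diag (c-entries D) · w₀ · V)        ≈⟨ det-bruhat 2-torsion-free (c-entries D) (ᴿ-U W-U) V-U ⟩
          prod (c-entries D)                             ≈⟨ prod-c-entries ⟩
          1#                                 ≈⟨ fromℤ-1 ⟨
          fromℤ (+ 1)                        ∎)
      ; b₁       = W ᴿ
      ; b₂       = V
      ; b₁-U     = ᴿ-U W-U
      ; b₂-U     = V-U
      ; γ≋b₁cwb₂ = bruhat
      }
      where
      bruhat : ι (ℤᴿ.flipRows G) ≋ W ᴿ · diag (c-entries D) · w₀ · V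
      bruhat = flipRows-injective (≋-trans (flipRows-involutive (ι G)) (≋-trans (≋-sym eq)
        (≋-trans (·-congʳ (diag (δ D) · V) (λ i j → sym (ᴿ-involutive W j i))) (flipRows-bruhat (W ᴿ) V (c-entries D)))))

  rows : ∀ {k} {D : Vector ℕ⁺ k} → C D → ℤᴹ.Matrix (suc k)
  rows x = ℤᴿ.flipRows (γ x)

  rows-cell : ∀ {k} (D : Vector ℕ⁺ k) G W V eq → rows (cell D G W V eq) ℤᴹ.≋ G
  rows-cell D G W V eq = ℤᴿ.flipRows-involutive G

  factorization : ∀ {k} {D : Vector ℕ⁺ k} (x : C D) → diag (δ D) ~[ b₁ x ᴿ , b₂ x ] ι (rows x)
  factorization {D = D} x = mk~ (ᴿ-U (b₁-U x)) (b₂-U x)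
    (≋-trans (flipRows-bruhat (b₁ x) (b₂ x) (c-entries D)) (λ i j → sym (γ≋b₁cwb₂ x (opposite i) j)))

  rows-pivots : ∀ {k} {D : Vector ℕ⁺ k} (x : C D) i → ℤᵁ.pivots (rows x) i ≡ + pivotsOf D i
  rows-pivots {D = D} x i = fromℤ-injective (begin
    fromℤ (ℤᵁ.pivots (rows x) i)  ≈⟨ ι-pivots (rows x) i ⟨
    pivots (ι (rows x)) i         ≈⟨ ~-pivots (factorization x) i ⟨
    pivots (diag (δ D)) i         ≈⟨ pivots-δ D i ⟩
    fromℕ (pivotsOf D i)          ∎)

  δ-pivots-invertible : ∀ {k} (D : Vector ℕ⁺ k) i → Invertible (pivots (diag (δ D)) i)
  δ-pivots-invertible D i with fromℕ-invertible (pivotsOf D i) {{pivotChain≢0 1 1 D i}}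
  ... | x⁻¹ , inverse = x⁻¹ , trans (*-congʳ (pivots-δ D i)) inverse

  module _ {k} (D : Vector ℕ⁺ k) (G : ℤᴹ.Matrix (suc k)) (eq : ∀ i → ℤᵁ.pivots G i ≡ + pivotsOf D i) where

    private
      decomposition : ∃[ W ] ∃[ V ] diag (δ D) ~[ W , V ] ι G
      decomposition = pivots⇒~ (δ-pivots-invertible D)
        (λ i → trans (pivots-δ D i) (trans (fromℤ-cong (≡.sym (eq i))) (sym (ι-pivots G i))))

    -- The right pivots suffice for membership in C(c): the unipotent factors are found over ℝ,
    -- where the pivots are invertible. The converse is `rows-pivots`.
    cellOf : C D
    cellOf = cell D G _ _ (proj₂ (proj₂ decomposition))

    rows-cellOf : rows cellOf ℤᴹ.≋ G
    rows-cellOf = ℤᴿ.flipRows-involutive G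

  ∼⇒~ : ∀ {k} {D : Vector ℕ⁺ k} {x y : C D} → x ∼ y → rows x ~ℤ rows y
  ∼⇒~ {x = x} {y} (u , v , U , V , eq) = u ℤᴿ.ᴿ , v , ℤᵁ.mk~ (ℤᴿ.ᴿ-U U) V
    (ℤᴹ.≋-trans (ℤᴿ.flipRows-· u (γ x ℤᴹ.· v))
      (λ i j → ≡.trans (≡.sym (ℤᴹ.·-assoc u (γ x) v (opposite i) j)) (eq (opposite i) j)))

  ~⇒∼ : ∀ {k} {D : Vector ℕ⁺ k} {x y : C D} → rows x ~ℤ rows y → x ∼ y
  ~⇒∼ {x = x} {y} (u , v , ℤᵁ.mk~ U V eq) = u ℤᴿ.ᴿ , v , ℤᴿ.ᴿ-U U , V ,
    ℤᴹ.≋-trans (ℤᴹ.·-assoc (u ℤᴿ.ᴿ) (γ x) v)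
      (ℤᴿ.flipRows-injective (ℤᴹ.≋-trans (ℤᴹ.≋-sym (ℤᴿ.flipRows-· (u ℤᴿ.ᴿ) (γ x ℤᴹ.· v)))
        (ℤᴹ.≋-trans (ℤᴹ.·-congʳ (rows x ℤᴹ.· v) (λ i j → ℤᴿ.ᴿ-involutive u j i)) eq)))

  -- The summand and its invariance on double cosets.

  weight : ∀ {k} {D : Vector ℕ⁺ k} (M N : Vector ℤ k) → C D → ℂ.Carrier
  weight M N x = ψ (reverse M) (b₁ x) ℂ.* ψ N (b₂ x)

  ψ-superdiagonal : ∀ {k} (M : Vector ℤ k) {u v : Matrix (suc k)} →
                    (∀ i → superdiagonal u i ≈ superdiagonal v i) → ψ M u ℂ.≈ ψ M v
  ψ-superdiagonal {k} M eq = e-cong (sum-cong-≋ {k} (λ i → *-congˡ {fromℤ (M i)} (eq i)))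

  -- Reflection in the antidiagonal reverses the superdiagonal, which undoes the reversal of `M` in
  -- the definition of the sum.
  ψ-reverse : ∀ {k} (M : Vector ℤ k) (W : Matrix (suc k)) → ψ (reverse M) (W ᴿ) ℂ.≈ ψ M W
  ψ-reverse {k} M W = e-cong (trans
    (sum-cong-≋ {k} (λ i → *-congˡ {fromℤ (M (opposite i))}
      (reflexive (≡.cong (W (inject₁ (opposite i))) (opposite-inject₁ i)))))
    (sym (sum-opposite (λ i → fromℤ (M i) * superdiagonal W i))))

  weight-ᴿ : ∀ {k} {D : Vector ℕ⁺ k} (M N : Vector ℤ k) (x : C D) →
             weight M N x ℂ.≈ ψ M (b₁ x ᴿ) ℂ.* ψ N (b₂ x)
  weight-ᴿ M N x = ℂ.*-congʳ (ℂ.trans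
    (ψ-superdiagonal (reverse M) {b₁ x} {b₁ x ᴿ ᴿ} (λ i → sym (ᴿ-involutive (b₁ x) (inject₁ i) (suc i))))
    (ψ-reverse M (b₁ x ᴿ)))

  -- The integral factor adds an integer to the argument of `e`.
  ψ-integral : ∀ {k} (M : Vector ℤ k) {u : Matrix (suc k)} {v : ℤᴹ.Matrix (suc k)} → IsUpperUnipotent u →
               ℤᴹ.IsUpperUnipotent v → ψ M (u · ι v) ℂ.≈ ψ M u
  ψ-integral {k} M {u} {v} U V = ℂ.trans (e-cong (begin
    sum (λ i → fromℤ (M i) * superdiagonal (u · ι v) i)
      ≈⟨ sum-cong-≋ {k} (λ i → trans (*-congˡ {fromℤ (M i)} (superdiagonal-· U (ι-U V) i)) (distribˡ _ _ _)) ⟩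
    sum (λ i → fromℤ (M i) * superdiagonal u i + fromℤ (M i) * superdiagonal (ι v) i)
      ≈⟨ ∑-distrib-+ (λ i → fromℤ (M i) * superdiagonal u i) (λ i → fromℤ (M i) * superdiagonal (ι v) i) ⟩
    sum (λ i → fromℤ (M i) * superdiagonal u i) + sum (λ i → fromℤ (M i) * superdiagonal (ι v) i)
      ≈⟨ +-congˡ (trans (fromℤ-sum (λ i → M i ℤ.* v (inject₁ i) (suc i)))
           (sum-cong-≋ {k} (λ i → fromℤ-* (M i) (v (inject₁ i) (suc i))))) ⟨
    sum (λ i → fromℤ (M i) * superdiagonal u i) + fromℤ s ∎))
    (ℂ.trans (e-+ _ _) (ℂ.trans (ℂ.*-congˡ (e-ℤ s)) (ℂ.*-identityʳ _)))
    where
    s = ℤᵁ.∑ (λ i → M i ℤ.* v (inject₁ i) (suc i))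

  -- Composing the factorisation of `x` with the integral equivalence gives a factorisation of `y`.
  -- By uniqueness its factors are those of `y`, so they differ from those of `x` by integral ones
  -- only.
  weight-∼ : ∀ {k} {D : Vector ℕ⁺ k} (M N : Vector ℤ k) {x y : C D} → x ∼ y → weight M N x ℂ.≈ weight M N y
  weight-∼ {D = D} M N {x} {y} x∼y =
    ℂ.trans (weight-ᴿ M N x)
    (ℂ.trans (ℂ.sym (ℂ.*-cong (ψ-integral M {b₁ x ᴿ} {u} (ᴿ-U (b₁-U x)) (ℤᵁ.left-U A~B)) (ψ-integral N {b₂ x} {v} (b₂-U x) (ℤᵁ.right-U A~B))))
    (ℂ.trans (ℂ.*-cong (ψ-superdiagonal M {b₁ x ᴿ · ι u} {b₁ y ᴿ} (λ i → proj₁ same (inject₁ i) (suc i))) (ψ-superdiagonal N {b₂ x · ι v} {b₂ y} (λ i → proj₂ same (inject₁ i) (suc i))))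
    (ℂ.sym (weight-ᴿ M N y))))
    where
    rows~ = ∼⇒~ {x = x} {y} x∼y
    u = proj₁ rows~
    v = proj₁ (proj₂ rows~)
    A~B = proj₂ (proj₂ rows~)
    same : b₁ x ᴿ · ι u ≋ b₁ y ᴿ × b₂ x · ι v ≋ b₂ y
    same = ~-unique (λ i → invertible⇒regular (δ-pivots-invertible D i))
      (~-trans (factorization x) (ι-~ A~B)) (factorization y)

  -- Decidable equality and finiteness of X(c).

  X-decSetoid : ∀ {k} → Vector ℕ⁺ k → DecSetoid (a ⊔ ℓ₁) 0ℓ
  X-decSetoid D = record
    { isDecEquivalence = record
      { isEquivalence = Setoid.isEquivalence (X D)
      ; _≟_           = λ x y → map′ (~⇒∼ {x = x} {y}) (∼⇒~ {x = x} {y})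
          (~-decidable (rows x) (rows y) (λ i eq → ℕ.≢-nonZero⁻¹ _ {{pivotChain≢0 1 1 D i}} (ℤ.+-injective (≡.trans (≡.sym (rows-pivots x i)) eq))))
      }
    }

  module _ {k} (D : Vector ℕ⁺ k) where

    open Enumerates (X D) using (IsEnumeration)
    open Uniqueness (X D) using (Unique)

    private
      HasPivots : ℤᴹ.Matrix (suc k) → Set
      HasPivots G = ∀ i → ℤᵁ.pivots G i ≡ + pivotsOf D i

      hasPivots? : ∀ G → Dec (HasPivots G)
      hasPivots? G = all? (λ i → ℤᵁ.pivots G i ℤ.≟ + pivotsOf D i)

      -- The division in `fromSchur` may fail to be exact for an arbitrary choice of residues; the
      -- pivot test keeps only matrices that come from C(c).
      cells : ℤᴹ.Matrix (suc k) → List (C D)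
      cells G with hasPivots? G
      ... | yes eq = List.[ cellOf D G eq ]
      ... | no _   = List.[]

      cells-complete : ∀ x G → rows x ~ℤ G → Any (x ∼_) (cells G)
      cells-complete x G rows~G@(u , v , A~B) with hasPivots? G
      ... | yes eq = here (~⇒∼ {x = x} {cellOf D G eq} (u , v , ℤᵁ.~-cong (λ _ _ → ≡.refl) (ℤᴹ.≋-sym (rows-cellOf D G eq)) A~B))
      ... | no neq = contradiction (λ i → ≡.trans (≡.sym (ℤᵁ.~-pivots A~B i)) (rows-pivots x i)) neq

    finite : ∃[ xs ] IsEnumeration xs × Unique xs
    finite = List.deduplicate _≟′_ xs , EnumeratesProperties.deduplicate⁺ (X-decSetoid D) complete , DecUniquenessProperties.deduplicate-! (X-decSetoid D) xs
      where
      open DecSetoid (X-decSetoid D) using () renaming (_≟_ to _≟′_)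
      xs = List.concatMap cells (representatives (pivotsOf D) (pivotChain≢0 1 1 D))
      complete : IsEnumeration xs
      complete x = Any.concatMap⁺ cells (Any.map (cells-complete x _)
        (representatives-complete (pivotsOf D) (pivotChain≢0 1 1 D) (rows x) (rows-pivots x)))

-- Integral equivalence of glued matrices in terms of their two constituents.

module IntegralGluing where

  open ≡ using (refl; sym; trans; cong; cong₂)
  open ℤᴹ using (Matrix; _≋_; ≋-sym; IsUpperUnipotent)
  open ℤᵁ using (schur; row; col; minor; minor-U; unipotent; unipotent-U; scaleRows; cornerScale; _⋆_; _~[_,_]_; mk~; left-U; right-U; descend; lift; Descent)
  open ≡-Reasoning

  gcd≡1⇒bézout : ∀ m n → gcd m n ≡ 1 → ∃[ α ] ∃[ β ] α ℤ.* + n ℤ.+ β ℤ.* + m ≡ 1ℤ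
  gcd≡1⇒bézout m n eq with subst (λ d → Bézout.Identity d m n) eq (Bézout.identity (gcd-GCD m n))
  ... | Bézout.+- x y eq = ℤ.- (+ y) , + x , (begin
    ℤ.- (+ y) ℤ.* + n ℤ.+ + x ℤ.* + m             ≡⟨ cong (λ x → ℤ.- (+ y) ℤ.* + n ℤ.+ x) (ℤ.pos-* x m) ⟨
    ℤ.- (+ y) ℤ.* + n ℤ.+ + (x ℕ.* m)             ≡⟨ cong (λ k → ℤ.- (+ y) ℤ.* + n ℤ.+ + k) eq ⟨
    ℤ.- (+ y) ℤ.* + n ℤ.+ (1ℤ ℤ.+ + (y ℕ.* n))    ≡⟨ cong (λ k → ℤ.- (+ y) ℤ.* + n ℤ.+ (1ℤ ℤ.+ k)) (ℤ.pos-* y n) ⟩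
    ℤ.- (+ y) ℤ.* + n ℤ.+ (1ℤ ℤ.+ + y ℤ.* + n)    ≡⟨ lemma (+ y) (+ n) ⟩
    1ℤ                                            ∎)
    where
    lemma : ∀ y n → ℤ.- y ℤ.* n ℤ.+ (1ℤ ℤ.+ y ℤ.* n) ≡ 1ℤ
    lemma = solve-∀
  ... | Bézout.-+ x y eq = + y , ℤ.- (+ x) , (begin
    + y ℤ.* + n ℤ.+ ℤ.- (+ x) ℤ.* + m             ≡⟨ cong (λ z → z ℤ.+ ℤ.- (+ x) ℤ.* + m) (ℤ.pos-* y n) ⟨
    + (y ℕ.* n) ℤ.+ ℤ.- (+ x) ℤ.* + m             ≡⟨ cong (λ k → + k ℤ.+ ℤ.- (+ x) ℤ.* + m) eq ⟨
    1ℤ ℤ.+ + (x ℕ.* m) ℤ.+ ℤ.- (+ x) ℤ.* + m      ≡⟨ cong (λ k → 1ℤ ℤ.+ k ℤ.+ ℤ.- (+ x) ℤ.* + m) (ℤ.pos-* x m) ⟩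
    1ℤ ℤ.+ + x ℤ.* + m ℤ.+ ℤ.- (+ x) ℤ.* + m      ≡⟨ lemma (+ x) (+ m) ⟩
    1ℤ                                            ∎)
    where
    lemma : ∀ x m → 1ℤ ℤ.+ x ℤ.* m ℤ.+ ℤ.- x ℤ.* m ≡ 1ℤ
    lemma = solve-∀

  -- Z = [[p, d, 0], [a, b, -q], [0, -Y₁]], where Y has the first row (ad - pb, pq) and Y₁
  -- below it.
  record Glued {k} (p d a : ℤ) (Y : Matrix (suc k)) (Z : Matrix (2 ℕ.+ k)) : Set where
    field
      corner : Z zero zero ≡ p
      row₀   : row Z zero ≡ d
      row₊   : ∀ j → row Z (suc j) ≡ 0ℤ
      col₀   : col Z zero ≡ a
      col₊   : ∀ i → col Z (suc i) ≡ 0ℤ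
      scaled : schur Z ≋ scaleRows (cornerScale p) Y

  module Coprime {p t α β : ℤ} (bézout : α ℤ.* t ℤ.+ β ℤ.* p ≡ 1ℤ) where

    -- x = α(tx) + (βx)p
    ∣-cancel : ∀ {x} → p ∣ t ℤ.* x → p ∣ x
    ∣-cancel {x} p∣tx = subst (p ∣_) (begin
      α ℤ.* (t ℤ.* x) ℤ.+ β ℤ.* x ℤ.* p       ≡⟨ lemma α β t p x ⟩
      (α ℤ.* t ℤ.+ β ℤ.* p) ℤ.* x             ≡⟨ cong (ℤ._* x) bézout ⟩
      1ℤ ℤ.* x                                ≡⟨ ℤ.*-identityˡ x ⟩
      x                                       ∎)
      (ℤ.∣m∣n⇒∣m+n (ℤ.∣n⇒∣m*n α p∣tx) (divides (β ℤ.* x) refl))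
      where
      lemma : ∀ α β t p x → α ℤ.* (t ℤ.* x) ℤ.+ β ℤ.* x ℤ.* p ≡ (α ℤ.* t ℤ.+ β ℤ.* p) ℤ.* x
      lemma = solve-∀

    module _ {k} {d a : ℤ} {Y : Matrix (suc k)} {Z : Matrix (2 ℕ.+ k)} (glued : Glued p d a Y Z) (Y₀₀≡t : Y zero zero ≡ t) where

      open Glued glued

      determinant : a ℤ.* d ℤ.- p ℤ.* Z (suc zero) (suc zero) ≡ t
      determinant = begin
        a ℤ.* d ℤ.- p ℤ.* z                              ≡⟨ cong₂ (λ x y → x ℤ.- y ℤ.* z) (cong₂ ℤ._*_ col₀ row₀) corner ⟨
        schur Z zero zero                                ≡⟨ scaled zero zero ⟩
        1ℤ ℤ.* Y zero zero                               ≡⟨ ℤ.*-identityˡ _ ⟩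
        Y zero zero                                      ≡⟨ Y₀₀≡t ⟩
        t                                                ∎
        where z = Z (suc zero) (suc zero)

      -- Modulo `p` one has a d ≡ t, and `t` is a unit there; hence so is `a`.
      a-cancel : ∀ {x} → p ∣ x ℤ.* a → p ∣ x
      a-cancel {x} p∣xa = ∣-cancel (subst (p ∣_) (begin
        x ℤ.* a ℤ.* d ℤ.- x ℤ.* z ℤ.* p     ≡⟨ lemma a d p x z ⟩
        (a ℤ.* d ℤ.- p ℤ.* z) ℤ.* x         ≡⟨ cong (ℤ._* x) determinant ⟩
        t ℤ.* x                             ∎)
        (ℤ.∣m∣n⇒∣m-n (ℤ.∣m⇒∣m*n d p∣xa) (divides (x ℤ.* z) refl)))
        where
        z = Z (suc zero) (suc zero)
        lemma : ∀ a d p x z → x ℤ.* a ℤ.* d ℤ.- x ℤ.* z ℤ.* p ≡ (a ℤ.* d ℤ.- p ℤ.* z) ℤ.* x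
        lemma = solve-∀

      row-divisible : ∀ j → p ∣ row Y j
      row-divisible j = divides (ℤ.- z) (begin
        row Y j                                   ≡⟨ ℤ.*-identityˡ _ ⟨
        1ℤ ℤ.* row Y j                            ≡⟨ scaled zero (suc j) ⟨
        col Z zero ℤ.* row Z (suc j) ℤ.- Z zero zero ℤ.* z ≡⟨ cong₂ (λ x y → col Z zero ℤ.* x ℤ.- y ℤ.* z) (row₊ j) corner ⟩
        col Z zero ℤ.* 0ℤ ℤ.- p ℤ.* z             ≡⟨ lemma (col Z zero) p z ⟩
        ℤ.- z ℤ.* p                               ∎)
        where
        z = Z (suc zero) (suc (suc j))
        lemma : ∀ c p z → c ℤ.* 0ℤ ℤ.- p ℤ.* z ≡ ℤ.- z ℤ.* p
        lemma = solve-∀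

    ∣-sum : ∀ {n} (u : Matrix n) {x : Vector ℤ n} → (∀ l → p ∣ x l) → ∀ i → p ∣ (u ⋆ x) i
    ∣-sum {n} u {x} p∣x i = go (λ l → u l i) x p∣x
      where
      go : ∀ {n} (u x : Vector ℤ n) → (∀ l → p ∣ x l) → p ∣ ℤᵁ.∑ (λ l → u l ℤ.* x l)
      go {zero}  u x p∣x = divides 0ℤ refl
      go {suc n} u x p∣x = ℤ.∣m∣n⇒∣m+n (ℤ.∣n⇒∣m*n (u zero) (p∣x zero)) (go (tail u) (tail x) (p∣x ∘ suc))

    ∣-difference : ∀ {b s z} → b ≡ p ℤ.* s ℤ.+ z → p ∣ b ℤ.- z
    ∣-difference {b} {s} {z} eq = divides s (trans (cong (ℤ._- z) eq) (lemma p s z))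
      where
      lemma : ∀ p s z → p ℤ.* s ℤ.+ z ℤ.- z ≡ s ℤ.* p
      lemma = solve-∀

    private
      solveFor : ∀ {b z} (p∣ : p ∣ b ℤ.- z) → b ≡ p ℤ.* quotient p∣ ℤ.+ 1ℤ ℤ.* z
      solveFor {b} {z} (divides q eq) = trans (lemma b z) (trans (cong (ℤ._+ z) eq) (lemma′ p q z))
        where
        lemma : ∀ b z → b ≡ b ℤ.- z ℤ.+ z
        lemma = solve-∀
        lemma′ : ∀ p q z → q ℤ.* p ℤ.+ z ≡ p ℤ.* q ℤ.+ 1ℤ ℤ.* z
        lemma′ = solve-∀

    module _ (p≢0 : p ≢ 0ℤ) {k} {d a d′ a′ : ℤ} {Y Y′ : Matrix (suc k)} {Z Z′ : Matrix (2 ℕ.+ k)}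
             (glued : Glued p d a Y Z) (glued′ : Glued p d′ a′ Y′ Z′)
             (Y₀₀≡t : Y zero zero ≡ t) (Y′₀₀≡t : Y′ zero zero ≡ t) where

      private
        module G  = Glued glued
        module G′ = Glued glued′

      -- The factors of `Y ~ℤ Y′` act on the Schur complements once the first row of `u` is
      -- multiplied by `p`. They disturb the zeros of `Z` by `v zero j · d` and `u′ zero i · a`,
      -- which multiples of the corner `p` must remove. For `u′` this is clear; for `v` both first
      -- rows of `Y` and `Y′` are divisible by `p` off the corner, so t · `row v` is, and so is
      -- `row v`.
      glued-cong : p ∣ d′ ℤ.- d → p ∣ a′ ℤ.- a → Y ~ℤ Y′ → Z ~ℤ Z′
      glued-cong p∣Δd p∣Δa (u , v , Y~Y′) = _ , _ ,
        lift {A = Z} {Z′} {u′} {v} {t′} {s′} (subst ℤᵁ.Regular (sym G.corner) (≢0⇒regular p≢0)) (trans G′.corner (sym G.corner)) top left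
          (ℤᵁ.~-cong (≋-sym G.scaled) (≋-sym G′.scaled) (ℤᵁ.conjugate (cornerScale p) U′
            (ℤᵁ.cornerScale-conjugates (left-U Y~Y′) U′ (λ _ → refl) (λ _ _ → refl)) Y~Y′))
        where
        u′ = unipotent (λ i → p ℤ.* row u i) (minor u)
        U′ : IsUpperUnipotent u′
        U′ = unipotent-U (minor-U (left-U Y~Y′))
        p∣v : ∀ j → p ∣ row v j
        p∣v j = ∣-cancel (subst (λ t → p ∣ t ℤ.* row v j) Y₀₀≡t
          (ℤ.∣m+n∣n⇒∣m (subst (p ∣_) (Descent.top (descend Y~Y′) j) (row-divisible glued′ Y′₀₀≡t j))
                       (∣-sum (minor v) (row-divisible glued Y₀₀≡t) j)))
        s′ t′ : Vector ℤ (suc k)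
        s′ = quotient p∣Δd ∷ (λ j → ℤ.- d ℤ.* quotient (p∣v j))
        t′ = quotient p∣Δa ∷ (λ i → ℤ.- a ℤ.* row u i)
        top : ∀ j → row Z′ j ≡ Z zero zero ℤ.* s′ j ℤ.+ (v ⋆ row Z) j
        top j = trans (entry j) (cong₂ (λ x y → x ℤ.* s′ j ℤ.+ y) (sym G.corner)
          (sym (trans (ℤᵁ.⋆-sparse v {row Z} G.row₊ j) (cong (v zero j ℤ.*_) G.row₀))))
          where
          entry : ∀ j → row Z′ j ≡ p ℤ.* s′ j ℤ.+ v zero j ℤ.* d
          entry zero    = trans G′.row₀ (trans (solveFor p∣Δd) (cong (λ x → p ℤ.* s′ zero ℤ.+ x ℤ.* d) (sym (proj₁ (right-U Y~Y′) zero))))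
          entry (suc j) = trans (G′.row₊ j) (trans (lemma p d (quotient (p∣v j))) (cong (λ x → p ℤ.* s′ (suc j) ℤ.+ x ℤ.* d) (sym (equality (p∣v j)))))
            where
            lemma : ∀ p d q → 0ℤ ≡ p ℤ.* (ℤ.- d ℤ.* q) ℤ.+ q ℤ.* p ℤ.* d
            lemma = solve-∀
        left : ∀ i → col Z′ i ≡ Z zero zero ℤ.* t′ i ℤ.+ (u′ ⋆ col Z) i
        left i = trans (entry i) (cong₂ (λ x y → x ℤ.* t′ i ℤ.+ y) (sym G.corner)
          (sym (trans (ℤᵁ.⋆-sparse u′ {col Z} G.col₊ i) (cong (u′ zero i ℤ.*_) G.col₀))))
          where
          entry : ∀ i → col Z′ i ≡ p ℤ.* t′ i ℤ.+ u′ zero i ℤ.* a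
          entry zero    = trans G′.col₀ (solveFor p∣Δa)
          entry (suc i) = trans (G′.col₊ i) (lemma p a (row u i))
            where
            lemma : ∀ p a q → 0ℤ ≡ p ℤ.* (ℤ.- a ℤ.* q) ℤ.+ p ℤ.* q ℤ.* a
            lemma = solve-∀

      -- To undo the scaling integrally, the first row of `u′` must be divisible by `p`. The zeros
      -- in the first columns give 0 = p · `row u` + u′ · a there, and `a` is a unit modulo `p`.
      glued-injective : Z ~ℤ Z′ → p ∣ d′ ℤ.- d × p ∣ a′ ℤ.- a × Y ~ℤ Y′
      glued-injective (u , v , Z~Z′) = p∣Δd , p∣Δa , (unipotent x (minor u′) , minor v ,
        ℤᵁ.unconjugate (cornerScale p) regular (unipotent-U (minor-U (minor-U (left-U Z~Z′))))
          (ℤᵁ.cornerScale-conjugates (unipotent-U (minor-U (minor-U (left-U Z~Z′)))) (minor-U (left-U Z~Z′))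
            (λ i → trans (equality (p∣u i)) (ℤ.*-comm _ p)) (λ _ _ → refl))
          (ℤᵁ.~-cong G.scaled G′.scaled schur~))
        where
        open Descent (descend Z~Z′)
        u′ = minor u
        regular : ∀ i → ℤᵁ.Regular (cornerScale p i)
        regular zero    = ≢0⇒regular {1ℤ} λ ()
        regular (suc i) = ≢0⇒regular p≢0
        top′ : ∀ j → row Z′ j ≡ p ℤ.* row v j ℤ.+ minor v zero j ℤ.* d
        top′ j = trans (top j) (cong₂ (λ x y → x ℤ.* row v j ℤ.+ y) G.corner
          (trans (ℤᵁ.⋆-sparse (minor v) {row Z} G.row₊ j) (cong (minor v zero j ℤ.*_) G.row₀)))
        left′ : ∀ i → col Z′ i ≡ p ℤ.* row u i ℤ.+ u′ zero i ℤ.* a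
        left′ i = trans (left i) (cong₂ (λ x y → x ℤ.* row u i ℤ.+ y) G.corner
          (trans (ℤᵁ.⋆-sparse u′ {col Z} G.col₊ i) (cong (u′ zero i ℤ.*_) G.col₀)))
        p∣Δd : p ∣ d′ ℤ.- d
        p∣Δd = ∣-difference (trans (sym G′.row₀) (trans (top′ zero)
          (cong (λ x → p ℤ.* row v zero ℤ.+ x) (trans (cong (ℤ._* d) (proj₁ (minor-U (right-U Z~Z′)) zero)) (ℤ.*-identityˡ d)))))
        p∣Δa : p ∣ a′ ℤ.- a
        p∣Δa = ∣-difference (trans (sym G′.col₀) (trans (left′ zero)
          (cong (λ x → p ℤ.* row u zero ℤ.+ x) (trans (cong (ℤ._* a) (proj₁ (minor-U (left-U Z~Z′)) zero)) (ℤ.*-identityˡ a)))))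
        p∣u : ∀ i → p ∣ u′ zero (suc i)
        p∣u i = a-cancel glued Y₀₀≡t (ℤ.∣m+n∣m⇒∣n (divides 0ℤ (trans (sym (left′ (suc i))) (G′.col₊ i)))
          (divides (row u (suc i)) (ℤ.*-comm p _)))
        x : Vector ℤ k
        x i = quotient (p∣u i)

open IntegralGluing

-- Behaviour of the pivots under scaling.

open ℤᴹ using () renaming (Matrix to Matrixᶻ)

module _ where
  open ≡
  open ≡-Reasoning

  scaled : ∀ {n} → ℤ → Matrixᶻ n → Matrixᶻ n
  scaled p A i j = p ℤ.* A i j

  schur-cornerScale : ∀ {n} p (A : Matrixᶻ (suc n)) → ℤᵁ.schur (ℤᵁ.scaleRows (ℤᵁ.cornerScale p) A) ℤᴹ.≋ scaled p (ℤᵁ.schur A)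
  schur-cornerScale p A i j = lemma p (A (suc i) zero) (A zero (suc j)) (A zero zero) (A (suc i) (suc j))
    where
    lemma : ∀ p x y z w → p ℤ.* x ℤ.* (1ℤ ℤ.* y) ℤ.- 1ℤ ℤ.* z ℤ.* (p ℤ.* w) ≡ p ℤ.* (x ℤ.* y ℤ.- z ℤ.* w)
    lemma = solve-∀

  schur-scaled : ∀ {n} p (A : Matrixᶻ (suc n)) → ℤᵁ.schur (scaled p A) ℤᴹ.≋ scaled (p ℤ.* p) (ℤᵁ.schur A)
  schur-scaled p A i j = lemma p (A (suc i) zero) (A zero (suc j)) (A zero zero) (A (suc i) (suc j))
    where
    lemma : ∀ p x y z w → p ℤ.* x ℤ.* (p ℤ.* y) ℤ.- p ℤ.* z ℤ.* (p ℤ.* w) ≡ p ℤ.* p ℤ.* (x ℤ.* y ℤ.- z ℤ.* w)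
    lemma = solve-∀

  -- One elimination step turns the scalar `p` into p², in step with `pivotChain`, where (p r)² d =
  -- p² (r² d).
  pivots-unscale : ∀ {k} p .{{_ : NonZero p}} r d (D : Vector ℕ⁺ k) (A : Matrixᶻ (suc k)) →
    (∀ i → ℤᵁ.pivots (scaled (+ p) A) i ≡ + pivotChain (p ℕ.* r) d D i) → ∀ i → ℤᵁ.pivots A i ≡ + pivotChain r d D i
  pivots-unscale {zero} p r d D A eq zero =
    ℤ.*-cancelˡ-≡ (+ p) _ _ (trans (eq zero) (ℤ.pos-* p r))
  pivots-unscale {suc k} p r d D A eq zero =
    ℤ.*-cancelˡ-≡ (+ p) _ _ (trans (eq zero) (trans (cong +_ (ℕ.*-assoc p r (value (D zero)))) (ℤ.pos-* p (r ℕ.* value (D zero)))))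
  pivots-unscale {suc k} p r d D A eq (suc i) = pivots-unscale (p ℕ.* p) {{ℕ.m*n≢0 p p}} (r ℕ.* r ℕ.* d) (value (D zero)) (tail D) (ℤᵁ.schur A)
    (λ i → begin
      ℤᵁ.pivots (scaled (+ (p ℕ.* p)) (ℤᵁ.schur A)) i
        ≡⟨ ℤᵁ.pivots-cong (λ i j → trans (cong (ℤ._* ℤᵁ.schur A i j) (ℤ.pos-* p p)) (sym (schur-scaled (+ p) A i j))) i ⟩
      ℤᵁ.pivots (scaled (+ p) A) (suc i)
        ≡⟨ eq (suc i) ⟩
      + pivotChain (p ℕ.* r ℕ.* (p ℕ.* r) ℕ.* d) (value (D zero)) (tail D) i
        ≡⟨ cong (λ r → + pivotChain r (value (D zero)) (tail D) i) (lemma p r d) ⟩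
      + pivotChain (p ℕ.* p ℕ.* (r ℕ.* r ℕ.* d)) (value (D zero)) (tail D) i ∎) i
    where
    lemma : ∀ p r d → p ℕ.* r ℕ.* (p ℕ.* r) ℕ.* d ≡ p ℕ.* p ℕ.* (r ℕ.* r ℕ.* d)
    lemma = solve-∀ᴺ

-- The gluing bijection on double cosets and the product formula for the summands.

module Gluing {r ℓ₁ ℓ₂} (E : ComplexExponential r ℓ₁ ℓ₂) {m} (D : Vector ℕ⁺ (2 ℕ.+ m))
              (α β : ℤ) (bézout : α ℤ.* + value (D 1F) ℤ.+ β ℤ.* + value (D 0F) ≡ 1ℤ) where

  open Kloosterman E
  open C
  open Cells E
  open ℤᵁ using (row; col; schur; minor; unipotent; unipotent-U; _~[_,_]_; mk~; Descent; descend; lift)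

  p t : ℤ
  p = + value (D 0F)
  t = + value (D 1F)

  p≢0 : p ≢ 0ℤ
  p≢0 eq = ℕ.≢-nonZero⁻¹ (value (D 0F)) {{value≢0 (D 0F)}} (ℤ.+-injective eq)

  instance
    value-nonZero : NonZero (value (D 0F))
    value-nonZero = value≢0 (D 0F)

  open Coprime {p} {t} {α} {β} bézout

  D₂ : Vector ℕ⁺ (suc zero)
  D₂ = D 0F ∷ []

  rows₂-corner : (x : C D₂) → rows x 0F 0F ≡ p
  rows₂-corner x = ≡.trans (rows-pivots x 0F) (≡.cong +_ (ℕ.*-identityˡ _))

  rows₂-determinant : (x : C D₂) → col (rows x) 0F ℤ.* row (rows x) 0F ℤ.- p ℤ.* rows x 1F 1F ≡ 1ℤ
  rows₂-determinant x = ≡.trans (≡.cong (λ p → col (rows x) 0F ℤ.* row (rows x) 0F ℤ.- p ℤ.* rows x 1F 1F) (≡.sym (rows₂-corner x)))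
    (rows-pivots x 1F)

  rows′-corner : (y : C (tail D)) → rows y 0F 0F ≡ t
  rows′-corner y = ≡.trans (rows-pivots y 0F) (≡.cong +_ (ℕ.*-identityˡ _))

  -- Since α t ≡ 1 mod p, adding - α · row Y times the first column makes the rest of the
  -- first row divisible by p.
  module Normalise (y : C (tail D)) where

    Y : Matrixᶻ (2 ℕ.+ m)
    Y = rows y

    shift : Vector ℤ (1 ℕ.+ m)
    shift j = ℤ.- α ℤ.* row Y j

    V : ℤᴹ.IsUpperUnipotent (unipotent shift ℤᴹ.I)
    V = unipotent-U ℤᴹ.I-U

    Ŷ₀ : Matrixᶻ (2 ℕ.+ m)
    Ŷ₀ = (ℤᴹ.I ℤᵁ.ᵀ) ℤᴹ.· (Y ℤᴹ.· unipotent shift ℤᴹ.I)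

    Y~Ŷ₀ : Y ~[ ℤᴹ.I , unipotent shift ℤᴹ.I ] Ŷ₀
    Y~Ŷ₀ = mk~ ℤᴹ.I-U V (λ _ _ → ≡.refl)

    pivots-Ŷ₀ : ∀ i → ℤᵁ.pivots Ŷ₀ i ≡ + pivotsOf (tail D) i
    pivots-Ŷ₀ i = ≡.trans (≡.sym (ℤᵁ.~-pivots Y~Ŷ₀ i)) (rows-pivots y i)

    ŷ : C (tail D)
    ŷ = cellOf (tail D) Ŷ₀ pivots-Ŷ₀

    y∼ŷ : y ∼ ŷ
    y∼ŷ = ~⇒∼ {x = y} {ŷ} (_ , _ , ℤᵁ.~-cong (λ _ _ → ≡.refl) (ℤᴹ.≋-sym (rows-cellOf (tail D) Ŷ₀ pivots-Ŷ₀)) Y~Ŷ₀)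

    -- Since 1 - α t = β p, the quotient by `p` is explicit: β times the old first row. It enters
    -- `gluedMatrix` with a minus sign.
    row-ŷ : ∀ j → row (rows ŷ) j ≡ p ℤ.* (β ℤ.* row Y j)
    row-ŷ j = begin
      row (rows ŷ) j                                              ≡⟨ rows-cellOf (tail D) Ŷ₀ pivots-Ŷ₀ zero (suc j) ⟩
      row Ŷ₀ j                                                    ≡⟨ Descent.top (descend Y~Ŷ₀) j ⟩
      Y 0F 0F ℤ.* (ℤ.- α ℤ.* row Y j) ℤ.+ (ℤᴹ.I ℤᵁ.⋆ row Y) j     ≡⟨ ≡.cong₂ (λ t z → t ℤ.* (ℤ.- α ℤ.* row Y j) ℤ.+ z) (rows′-corner y) (ℤᵁ.I-⋆ (row Y) j) ⟩
      t ℤ.* (ℤ.- α ℤ.* row Y j) ℤ.+ row Y j                       ≡⟨ lemma t α β p (row Y j) ⟩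
      (1ℤ ℤ.- (α ℤ.* t ℤ.+ β ℤ.* p)) ℤ.* row Y j ℤ.+ p ℤ.* (β ℤ.* row Y j) ≡⟨ ≡.cong (λ z → (1ℤ ℤ.- z) ℤ.* row Y j ℤ.+ p ℤ.* (β ℤ.* row Y j)) bézout ⟩
      0ℤ ℤ.+ p ℤ.* (β ℤ.* row Y j)                                ≡⟨ ℤ.+-identityˡ _ ⟩
      p ℤ.* (β ℤ.* row Y j)                                       ∎
      where
      open ≡-Reasoning
      lemma : ∀ t α β p y → t ℤ.* (ℤ.- α ℤ.* y) ℤ.+ y ≡ (1ℤ ℤ.- (α ℤ.* t ℤ.+ β ℤ.* p)) ℤ.* y ℤ.+ p ℤ.* (β ℤ.* y)
      lemma = solve-∀

  open Normalise using (ŷ; y∼ŷ; row-ŷ)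

  module _ (x : C D₂) (y : C (tail D)) where

    private
      d a₀ b₀ : ℤ
      d  = row (rows x) 0F
      a₀ = col (rows x) 0F
      b₀ = rows x 1F 1F

      Ŷ : Matrixᶻ (2 ℕ.+ m)
      Ŷ = rows (ŷ y)

    gluedMatrix : Matrixᶻ (3 ℕ.+ m)
    gluedMatrix = ℤᵁ.block p (d ∷ λ _ → 0ℤ) (t ℤ.* a₀ ∷ λ _ → 0ℤ)
      (ℤᵁ.block (t ℤ.* b₀) (λ j → ℤ.- (β ℤ.* row (rows y) j)) (λ i → ℤ.- Ŷ (suc i) zero) (λ i j → ℤ.- Ŷ (suc i) (suc j)))

    gluedMatrix-glued : Glued p d (t ℤ.* a₀) Ŷ gluedMatrix
    gluedMatrix-glued = record
      { corner = ≡.refl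
      ; row₀   = ≡.refl
      ; row₊   = λ _ → ≡.refl
      ; col₀   = ≡.refl
      ; col₊   = λ _ → ≡.refl
      ; scaled = entries
      }
      where
      open ≡-Reasoning
      entries : schur gluedMatrix ℤᴹ.≋ ℤᵁ.scaleRows (ℤᵁ.cornerScale p) Ŷ
      entries zero zero = begin
        t ℤ.* a₀ ℤ.* d ℤ.- p ℤ.* (t ℤ.* b₀)    ≡⟨ lemma t a₀ d p b₀ ⟩
        t ℤ.* (a₀ ℤ.* d ℤ.- p ℤ.* b₀)          ≡⟨ ≡.cong (t ℤ.*_) (rows₂-determinant x) ⟩
        t ℤ.* 1ℤ                               ≡⟨ ≡.trans (ℤ.*-comm t 1ℤ) (≡.cong (1ℤ ℤ.*_) (≡.sym (rows′-corner (ŷ y)))) ⟩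
        1ℤ ℤ.* Ŷ zero zero                     ∎
        where
        lemma : ∀ t a d p b → t ℤ.* a ℤ.* d ℤ.- p ℤ.* (t ℤ.* b) ≡ t ℤ.* (a ℤ.* d ℤ.- p ℤ.* b)
        lemma = solve-∀
      entries zero (suc j) = begin
        t ℤ.* a₀ ℤ.* 0ℤ ℤ.- p ℤ.* (ℤ.- (β ℤ.* row (rows y) j)) ≡⟨ lemma (t ℤ.* a₀) p (β ℤ.* row (rows y) j) ⟩
        1ℤ ℤ.* (p ℤ.* (β ℤ.* row (rows y) j))                  ≡⟨ ≡.cong (1ℤ ℤ.*_) (row-ŷ y j) ⟨
        1ℤ ℤ.* Ŷ zero (suc j)                                 ∎
        where
        lemma : ∀ a p z → a ℤ.* 0ℤ ℤ.- p ℤ.* (ℤ.- z) ≡ 1ℤ ℤ.* (p ℤ.* z)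
        lemma = solve-∀
      entries (suc i) zero    = lemma d p (Ŷ (suc i) zero)
        where
        lemma : ∀ d p z → 0ℤ ℤ.* d ℤ.- p ℤ.* (ℤ.- z) ≡ p ℤ.* z
        lemma = solve-∀
      entries (suc i) (suc j) = lemma p (Ŷ (suc i) (suc j))
        where
        lemma : ∀ p z → 0ℤ ℤ.* 0ℤ ℤ.- p ℤ.* (ℤ.- z) ≡ p ℤ.* z
        lemma = solve-∀

  private
    module ℝR = CommutativeRing ℝ-ring
    module ℂR = CommutativeRing (heytingRing ℂ)
    open ℝᴹ using (diag; fromℤ; fromℕ)
    open ℝᵁ using () renaming (unipotent to unipotentᴿ; minor to minorᴿ; row to rowᴿ; col to colᴿ; schur to schurᴿ)
    open Reversal ℝ-ring using (_ᴿ; ᴿ-U; schur-diag)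
    open Determinant ℝ-ring using (sign)
    open IntegerEmbedding ℝ-ring
    open Solver using (solve; _:=_; _:+_; _:*_; :-_)
    module ℝ-Reasoning = SetoidReasoning ℝR.setoid

  ⋆-0 : ∀ {n} (u : ℝᴹ.Matrix n) i → (u ℝᵁ.⋆ (λ _ → ℝ.0#)) i ℝ.≈ ℝ.0#
  ⋆-0 {suc n} u i = ℝ.trans (ℝᵁ.⋆-sparse u {λ _ → ℝ.0#} (λ _ → ℝ.refl) i) (ℝR.zeroʳ _)

  δ-corner : ∀ {k} (D : Vector ℕ⁺ (suc k)) → δ D 0F ℝ.≈ fromℤ (+ value (D 0F))
  δ-corner D = ℝ.trans (pivots-δ D 0F) (fromℤ-cong (≡.cong +_ (ℕ.*-identityˡ (value (D 0F)))))

  fromℤ-cornerScale : ∀ {k} (l : Fin (suc k)) → fromℤ (ℤᵁ.cornerScale p l) ℝ.≈ ℝᵁ.cornerScale (fromℤ p) l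
  fromℤ-cornerScale zero    = fromℤ-1
  fromℤ-cornerScale (suc l) = ℝ.refl

  -- In the first entry the corner `p` cancels the denominator D₁, while `δ (tail D)` has
  -- denominator 1 there; in the others it survives. So the diagonal shows the same scaling diag(1,
  -- p, ..., p) as the glued matrix.
  δ-tail : ∀ l → ℝ.- (δ D 0F ℝ.* δ D (suc l)) ℝ.≈ ℝᵁ.cornerScale (fromℤ p) l ℝ.* δ (tail D) l
  δ-tail zero = begin
    ℝ.- (δ D 0F ℝ.* δ D 1F)
      ≈⟨ ℝ.-‿cong (ℝ.*-cong (δ-corner D) (δ-ratio D 1F)) ⟩
    ℝ.- (fromℤ p ℝ.* ((ℝ.- ℝ.1# ℝ.* ℝ.1#) ℝ.* (fromℕ⁺ n ℝ.* 1/ D 0F)))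
      ≈⟨ solve 4 (λ o p n e → :- (p :* ((:- o :* o) :* (n :* e))) := o :* o :* n :* (p :* e)) ℝ.refl ℝ.1# (fromℤ p) (fromℕ⁺ n) (1/ D 0F) ⟩
    ℝ.1# ℝ.* ℝ.1# ℝ.* fromℕ⁺ n ℝ.* (fromℤ p ℝ.* 1/ D 0F)
      ≈⟨ ℝ.*-congˡ (ℝ.trans (*-1/ (D 0F)) (ℝ.sym (ℝ.trans (ℝ.*-congʳ (ℝ.sym fromℤ-1)) (*-1/ 1⁺)))) ⟩
    ℝ.1# ℝ.* ℝ.1# ℝ.* fromℕ⁺ n ℝ.* (ℝ.1# ℝ.* 1/ 1⁺)
      ≈⟨ solve 3 (λ o n e → o :* o :* n :* (o :* e) := o :* o :* (o :* (n :* e))) ℝ.refl ℝ.1# (fromℕ⁺ n) (1/ 1⁺) ⟩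
    ℝ.1# ℝ.* ℝ.1# ℝ.* (ℝ.1# ℝ.* (fromℕ⁺ n ℝ.* 1/ 1⁺))
      ≈⟨ ℝ.*-cong (ℝ.*-identityˡ ℝ.1#) (ℝ.sym (δ-ratio (tail D) 0F)) ⟩
    ℝ.1# ℝ.* δ (tail D) 0F ∎
    where
    open ℝ-Reasoning
    n = numerators (tail D) 0F
  δ-tail (suc l) = begin
    ℝ.- (δ D 0F ℝ.* δ D (suc (suc l)))
      ≈⟨ ℝ.-‿cong (ℝ.*-cong (δ-corner D) (δ-ratio D (suc (suc l)))) ⟩
    ℝ.- (fromℤ p ℝ.* ((ℝ.- ℝ.1# ℝ.* sign (suc l)) ℝ.* n/d))
      ≈⟨ solve 4 (λ o p s e → :- (p :* ((:- o :* s) :* e)) := o :* (p :* (s :* e))) ℝ.refl ℝ.1# (fromℤ p) (sign (suc l)) n/d ⟩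
    ℝ.1# ℝ.* (fromℤ p ℝ.* (sign (suc l) ℝ.* n/d))
      ≈⟨ ℝ.*-identityˡ _ ⟩
    fromℤ p ℝ.* (sign (suc l) ℝ.* n/d)
      ≈⟨ ℝ.*-congˡ {fromℤ p} (δ-ratio (tail D) (suc l)) ⟨
    fromℤ p ℝ.* δ (tail D) (suc l) ∎
    where
    open ℝ-Reasoning
    n/d = fromℕ⁺ (numerators (tail D) (suc l)) ℝ.* 1/ (D (suc l))

  schur-δ : schurᴿ (diag (δ D)) ℝᴹ.≋ ℝᵁ.scaleRows (ℝᵁ.cornerScale (fromℤ p)) (diag (δ (tail D)))
  schur-δ i j = ℝ.trans (schur-diag (δ D) i j) entry
    where
    entry : diag (λ l → ℝ.- (δ D 0F ℝ.* δ D (suc l))) i j ℝ.≈ ℝᵁ.cornerScale (fromℤ p) i ℝ.* diag (δ (tail D)) i j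
    entry with i ≟ j
    ... | yes _ = δ-tail i
    ... | no _  = ℝ.sym (ℝR.zeroʳ _)

  -- The first row of `diag (δ D)` vanishes off the corner, so that of `b₂ x` is the first row of
  -- `rows x` divided by the corner.
  corner-row : ∀ {k} {D : Vector ℕ⁺ (suc k)} (x : C D) j →
               fromℤ (row (rows x) j) ℝ.≈ fromℤ (+ value (D 0F)) ℝ.* rowᴿ (b₂ x) j
  corner-row {D = D} x j = begin
    fromℤ (row (rows x) j)                                        ≈⟨ ℝᵁ.Descent.top (ℝᵁ.descend (factorization x)) j ⟩
    δ D 0F ℝ.* rowᴿ (b₂ x) j ℝ.+ (minorᴿ (b₂ x) ℝᵁ.⋆ (λ _ → ℝ.0#)) j ≈⟨ ℝ.+-cong (ℝ.*-congʳ (δ-corner D)) (⋆-0 (minorᴿ (b₂ x)) j) ⟩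
    fromℤ (+ value (D 0F)) ℝ.* rowᴿ (b₂ x) j ℝ.+ ℝ.0#              ≈⟨ ℝ.+-identityʳ _ ⟩
    fromℤ (+ value (D 0F)) ℝ.* rowᴿ (b₂ x) j                       ∎
    where open ℝ-Reasoning

  corner-col : ∀ {k} {D : Vector ℕ⁺ (suc k)} (x : C D) i →
               fromℤ (col (rows x) i) ℝ.≈ fromℤ (+ value (D 0F)) ℝ.* rowᴿ (b₁ x ᴿ) i
  corner-col {D = D} x i = begin
    fromℤ (col (rows x) i)                                        ≈⟨ ℝᵁ.Descent.left (ℝᵁ.descend (factorization x)) i ⟩
    δ D 0F ℝ.* rowᴿ (b₁ x ᴿ) i ℝ.+ (minorᴿ (b₁ x ᴿ) ℝᵁ.⋆ (λ _ → ℝ.0#)) i ≈⟨ ℝ.+-cong (ℝ.*-congʳ (δ-corner D)) (⋆-0 (minorᴿ (b₁ x ᴿ)) i) ⟩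
    fromℤ (+ value (D 0F)) ℝ.* rowᴿ (b₁ x ᴿ) i ℝ.+ ℝ.0#            ≈⟨ ℝ.+-identityʳ _ ⟩
    fromℤ (+ value (D 0F)) ℝ.* rowᴿ (b₁ x ᴿ) i                     ∎
    where open ℝ-Reasoning

  module _ (x : C D₂) (y : C (tail D)) where

    private
      a₀ = col (rows x) 0F
      Ŷ  = rows (ŷ y)
      Z  = gluedMatrix x y

      W″ V″ : ℝᴹ.Matrix (2 ℕ.+ m)
      W″ = b₁ (ŷ y) ᴿ
      V″ = b₂ (ŷ y)
      Wₓ Vₓ : ℝᴹ.Matrix 2
      Wₓ = b₁ x ᴿ
      Vₓ = b₂ x

      W′ : ℝᴹ.Matrix (2 ℕ.+ m)
      W′ = unipotentᴿ (λ i → fromℤ p ℝ.* rowᴿ W″ i) (minorᴿ W″)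

      w v : Vector ℝ.Carrier (2 ℕ.+ m)
      w = fromℤ t ℝ.* rowᴿ Wₓ 0F ∷ λ _ → ℝ.0#
      v = rowᴿ Vₓ 0F ∷ λ _ → ℝ.0#

      W V : ℝᴹ.Matrix (3 ℕ.+ m)
      W = unipotentᴿ w W′
      V = unipotentᴿ v V″

    -- The factorisation of `ŷ`, moved through the scaling, factors the Schur complement. The first
    -- rows of `W` and `V` are then the first column and row of the glued matrix divided by `p`; the
    -- entry t a₀ makes the former t times that of `x`.
    gluedMatrix-factorization : diag (δ D) ℝᵁ.~[ W , V ] ι Z
    gluedMatrix-factorization = ℝᵁ.lift {A = diag (δ D)} {ι Z} {W′} {V″} {w} {v}
      (ℝᵁ.invertible⇒regular (δ-pivots-invertible D 0F)) (ℝ.sym (δ-corner D)) top left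
      (ℝᵁ.~-cong (ℝᴹ.≋-sym schur-δ) bottom
        (ℝᵁ.conjugate (ℝᵁ.cornerScale (fromℤ p)) W′-U
          (ℝᵁ.cornerScale-conjugates (ᴿ-U (b₁-U (ŷ y))) W′-U (λ _ → ℝ.refl) (λ _ _ → ℝ.refl))
          (factorization (ŷ y))))
      where
      open ℝ-Reasoning
      W′-U : ℝᴹ.IsUpperUnipotent W′
      W′-U = ℝᵁ.unipotent-U (ℝᵁ.minor-U (ᴿ-U (b₁-U (ŷ y))))
      bottom : ℝᵁ.scaleRows (ℝᵁ.cornerScale (fromℤ p)) (ι Ŷ) ℝᴹ.≋ schurᴿ (ι Z)
      bottom i j = begin
        ℝᵁ.cornerScale (fromℤ p) i ℝ.* fromℤ (Ŷ i j)      ≈⟨ ℝ.*-congʳ (fromℤ-cornerScale i) ⟨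
        fromℤ (ℤᵁ.cornerScale p i) ℝ.* fromℤ (Ŷ i j)      ≈⟨ fromℤ-* (ℤᵁ.cornerScale p i) (Ŷ i j) ⟨
        fromℤ (ℤᵁ.cornerScale p i ℤ.* Ŷ i j)              ≈⟨ fromℤ-cong (Glued.scaled (gluedMatrix-glued x y) i j) ⟨
        fromℤ (schur Z i j)                     ≈⟨ ι-schur Z i j ⟨
        schurᴿ (ι Z) i j                        ∎
      simplify : ∀ z (u : ℝᴹ.Matrix (2 ℕ.+ m)) i → δ D 0F ℝ.* z ℝ.+ (u ℝᵁ.⋆ (λ _ → ℝ.0#)) i ℝ.≈ fromℤ p ℝ.* z
      simplify z u i = ℝ.trans (ℝ.+-cong (ℝ.*-congʳ (δ-corner D)) (⋆-0 u i)) (ℝ.+-identityʳ _)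
      top : ∀ j → fromℤ (row Z j) ℝ.≈ δ D 0F ℝ.* v j ℝ.+ (V″ ℝᵁ.⋆ (λ _ → ℝ.0#)) j
      top zero    = ℝ.trans (corner-row x 0F) (ℝ.sym (simplify (v zero) V″ zero))
      top (suc j) = ℝ.sym (ℝ.trans (simplify ℝ.0# V″ (suc j)) (ℝR.zeroʳ _))
      left : ∀ i → fromℤ (col Z i) ℝ.≈ δ D 0F ℝ.* w i ℝ.+ (W′ ℝᵁ.⋆ (λ _ → ℝ.0#)) i
      left zero = begin
        fromℤ (t ℤ.* a₀)                                ≈⟨ fromℤ-* t a₀ ⟩
        fromℤ t ℝ.* fromℤ a₀                            ≈⟨ ℝ.*-congˡ (corner-col x 0F) ⟩
        fromℤ t ℝ.* (fromℤ p ℝ.* rowᴿ Wₓ 0F)            ≈⟨ solve 3 (λ t p w → t :* (p :* w) := p :* (t :* w)) ℝ.refl (fromℤ t) (fromℤ p) (rowᴿ Wₓ 0F) ⟩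
        fromℤ p ℝ.* (fromℤ t ℝ.* rowᴿ Wₓ 0F)            ≈⟨ simplify (w zero) W′ zero ⟨
        δ D 0F ℝ.* w zero ℝ.+ (W′ ℝᵁ.⋆ (λ _ → ℝ.0#)) zero ∎
      left (suc i) = ℝ.sym (ℝ.trans (simplify ℝ.0# W′ (suc i)) (ℝR.zeroʳ _))

    glue : C D
    glue = cell D Z W V gluedMatrix-factorization

    -- The superdiagonals of `W` and `V` consist of one entry from `x` and the rest from `ŷ y`. The
    -- factors `t` and `p` are moved into `M`, `e` turns the sums into products, and `ŷ y` may be
    -- replaced by `y` in the same coset.
    weight-glue : ∀ (M N : Vector ℤ (2 ℕ.+ m)) → weight M N glue ℂ.≈
      weight ((t ℤ.* M 0F) ∷ []) (N 0F ∷ []) x ℂ.* weight ((p ℤ.* M 1F) ∷ tail (tail M)) (tail N) y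
    weight-glue M N =
      ℂ.trans (ℂ.*-cong (ℂ.trans (ψ-reverse M W) ψ-W) ψ-V)
      (ℂ.trans (interchange _ _ _ _)
      (ℂ.*-cong (ℂ.sym (weight-ᴿ (t ℤ.* M 0F ∷ []) (N 0F ∷ []) x))
        (ℂ.trans (ℂ.sym (weight-ᴿ M′ (tail N) (ŷ y))) (ℂ.sym (weight-∼ M′ (tail N) {y} {ŷ y} (y∼ŷ y))))))
      where
      open ℝ-Reasoning
      open CommutativeSemigroupProperties (CommutativeRing.*-commutativeSemigroup (heytingRing ℂ)) using (interchange)
      open Sum (CommutativeRing.semiring ℝ-ring) using (sum)
      M′ : Vector ℤ (1 ℕ.+ m)
      M′ = p ℤ.* M 1F ∷ tail (tail M)
      ψ-W : ψ M W ℂ.≈ ψ (t ℤ.* M 0F ∷ []) Wₓ ℂ.* ψ M′ W″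
      ψ-W = ℂ.trans (e-cong (begin
        fromℤ (M 0F) ℝ.* (fromℤ t ℝ.* rowᴿ Wₓ 0F) ℝ.+ (fromℤ (M 1F) ℝ.* (fromℤ p ℝ.* rowᴿ W″ 0F) ℝ.+ rest)
          ≈⟨ ℝ.+-cong (ℝ.trans (solve 3 (λ m t w → m :* (t :* w) := t :* m :* w) ℝ.refl (fromℤ (M 0F)) (fromℤ t) (rowᴿ Wₓ 0F))
                        (ℝ.trans (ℝ.*-congʳ (ℝ.sym (fromℤ-* t (M 0F)))) (ℝ.sym (ℝ.+-identityʳ _))))
               (ℝ.+-congʳ (ℝ.trans (solve 3 (λ m t w → m :* (t :* w) := t :* m :* w) ℝ.refl (fromℤ (M 1F)) (fromℤ p) (rowᴿ W″ 0F))
                        (ℝ.*-congʳ (ℝ.sym (fromℤ-* p (M 1F)))))) ⟩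
        (fromℤ (t ℤ.* M 0F) ℝ.* rowᴿ Wₓ 0F ℝ.+ ℝ.0#) ℝ.+ (fromℤ (p ℤ.* M 1F) ℝ.* rowᴿ W″ 0F ℝ.+ rest) ∎))
        (e-+ _ _)
        where rest = sum (λ i → fromℤ (M (suc (suc i))) ℝ.* W″ (suc (inject₁ i)) (suc (suc i)))
      ψ-V : ψ N V ℂ.≈ ψ (N 0F ∷ []) Vₓ ℂ.* ψ (tail N) V″
      ψ-V = ℂ.trans (e-cong (ℝ.+-congʳ (ℝ.sym (ℝ.+-identityʳ _)))) (e-+ _ _)

  rows-glue : ∀ x y → gluedMatrix x y ~ℤ rows (glue x y)
  rows-glue x y = _ , _ , ℤᵁ.~-refl (ℤᴹ.≋-sym (rows-cell D (gluedMatrix x y) _ _ (gluedMatrix-factorization x y)))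

  module _ {x x′ : C D₂} {y y′ : C (tail D)} where

    private
      module X′ = Setoid (X (tail D))
      d d′ a₀ a₀′ : ℤ
      d   = row (rows x) 0F
      d′  = row (rows x′) 0F
      a₀  = col (rows x) 0F
      a₀′ = col (rows x′) 0F
      *-distribˡ-- : ∀ t a b → t ℤ.* (a ℤ.- b) ≡ t ℤ.* a ℤ.- t ℤ.* b
      *-distribˡ-- = solve-∀

    glue-cong : x ∼ x′ → y ∼ y′ → glue x y ∼ glue x′ y′
    glue-cong x∼x′ y∼y′ = ~⇒∼ {x = glue x y} {glue x′ y′} (~ℤ-trans (~ℤ-sym (rows-glue x y)) (~ℤ-trans
      (glued-cong p≢0 (gluedMatrix-glued x y) (gluedMatrix-glued x′ y′) (rows′-corner (ŷ y)) (rows′-corner (ŷ y′))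
        (∣-difference row≡) (subst (p ∣_) (*-distribˡ-- t a₀′ a₀) (∣n⇒∣m*n t (∣-difference col≡)))
        (∼⇒~ {x = ŷ y} {ŷ y′} (X′.trans {ŷ y} {y} {ŷ y′} (X′.sym {y} {ŷ y} (y∼ŷ y)) (X′.trans {y} {y′} {ŷ y′} y∼y′ (y∼ŷ y′)))))
      (rows-glue x′ y′)))
      where
      u = proj₁ (∼⇒~ {x = x} {x′} x∼x′)
      v = proj₁ (proj₂ (∼⇒~ {x = x} {x′} x∼x′))
      x~x′ = proj₂ (proj₂ (∼⇒~ {x = x} {x′} x∼x′))
      open Descent (descend x~x′)
      row≡ : d′ ≡ p ℤ.* row v 0F ℤ.+ d
      row≡ = ≡.trans (top 0F) (≡.cong₂ (λ p z → p ℤ.* row v 0F ℤ.+ z) (rows₂-corner x)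
        (ℤᵁ.sum-U (ℤᵁ.minor-U (ℤᵁ.right-U x~x′)) (row (rows x))))
      col≡ : a₀′ ≡ p ℤ.* row u 0F ℤ.+ a₀
      col≡ = ≡.trans (left 0F) (≡.cong₂ (λ p z → p ℤ.* row u 0F ℤ.+ z) (rows₂-corner x)
        (ℤᵁ.sum-U (ℤᵁ.minor-U (ℤᵁ.left-U x~x′)) (col (rows x))))

    -- The Schur complement of `rows x` is the single pivot 1, so the class of `x` is determined by
    -- `d` and `a₀` modulo `p`. The gluing shows only t a₀, from which `t` is cancelled modulo `p`.
    glue-injective : glue x y ∼ glue x′ y′ → x ∼ x′ × y ∼ y′
    glue-injective z∼z′ = x∼x′ , y∼y′
      where
      divisibilities = glued-injective p≢0 (gluedMatrix-glued x y) (gluedMatrix-glued x′ y′) (rows′-corner (ŷ y)) (rows′-corner (ŷ y′))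
        (~ℤ-trans (rows-glue x y) (~ℤ-trans (∼⇒~ {x = glue x y} {glue x′ y′} z∼z′) (~ℤ-sym (rows-glue x′ y′))))
      p∣Δd : p ∣ d′ ℤ.- d
      p∣Δd = proj₁ divisibilities
      p∣Δa : p ∣ a₀′ ℤ.- a₀
      p∣Δa = ∣-cancel (subst (p ∣_) (≡.sym (*-distribˡ-- t a₀′ a₀)) (proj₁ (proj₂ divisibilities)))
      y∼y′ : y ∼ y′
      y∼y′ = X′.trans {y} {ŷ y} {y′} (y∼ŷ y) (X′.trans {ŷ y} {ŷ y′} {y′}
        (~⇒∼ {x = ŷ y} {ŷ y′} (proj₂ (proj₂ divisibilities))) (X′.sym {y′} {ŷ y′} (y∼ŷ y′)))
      solveFor : ∀ {b z} (p∣ : p ∣ b ℤ.- z) → b ≡ rows x 0F 0F ℤ.* quotient p∣ ℤ.+ z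
      solveFor {b} {z} (divides q eq) = ≡.trans (lemma b z) (≡.cong (ℤ._+ z) (≡.trans eq (≡.trans (ℤ.*-comm q p) (≡.cong (ℤ._* q) (≡.sym (rows₂-corner x))))))
        where
        lemma : ∀ b z → b ≡ b ℤ.- z ℤ.+ z
        lemma = solve-∀
      schur≡ : schur (rows x) ℤᴹ.≋ schur (rows x′)
      schur≡ 0F 0F = ≡.trans (rows-pivots x 1F) (≡.sym (rows-pivots x′ 1F))
      x∼x′ : x ∼ x′
      x∼x′ = ~⇒∼ {x = x} {x′} (_ , _ , lift {A = rows x} {rows x′} {ℤᴹ.I} {ℤᴹ.I} {λ _ → quotient p∣Δa} {λ _ → quotient p∣Δd}
        (subst ℤᵁ.Regular (≡.sym (rows₂-corner x)) (≢0⇒regular p≢0)) (≡.trans (rows₂-corner x′) (≡.sym (rows₂-corner x)))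
        (λ { 0F → ≡.trans (solveFor p∣Δd) (≡.cong (λ z → rows x 0F 0F ℤ.* quotient p∣Δd ℤ.+ z) (≡.sym (ℤᵁ.I-⋆ (row (rows x)) 0F))) })
        (λ { 0F → ≡.trans (solveFor p∣Δa) (≡.cong (λ z → rows x 0F 0F ℤ.* quotient p∣Δa ℤ.+ z) (≡.sym (ℤᵁ.I-⋆ (col (rows x)) 0F))) })
        (ℤᵁ.~-refl schur≡))

  module Unglue (z : C D) where

    private
      Z₀ = rows z
      d = row Z₀ 0F
      a = col Z₀ 0F
      b = Z₀ 1F 1F

    corner≡ : Z₀ 0F 0F ≡ p
    corner≡ = ≡.trans (rows-pivots z 0F) (≡.cong +_ (ℕ.*-identityˡ _))

    determinant≡ : a ℤ.* d ℤ.- p ℤ.* b ≡ t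
    determinant≡ = ≡.trans (≡.cong (λ p → a ℤ.* d ℤ.- p ℤ.* b) (≡.sym corner≡)) (≡.trans (rows-pivots z 1F) (≡.cong +_ (ℕ.*-identityˡ _)))

    -- The leading 2 × 2 block has a d - p b = t, so α a inverts `d` modulo `p`, and α d inverts
    -- `a`.
    unit : d ℤ.* (α ℤ.* a) ℤ.+ p ℤ.* (β ℤ.- α ℤ.* b) ≡ 1ℤ
    unit = ≡.trans (lemma α β a b d p) (≡.trans (≡.cong (λ t → α ℤ.* t ℤ.+ β ℤ.* p) determinant≡) bézout)
      where
      lemma : ∀ α β a b d p → d ℤ.* (α ℤ.* a) ℤ.+ p ℤ.* (β ℤ.- α ℤ.* b) ≡ α ℤ.* (a ℤ.* d ℤ.- p ℤ.* b) ℤ.+ β ℤ.* p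
      lemma = solve-∀

    -- With x₀ e + p f = 1, where f = β - α b, each later entry y of `x` equals e y · x₀ + f y · p
    -- and is removed by subtracting these multiples. The leading 0 leaves x₀ itself unchanged.
    clear : ℤ → Vector ℤ (2 ℕ.+ m) → Matrixᶻ (3 ℕ.+ m)
    clear e x = unipotent (0ℤ ∷ λ j → ℤ.- (β ℤ.- α ℤ.* b) ℤ.* x (suc j)) (unipotent (λ j → ℤ.- e ℤ.* x (suc j)) ℤᴹ.I)

    clear-U : ∀ e x → ℤᴹ.IsUpperUnipotent (clear e x)
    clear-U e x = unipotent-U (unipotent-U ℤᴹ.I-U)

    cleared : ∀ e (x : Vector ℤ (2 ℕ.+ m)) → x 0F ℤ.* e ℤ.+ p ℤ.* (β ℤ.- α ℤ.* b) ≡ 1ℤ → ∀ j →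
              Z₀ 0F 0F ℤ.* row (clear e x) (suc j) ℤ.+ (minor (clear e x) ℤᵁ.⋆ x) (suc j) ≡ 0ℤ
    cleared e x eq j = begin
      Z₀ 0F 0F ℤ.* (ℤ.- f ℤ.* y) ℤ.+ (ℤ.- e ℤ.* y ℤ.* x 0F ℤ.+ (ℤᴹ.I ℤᵁ.⋆ (λ l → x (suc l))) j)
        ≡⟨ ≡.cong₂ (λ p z → p ℤ.* (ℤ.- f ℤ.* y) ℤ.+ (ℤ.- e ℤ.* y ℤ.* x 0F ℤ.+ z)) corner≡ (ℤᵁ.I-⋆ (λ l → x (suc l)) j) ⟩
      p ℤ.* (ℤ.- f ℤ.* y) ℤ.+ (ℤ.- e ℤ.* y ℤ.* x 0F ℤ.+ y)
        ≡⟨ lemma p f y e (x 0F) ⟩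
      (1ℤ ℤ.- (x 0F ℤ.* e ℤ.+ p ℤ.* f)) ℤ.* y
        ≡⟨ ≡.cong (λ z → (1ℤ ℤ.- z) ℤ.* y) eq ⟩
      0ℤ ∎
      where
      open ≡-Reasoning
      f = β ℤ.- α ℤ.* b
      y = x (suc j)
      lemma : ∀ p f y e x → p ℤ.* (ℤ.- f ℤ.* y) ℤ.+ (ℤ.- e ℤ.* y ℤ.* x ℤ.+ y) ≡ (1ℤ ℤ.- (x ℤ.* e ℤ.+ p ℤ.* f)) ℤ.* y
      lemma = solve-∀

    kept : ∀ e (x : Vector ℤ (2 ℕ.+ m)) → Z₀ 0F 0F ℤ.* 0ℤ ℤ.+ (minor (clear e x) ℤᵁ.⋆ x) 0F ≡ x 0F
    kept e x = ≡.trans (≡.cong₂ ℤ._+_ (ℤ.*-zeroʳ (Z₀ 0F 0F)) (ℤᵁ.sum-U (ℤᵁ.minor-U (clear-U e x)) x)) (ℤ.+-identityˡ _)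

    u v Z₁ : Matrixᶻ (3 ℕ.+ m)
    u = clear (α ℤ.* d) (col Z₀)
    v = clear (α ℤ.* a) (row Z₀)
    Z₁ = (u ℤᵁ.ᵀ) ℤᴹ.· (Z₀ ℤᴹ.· v)

    Z₀~Z₁ : Z₀ ~[ u , v ] Z₁
    Z₀~Z₁ = mk~ (clear-U (α ℤ.* d) (col Z₀)) (clear-U (α ℤ.* a) (row Z₀)) (λ _ _ → ≡.refl)

    open Descent (descend Z₀~Z₁)

    -- The Schur complement of `Z₁` with its scaling removed: below the first row the cleared column
    -- leaves -p times the entries of `Z₁`, and here the factor `p` is omitted.
    Y : Matrixᶻ (2 ℕ.+ m)
    Y zero    j = schur Z₁ zero j
    Y (suc i) j = ℤ.- Z₁ (suc (suc i)) (suc j)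

    Z₁-glued : Glued p d a Y Z₁
    Z₁-glued = record
      { corner = ≡.trans corner corner≡
      ; row₀   = ≡.trans (top 0F) (kept (α ℤ.* a) (row Z₀))
      ; row₊   = λ j → ≡.trans (top (suc j)) (cleared (α ℤ.* a) (row Z₀) unit j)
      ; col₀   = ≡.trans (left 0F) (kept (α ℤ.* d) (col Z₀))
      ; col₊   = col₊
      ; scaled = entries
      }
      where
      lemma : ∀ a d α → a ℤ.* (α ℤ.* d) ≡ d ℤ.* (α ℤ.* a)
      lemma = solve-∀
      lemma′ : ∀ x p z → 0ℤ ℤ.* x ℤ.- p ℤ.* z ≡ p ℤ.* (ℤ.- z)
      lemma′ = solve-∀
      col₊ : ∀ i → col Z₁ (suc i) ≡ 0ℤ
      col₊ i = ≡.trans (left (suc i)) (cleared (α ℤ.* d) (col Z₀) (≡.trans (≡.cong (ℤ._+ p ℤ.* (β ℤ.- α ℤ.* b)) (lemma a d α)) unit) i)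
      entries : schur Z₁ ℤᴹ.≋ ℤᵁ.scaleRows (ℤᵁ.cornerScale p) Y
      entries zero    j = ≡.sym (ℤ.*-identityˡ _)
      entries (suc i) j = ≡.trans (≡.cong₂ (λ x q → x ℤ.* row Z₁ j ℤ.- q ℤ.* Z₁ (suc (suc i)) (suc j)) (col₊ i) (≡.trans corner corner≡))
        (lemma′ (row Z₁ j) p (Z₁ (suc (suc i)) (suc j)))

    pivots-Z₁ : ∀ i → ℤᵁ.pivots Z₁ i ≡ + pivotsOf D i
    pivots-Z₁ i = ≡.trans (≡.sym (ℤᵁ.~-pivots Z₀~Z₁ i)) (rows-pivots z i)

    pivots-Y : ∀ i → ℤᵁ.pivots Y i ≡ + pivotsOf (tail D) i
    pivots-Y zero    = pivots-Z₁ 1F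
    pivots-Y (suc i) = pivots-unscale (value (D 0F)) 1 (value (D 1F)) (tail (tail D)) (schur Y) (λ i → begin
      ℤᵁ.pivots (scaled p (schur Y)) i
        ≡⟨ ℤᵁ.pivots-cong (λ i j → ≡.trans (ℤᵁ.schur-cong (Glued.scaled Z₁-glued) i j) (schur-cornerScale p Y i j)) i ⟨
      ℤᵁ.pivots (schur (schur Z₁)) i
        ≡⟨ pivots-Z₁ (suc (suc i)) ⟩
      + pivotChain (1 ℕ.* 1 ℕ.* value (D 0F)) (value (D 1F)) (tail (tail D)) i
        ≡⟨ ≡.cong (λ r → + pivotChain r (value (D 1F)) (tail (tail D)) i) (ℕ.*-comm 1 (value (D 0F))) ⟩
      + pivotChain (value (D 0F) ℕ.* 1) (value (D 1F)) (tail (tail D)) i ∎) i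
      where open ≡-Reasoning

    -- The lower row is α (a, b) with β subtracted at the end, which makes the second pivot 1 by
    -- `unit`. Gluing multiplies α a by `t`, giving `a` again modulo `p`.
    Xᵐ : Matrixᶻ 2
    Xᵐ = ℤᵁ.block p (λ _ → d) (λ _ → α ℤ.* a) (λ _ _ → α ℤ.* b ℤ.- β)

    pivots-X : ∀ i → ℤᵁ.pivots Xᵐ i ≡ + pivotsOf D₂ i
    pivots-X 0F = ≡.cong +_ (≡.sym (ℕ.*-identityˡ _))
    pivots-X 1F = ≡.trans (lemma α β a b d p) unit
      where
      lemma : ∀ α β a b d p → α ℤ.* a ℤ.* d ℤ.- p ℤ.* (α ℤ.* b ℤ.- β) ≡ d ℤ.* (α ℤ.* a) ℤ.+ p ℤ.* (β ℤ.- α ℤ.* b)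
      lemma = solve-∀

    x : C D₂
    x = cellOf D₂ Xᵐ pivots-X

    y : C (tail D)
    y = cellOf (tail D) Y pivots-Y

    z∼glue : z ∼ glue x y
    z∼glue = ~⇒∼ {x = z} {glue x y} (~ℤ-trans (_ , _ , Z₀~Z₁) (~ℤ-trans
      (glued-cong p≢0 Z₁-glued (gluedMatrix-glued x y) (≡.trans (pivots-Y zero) (≡.cong +_ (ℕ.*-identityˡ _))) (rows′-corner (ŷ y))
        (divides 0ℤ (≡.trans (≡.cong (ℤ._- d) (rows-cellOf D₂ Xᵐ pivots-X 0F 1F)) (ℤ.+-inverseʳ d)))
        (divides (ℤ.- β ℤ.* a) (begin
          t ℤ.* col (rows x) 0F ℤ.- a                ≡⟨ ≡.cong (λ c → t ℤ.* c ℤ.- a) (rows-cellOf D₂ Xᵐ pivots-X 1F 0F) ⟩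
          t ℤ.* (α ℤ.* a) ℤ.- a                      ≡⟨ lemma t α β a p ⟩
          (α ℤ.* t ℤ.+ β ℤ.* p ℤ.- 1ℤ) ℤ.* a ℤ.+ ℤ.- β ℤ.* a ℤ.* p ≡⟨ ≡.cong (λ c → (c ℤ.- 1ℤ) ℤ.* a ℤ.+ ℤ.- β ℤ.* a ℤ.* p) bézout ⟩
          0ℤ ℤ.* a ℤ.+ ℤ.- β ℤ.* a ℤ.* p             ≡⟨ ℤ.+-identityˡ _ ⟩
          ℤ.- β ℤ.* a ℤ.* p                          ∎))
        (~ℤ-trans (_ , _ , ℤᵁ.~-refl (ℤᴹ.≋-sym (rows-cellOf (tail D) Y pivots-Y))) (∼⇒~ {x = y} {ŷ y} (y∼ŷ y))))
      (rows-glue x y)))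
      where
      open ≡-Reasoning
      lemma : ∀ t α β a p → t ℤ.* (α ℤ.* a) ℤ.- a ≡ (α ℤ.* t ℤ.+ β ℤ.* p ℤ.- 1ℤ) ℤ.* a ℤ.+ ℤ.- β ℤ.* a ℤ.* p
      lemma = solve-∀

  module _ {k} (D : Vector ℕ⁺ k) (M N : Vector ℤ k) (xs : List (C D))
           (xs-enumerates : Enumerates.IsEnumeration (X D) xs) (xs-unique : Uniqueness.Unique (X D) xs) where

    sumOver : S[ M , N ⨾ D ]≔ FiniteSums.ListSums.∑ (heytingRing ℂ) (weight M N) xs
    sumOver .IsSumOver.finite = xs , xs-enumerates , xs-unique
    sumOver .IsSumOver.sum ys ys-enumerates ys-unique =
      FiniteSums.ListSums.∑-enumeration (heytingRing ℂ) (X D) (weight M N) (λ {x} {y} → weight-∼ M N {x} {y})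
        ys-enumerates ys-unique xs-enumerates xs-unique

  module _ (xs : List (C D₂)) (ys : List (C (tail D))) where

    glue-enumerates : Enumerates.IsEnumeration (X D₂) xs → Enumerates.IsEnumeration (X (tail D)) ys →
                      Enumerates.IsEnumeration (X D) (List.cartesianProductWith glue xs ys)
    glue-enumerates xs-enumerates ys-enumerates z = Any.cartesianProductWith⁺ glue
      (λ {x′} {y′} x∼x′ y∼y′ → Setoid.trans (X D) {z} {glue x y} {glue x′ y′} z∼glue (glue-cong {x} {x′} {y} {y′} x∼x′ y∼y′))
      (xs-enumerates x) (ys-enumerates y)
      where open Unglue z

    glue-unique : Uniqueness.Unique (X D₂) xs → Uniqueness.Unique (X (tail D)) ys →
                  Uniqueness.Unique (X D) (List.cartesianProductWith glue xs ys)
    glue-unique = UniquenessProperties.cartesianProductWith⁺ (X D₂) (X (tail D)) (X D) glue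
      (λ {x} {x′} {y} {y′} → glue-injective {x} {x′} {y} {y′})

    multiplicativity : Enumerates.IsEnumeration (X D₂) xs → Uniqueness.Unique (X D₂) xs →
      Enumerates.IsEnumeration (X (tail D)) ys → Uniqueness.Unique (X (tail D)) ys →
      (M N : Vector ℤ (2 ℕ.+ m)) → ∃[ s ] ∃[ s₂ ] ∃[ s′ ]
      (S[ M , N ⨾ D ]≔ s) ×
      (S[ (t ℤ.* M 0F) ∷ [] , N 0F ∷ [] ⨾ D₂ ]≔ s₂) ×
      (S[ (p ℤ.* M 1F) ∷ tail (tail M) , tail N ⨾ tail D ]≔ s′) ×
      (s ℂ.≈ s₂ ℂ.* s′)
    multiplicativity xs-enumerates xs-unique ys-enumerates ys-unique M N =
      _ , _ , _ ,
      sumOver D M N (List.cartesianProductWith glue xs ys)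
        (glue-enumerates xs-enumerates ys-enumerates) (glue-unique xs-unique ys-unique) ,
      sumOver D₂ (t ℤ.* M 0F ∷ []) (N 0F ∷ []) xs xs-enumerates xs-unique ,
      sumOver (tail D) (p ℤ.* M 1F ∷ tail (tail M)) (tail N) ys ys-enumerates ys-unique ,
      FiniteSums.ListSums.∑-product (heytingRing ℂ) glue (λ x y → weight-glue x y M N) xs ys

-- From coprimality to the product formula by a Bézout identity.

open import Data.Nat.Base using (_+_)

corollary3p10 : ∀ {a ℓ₁ ℓ₂} (E : ComplexExponential a ℓ₁ ℓ₂) → let open Kloosterman E in
    ∀ m (M N : Vector ℤ (2 + m)) (D : Vector ℕ⁺ (2 + m)) →
    gcd (value (D 0F)) (∏ (tail D)) ≡ 1 →
    ∃[ s ] ∃[ s₂ ] ∃[ s′ ]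
    (S[ M , N ⨾ D ]≔ s) ×
    (S[ (+ value (D 1F) ℤ.* M 0F) ∷ [] , N 0F ∷ [] ⨾ D 0F ∷ [] ]≔ s₂) ×
    (S[ (+ value (D 0F) ℤ.* M 1F) ∷ tail (tail M) , tail N ⨾ tail D ]≔ s′) ×
    (s ℂ.≈ s₂ ℂ.* s′)
corollary3p10 E m M N D coprime = multiplicativity (proj₁ (finite D₂)) (proj₁ (finite (tail D)))
    (proj₁ (proj₂ (finite D₂))) (proj₂ (proj₂ (finite D₂)))
    (proj₁ (proj₂ (finite (tail D)))) (proj₂ (proj₂ (finite (tail D)))) M N
  where
  identity = gcd≡1⇒bézout (value (D 0F)) (∏ (tail D)) coprime
  α = proj₁ identity
  β = proj₁ (proj₂ identity)
  -- Absorbing this product into the coefficient `α` turns the Bézout identity for D₁ and D₂D₃⋯ into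
  -- one for D₁ and D₂, the form in which the gluing takes it.
  rest = ∏ (tail (tail D))
  bézout : α ℤ.* + rest ℤ.* + value (D 1F) ℤ.+ β ℤ.* + value (D 0F) ≡ + 1
  bézout = ≡.trans (≡.cong (ℤ._+ β ℤ.* + value (D 0F)) (≡.trans (lemma α (+ rest) (+ value (D 1F)))
    (≡.cong (α ℤ.*_) (≡.sym (ℤ.pos-* (value (D 1F)) rest))))) (proj₂ (proj₂ identity))
    where
    lemma : ∀ α r t → α ℤ.* r ℤ.* t ≡ α ℤ.* (t ℤ.* r)
    lemma = solve-∀
  open Gluing E D (α ℤ.* + rest) β bézout
  open Cells E using (finite)
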